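{- For all positive integers $m,n,j,k,s,t$, the product $$\zeta(m+1,\{1\}^{j-1})\,\zeta(n+1,\{1\}^{k-1},s+1,\{1\}^{t-1})$$ equals $\Sigma_1+\Sigma_2+\Sigma_3+\Sigma_4$, where $$ \begin{aligned} \Sigma_1=&\sum_{\substack{0\le n_1\le n\\ j_1+j_2+j_3+j_4=j\\ |\alpha|=n-n_1+j_1+1\\ |\tilde\alpha|=s+j_3}}\binom{m-1+n_1}{m-1}\binom{j_2+k-1}{k-1}\binom{j_4+t-1}{t-1}\\ &\quad\times\zeta\big(\alpha_1+m+n_1,\alpha_2,\ldots,\alpha_{j_1},\alpha_{j_1+1},\{1\}^{j_2+k-1},\tilde\alpha_1+1,\tilde\alpha_2,\ldots,\tilde\alpha_{j_3},\tilde\alpha_{j_3+1},\{1\}^{j_4+t-1}\big), \end{aligned} $$ $$ \begin{aligned} \Sigma_2=&\sum_{\substack{1\le k_1\le k\\ 0\le m_1\le m-1}}\binom{m_1+n-1}{n-1}\sum_{\substack{j_1+j_2+j_3=j\\ |\beta|=m-m_1+k_1\\ |\tilde\beta|=s+j_2}}\binom{j_1+k-k_1}{k-k_1}\binom{j_3+t-1}{t-1}\\ &\quad\times\zeta\big(\beta_1+m_1+n,\beta_2,\ldots,\beta_{k_1},\beta_{k_1+1}+1,\{1\}^{j_1+k-k_1-1},\tilde\beta_1+1,\tilde\beta_2,\ldots,\tilde\beta_{j_2},\tilde\beta_{j_2+1},\{1\}^{j_3+t-1}\big), \end{aligned} $$ with the convention that when $j_1+k-k_1=0$ (that is, $j_1=0$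 and $k_1=k$) the block $\beta_{k_1+1}+1,\{1\}^{j_1+k-k_1-1},\tilde\beta_1+1$ is read as the single entry $\beta_{k_1+1}+\tilde\beta_1+1$, $$ \begin{aligned} \Sigma_3=&\sum_{\substack{1\le s_1\le s\\ m_1+m_2+m_3=m-1}}\binom{m_1+n-1}{n-1}\binom{m_3+s_1-1}{s_1-1}\sum_{\substack{j_1+j_2=j\\ |\gamma|=m_2+k+1\\ |\tilde\gamma|=s-s_1+j_1+1}}\binom{j_2+t-1}{t-1}\\ &\quad\times\zeta\big(\gamma_1+m_1+n,\gamma_2,\ldots,\gamma_k,\gamma_{k+1}+\tilde\gamma_1+m_3+s_1,\tilde\gamma_2,\ldots,\tilde\gamma_{j_1},\tilde\gamma_{j_1+1},\{1\}^{j_2+t-1}\big), \end{aligned} $$ $$ \begin{aligned} \Sigma_4=&\sum_{\substack{1\le t_1\le t\\ m_1+m_2+m_3+m_4=m-1}}\binom{m_1+n-1}{n-1}\binom{m_3+s-1}{s-1}\binom{j+t-t_1}{j}\\ &\quad\times\sum_{\substack{|\delta|=m_2+k\\ |\tilde\delta|=m_4+t_1+1}}\zeta\big(\delta_1+m_1+n,\delta_2,\ldots,\delta_k,m_3+s+\tilde\delta_1,\tilde\delta_2,\ldots,\tilde\delta_{t_1},\tilde\delta_{t_1+1}+1,\{1\}^{j+t-t_1-1}\big). \end{aligned} $$ Here all $j_i$ and $m_i$ range over integers $\ge 0$ subject to the indicated constraints, and the Greek tuples range over all tuples of integers $\ge 1$ of the following lengths with the indicated sums of entries: $\alpha=(\alpha_1,\ldots,\alpha_{j_1+1})$,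 $\tilde\alpha=(\tilde\alpha_1,\ldots,\tilde\alpha_{j_3+1})$, $\beta=(\beta_1,\ldots,\beta_{k_1+1})$, $\tilde\beta=(\tilde\beta_1,\ldots,\tilde\beta_{j_2+1})$, $\gamma=(\gamma_1,\ldots,\gamma_{k+1})$, $\tilde\gamma=(\tilde\gamma_1,\ldots,\tilde\gamma_{j_1+1})$, $\delta=(\delta_1,\ldots,\delta_k)$, $\tilde\delta=(\tilde\delta_1,\ldots,\tilde\delta_{t_1+1})$, where $|\cdot|$ denotes the sum of the entries of a tuple.
   Context: For positive integers $s_1,\ldots,s_r$ with $s_1\ge 2$, the multiple zeta value is the real number $$\zeta(s_1,\ldots,s_r)=\sum_{n_1>n_2>\cdots>n_r\ge 1}\frac{1}{n_1^{s_1}\cdots n_r^{s_r}}.$$ $\{1\}^p$ denotes the string $1,\ldots,1$ with $p$ terms (the empty string if $p=0$). Convention for short strings: a displayed string of entries indexed by a tuple of length $\ell$ contains exactly one entry for each index $1,\ldots,\ell$, the first (and, where shown, last) entry carrying the displayed shift. For example, when $j_1=0$ the string $\alpha_1+m+n_1,\alpha_2,\ldots,\alpha_{j_1},\alpha_{j_1+1}$ is the single entry $\alpha_1+m+n_1$; when $j_3=0$ (resp. $j_2=0$) the string $\tilde\alpha_1+1,\ldots,\tilde\alpha_{j_3+1}$ (resp. $\tilde\beta_1+1,\ldots,\tilde\beta_{j_2+1}$) is the single entry $\tilde\alpha_1+1$ (resp. $\tilde\beta_1+1$); when $j_1=0$ in $\Sigma_3$ the string $\tilde\gamma_2,\ldots,\tilde\gamma_{j_1+1}$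 is empty; when $k=1$ the string $\delta_1+m_1+n,\delta_2,\ldots,\delta_k$ is the single entry $\delta_1+m_1+n$. -}

module Defs where

open import Data.Integer as ℤ using (+_; +[1+_]; -[1+_]; +0)
import Data.Integer.Properties as ℤ
open import Data.List.Base as List
  using (List; []; _∷_; [_]; _++_; map; concatMap; foldr; length; replicate; upTo)
open import Data.Nat as ℕ using (ℕ; zero; suc; NonZero; NonTrivial; _∸_; _^_)
import Data.Nat.Properties as ℕ
open import Data.Product using (∃; _×_; _,_; proj₁; proj₂)
open import Data.Rational as ℚ using (ℚ; mkℚ; 0ℚ; 1ℚ; ½; toℚᵘ; fromℚᵘ)
import Data.Rational.Properties as ℚ
open import Data.Rational.Solver using (module +-*-Solver)
open import Data.Rational.Unnormalised as ℚᵘ using (mkℚᵘ)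
import Data.Rational.Unnormalised.Properties as ℚᵘ
open import Data.Sum using (_⊎_; inj₁; inj₂)
open import Data.Vec.Base as Vec using (Vec; []; _∷_; head; tail; init; last; toList)
open import Relation.Binary.PropositionalEquality hiding ([_])

-- Reals are Cauchy sequences of rationals; two are equal when their difference
-- tends to 0.

infix 4 _≃_
infixl 6 _+ᴿ_
infixl 7 _*ᴿ_ _·_

IsCauchy : (ℕ → ℚ) → Set
IsCauchy x = ∀ ε → 0ℚ ℚ.< ε →
  ∃ λ N → ∀ m n → N ℕ.≤ m → N ℕ.≤ n → ℚ.∣ x m ℚ.- x n ∣ ℚ.< ε

record ℝ : Set where
  constructor mkℝ
  field
    seq    : ℕ → ℚ
    cauchy : IsCauchy seq

open ℝ public

_≃_ : ℝ → ℝ → Set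
x ≃ y = ∀ ε → 0ℚ ℚ.< ε →
  ∃ λ N → ∀ n → N ℕ.≤ n → ℚ.∣ seq x n ℚ.- seq y n ∣ ℚ.< ε

module RealArithmetic where
  open import Data.Rational.Base using (_+_; _*_; _-_; -_; ∣_∣; _≤_; _<_)
  open +-*-Solver using (solve; _:=_; _:+_; _:*_; _:-_; :-_; con)

  halves : ∀ ε → ε * ½ + ε * ½ ≡ ε
  halves = solve 1 (λ e → e :* con ½ :+ e :* con ½ := e) refl

  +-diff : ∀ a b c d → (a + b) - (c + d) ≡ (a - c) + (b - d)
  +-diff = solve 4 (λ a b c d → (a :+ b) :- (c :+ d) := (a :- c) :+ (b :- d)) refl

  *-diff : ∀ a b c d → a * b - c * d ≡ a * (b - d) + d * (a - c)
  *-diff = solve 4 (λ a b c d → a :* b :- c :* d := a :* (b :- d) :+ d :* (a :- c)) refl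

  sub-add : ∀ a b → a ≡ (a - b) + b
  sub-add = solve 2 (λ a b → a := (a :- b) :+ b) refl

  *-pos : ∀ {p q} → 0ℚ < p → 0ℚ < q → 0ℚ < p * q
  *-pos {p} {q} p>0 q>0 = ℚ.positive⁻¹ (p * q)
    {{ℚ.pos*pos⇒pos p {{ℚ.positive p>0}} q {{ℚ.positive q>0}}}}

  *-nonNeg : ∀ {p q} → 0ℚ ≤ p → 0ℚ ≤ q → 0ℚ ≤ p * q
  *-nonNeg {p} {q} p≥0 q≥0 = ℚ.nonNegative⁻¹ (p * q)
    {{ℚ.nonNeg*nonNeg⇒nonNeg p {{ℚ.nonNegative p≥0}} q {{ℚ.nonNegative q≥0}}}}

  +-nonNeg : ∀ {p q} → 0ℚ ≤ p → 0ℚ ≤ q → 0ℚ ≤ p + q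
  +-nonNeg {p} {q} p≥0 q≥0 = ℚ.nonNegative⁻¹ (p + q)
    {{ℚ.nonNeg+nonNeg⇒nonNeg p {{ℚ.nonNegative p≥0}} q {{ℚ.nonNegative q≥0}}}}

  half-pos : ∀ {ε} → 0ℚ < ε → 0ℚ < ε * ½
  half-pos ε>0 = *-pos ε>0 (ℚ.positive⁻¹ ½)

  0<1 : 0ℚ < 1ℚ
  0<1 = ℚ.positive⁻¹ 1ℚ

  0≤1 : 0ℚ ≤ 1ℚ
  0≤1 = ℚ.nonNegative⁻¹ 1ℚ

  *-mono-≤ : ∀ {p q r s} → 0ℚ ≤ p → 0ℚ ≤ s → p ≤ q → r ≤ s → p * r ≤ q * s
  *-mono-≤ {p} {q} {r} {s} p≥0 s≥0 p≤q r≤s =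
    ℚ.≤-trans (ℚ.*-monoˡ-≤-nonNeg p {{ℚ.nonNegative p≥0}} r≤s)
              (ℚ.*-monoʳ-≤-nonNeg s {{ℚ.nonNegative s≥0}} p≤q)

  +-cauchy : ∀ x y → IsCauchy x → IsCauchy y → IsCauchy (λ n → x n + y n)
  +-cauchy x y cx cy ε ε>0 with cx (ε * ½) (half-pos ε>0) | cy (ε * ½) (half-pos ε>0)
  ... | N , x< | M , y< = N ℕ.⊔ M , λ m n N≤m N≤n → begin-strict
    ∣ (x m + y m) - (x n + y n) ∣
      ≡⟨ cong ∣_∣ (+-diff (x m) (y m) (x n) (y n)) ⟩
    ∣ (x m - x n) + (y m - y n) ∣
      ≤⟨ ℚ.∣p+q∣≤∣p∣+∣q∣ (x m - x n) (y m - y n) ⟩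
    ∣ x m - x n ∣ + ∣ y m - y n ∣
      <⟨ ℚ.+-mono-< (x< m n (ℕ.m⊔n≤o⇒m≤o N M N≤m) (ℕ.m⊔n≤o⇒m≤o N M N≤n))
                    (y< m n (ℕ.m⊔n≤o⇒n≤o N M N≤m) (ℕ.m⊔n≤o⇒n≤o N M N≤n)) ⟩
    ε * ½ + ε * ½
      ≡⟨ halves ε ⟩
    ε ∎
    where open ℚ.≤-Reasoning

  bounded : ∀ {x} → IsCauchy x →
            ∃ λ B → 0ℚ ≤ B × ∃ λ N → ∀ n → N ℕ.≤ n → ∣ x n ∣ ≤ B
  bounded {x} cx with cx 1ℚ 0<1
  ... | N , x< = 1ℚ + ∣ x N ∣ , +-nonNeg 0≤1 (ℚ.0≤∣p∣ (x N)) , N , λ n N≤n → begin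
    ∣ x n ∣
      ≡⟨ cong ∣_∣ (sub-add (x n) (x N)) ⟩
    ∣ (x n - x N) + x N ∣
      ≤⟨ ℚ.∣p+q∣≤∣p∣+∣q∣ (x n - x N) (x N) ⟩
    ∣ x n - x N ∣ + ∣ x N ∣
      ≤⟨ ℚ.+-monoˡ-≤ ∣ x N ∣ (ℚ.<⇒≤ (x< n N N≤n ℕ.≤-refl)) ⟩
    1ℚ + ∣ x N ∣ ∎
    where open ℚ.≤-Reasoning

  cancel : ∀ a b → (a + b) - a ≡ b
  cancel = solve 2 (λ a b → (a :+ b) :- a := b) refl

  rearrange : ∀ a b c d → a * (b + c * d) ≡ b * a + c * (a * d)
  rearrange = solve 4 (λ a b c d → a :* (b :+ c :* d) := b :* a :+ c :* (a :* d)) refl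

  rearrange-suc : ∀ a e k → (a + e * k) + e ≡ a + e * (1ℚ + k)
  rearrange-suc = solve 3 (λ a e k → (a :+ e :* k) :+ e := a :+ e :* (con 1ℚ :+ k)) refl

  rearrange-half : ∀ a b e k → (a + e * ½ * k) + (b + e * ½ * k) ≡ (a + b) + e * k
  rearrange-half = solve 4 (λ a b e k →
    (a :+ e :* con ½ :* k) :+ (b :+ e :* con ½ :* k) := (a :+ b) :+ e :* k) refl

  rearrange-step : ∀ e x y z → e * e * x + e * (y + (x + e * z)) ≡ (e * e * z + e * y) + (e * e + e) * x
  rearrange-step = solve 4 (λ e x y z →
    e :* e :* x :+ e :* (y :+ (x :+ e :* z)) := (e :* e :* z :+ e :* y) :+ (e :* e :+ e) :* x) refl

  ∣-∣-comm : ∀ a b → ∣ a - b ∣ ≡ ∣ b - a ∣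
  ∣-∣-comm a b = trans (sym (ℚ.∣-p∣≡∣p∣ (a - b)))
    (cong ∣_∣ (solve 2 (λ a b → :- (a :- b) := b :- a) refl a b))

  scale : ∀ A → 0ℚ ≤ A → ∀ ε → 0ℚ < ε → ∃ λ η → 0ℚ < η × A * η < ε
  scale A A≥0 ε ε>0 = go (1ℚ + A) (ℚ.<-≤-trans 0<1 1≤D) (ℚ.+-comm 1ℚ A)
    where
    1≤D : 1ℚ ≤ 1ℚ + A
    1≤D = subst (_≤ 1ℚ + A) (ℚ.+-identityʳ 1ℚ) (ℚ.+-monoʳ-≤ 1ℚ A≥0)
    go : ∀ D → 0ℚ < D → D ≡ A + 1ℚ → ∃ λ η → 0ℚ < η × A * η < ε
    go D D>0 D≡ = η , η>0 , (begin-strict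
      A * η            ≡⟨ ℚ.+-identityʳ (A * η) ⟨
      A * η + 0ℚ       <⟨ ℚ.+-monoʳ-< (A * η) η>0 ⟩
      A * η + η        ≡⟨ cong (λ z → A * η + z) (ℚ.*-identityˡ η) ⟨
      A * η + 1ℚ * η   ≡⟨ ℚ.*-distribʳ-+ η A 1ℚ ⟨
      (A + 1ℚ) * η     ≡⟨ cong (_* η) D≡ ⟨
      D * η            ≡⟨ ℚ.*-assoc D (ℚ.1/ D) ε ⟨
      D * (ℚ.1/ D) * ε ≡⟨ cong (_* ε) (ℚ.*-inverseʳ D) ⟩
      1ℚ * ε           ≡⟨ ℚ.*-identityˡ ε ⟩
      ε                ∎)
      where
      open ℚ.≤-Reasoning
      instance
        D-pos : ℚ.Positive D
        D-pos = ℚ.positive D>0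
        D-nonZero : ℚ.NonZero D
        D-nonZero = ℚ.pos⇒nonZero D
      η : ℚ
      η = (ℚ.1/ D) * ε
      η>0 : 0ℚ < η
      η>0 = *-pos (ℚ.positive⁻¹ (ℚ.1/ D) {{ℚ.1/pos⇒pos D}}) ε>0

  *-cauchy : ∀ x y → IsCauchy x → IsCauchy y → IsCauchy (λ n → x n * y n)
  *-cauchy x y cx cy ε ε>0 = go (bounded cx) (bounded cy)
    where
    open ℚ.≤-Reasoning
    Bound : (ℕ → ℚ) → Set
    Bound z = ∃ λ B → 0ℚ ≤ B × ∃ λ N → ∀ n → N ℕ.≤ n → ∣ z n ∣ ≤ B
    Close : (ℕ → ℚ) → ℚ → Set
    Close z η = ∃ λ N → ∀ m n → N ℕ.≤ m → N ℕ.≤ n → ∣ z m - z n ∣ < η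
    go : Bound x → Bound y → Close (λ n → x n * y n) ε
    go (A , A≥0 , K , x≤A) (B , B≥0 , L , y≤B) = go′ (scale (A + B) (+-nonNeg A≥0 B≥0) ε ε>0)
     where
     go″ : ∀ η → 0ℚ < η → (A + B) * η < ε → Close x η → Close y η → Close (λ n → x n * y n) ε
     go″ η η>0 η< (N , x<) (M , y<) = (K ℕ.⊔ L) ℕ.⊔ (N ℕ.⊔ M) , λ m n h h′ →
      let KL≤m = ℕ.m⊔n≤o⇒m≤o (K ℕ.⊔ L) (N ℕ.⊔ M) h
          NM≤m = ℕ.m⊔n≤o⇒n≤o (K ℕ.⊔ L) (N ℕ.⊔ M) h
          KL≤n = ℕ.m⊔n≤o⇒m≤o (K ℕ.⊔ L) (N ℕ.⊔ M) h′
          NM≤n = ℕ.m⊔n≤o⇒n≤o (K ℕ.⊔ L) (N ℕ.⊔ M) h′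
      in begin-strict
      ∣ x m * y m - x n * y n ∣
        ≡⟨ cong ∣_∣ (*-diff (x m) (y m) (x n) (y n)) ⟩
      ∣ x m * (y m - y n) + y n * (x m - x n) ∣
        ≤⟨ ℚ.∣p+q∣≤∣p∣+∣q∣ (x m * (y m - y n)) (y n * (x m - x n)) ⟩
      ∣ x m * (y m - y n) ∣ + ∣ y n * (x m - x n) ∣
        ≡⟨ cong₂ _+_ (ℚ.∣p*q∣≡∣p∣*∣q∣ (x m) (y m - y n)) (ℚ.∣p*q∣≡∣p∣*∣q∣ (y n) (x m - x n)) ⟩
      ∣ x m ∣ * ∣ y m - y n ∣ + ∣ y n ∣ * ∣ x m - x n ∣
        ≤⟨ ℚ.+-mono-≤
             (*-mono-≤ (ℚ.0≤∣p∣ (x m)) (ℚ.<⇒≤ η>0) (x≤A m (ℕ.m⊔n≤o⇒m≤o K L KL≤m))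
               (ℚ.<⇒≤ (y< m n (ℕ.m⊔n≤o⇒n≤o N M NM≤m) (ℕ.m⊔n≤o⇒n≤o N M NM≤n))))
             (*-mono-≤ (ℚ.0≤∣p∣ (y n)) (ℚ.<⇒≤ η>0) (y≤B n (ℕ.m⊔n≤o⇒n≤o K L KL≤n))
               (ℚ.<⇒≤ (x< m n (ℕ.m⊔n≤o⇒m≤o N M NM≤m) (ℕ.m⊔n≤o⇒m≤o N M NM≤n)))) ⟩
      A * η + B * η
        ≡⟨ ℚ.*-distribʳ-+ η A B ⟨
      (A + B) * η
        <⟨ η< ⟩
      ε ∎
     go′ : (∃ λ η → 0ℚ < η × (A + B) * η < ε) → Close (λ n → x n * y n) ε
     go′ (η , η>0 , η<) = go″ η η>0 η< (cx η η>0) (cy η η>0)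

  const-cauchy : ∀ q → IsCauchy (λ _ → q)
  const-cauchy q ε ε>0 = 0 , λ _ _ _ _ → ℚ.≤-<-trans (ℚ.≤-reflexive (cong ∣_∣ (ℚ.+-inverseʳ q))) ε>0

open RealArithmetic

_+ᴿ_ : ℝ → ℝ → ℝ
x +ᴿ y = mkℝ (λ n → seq x n ℚ.+ seq y n) (+-cauchy (seq x) (seq y) (cauchy x) (cauchy y))

_*ᴿ_ : ℝ → ℝ → ℝ
x *ᴿ y = mkℝ (λ n → seq x n ℚ.* seq y n) (*-cauchy (seq x) (seq y) (cauchy x) (cauchy y))

fromℚ : ℚ → ℝ
fromℚ q = mkℝ (λ _ → q) (const-cauchy q)

_·_ : ℕ → ℝ → ℝ
c · x = fromℚ (+ c ℚ./ 1) *ᴿ x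

∑ : {A : Set} → List A → (A → ℝ) → ℝ
∑ xs f = foldr (λ a x → f a +ᴿ x) (fromℚ 0ℚ) xs

record ℕ⁺ : Set where
  constructor pos
  field
    value           : ℕ
    .{{isNonZero}} : NonZero value

open ℕ⁺ public using (value)

infixl 6 _⊕_

_⊕_ : ℕ⁺ → ℕ → ℕ⁺
pos a ⊕ d = pos (a ℕ.+ d) {{ℕ.>-nonZero (ℕ.≤-trans (ℕ.>-nonZero⁻¹ a) (ℕ.m≤m+n a d))}}

ones : ℕ → List ℕ⁺
ones p = replicate p (pos 1)

-- recipPow p s = 1 / n^s for n = suc p
recipPow : ℕ → ℕ → ℚ
recipPow p s = (+ 1 ℚ./ (suc p ^ s)) {{ℕ.m^n≢0 (suc p) s}}

-- The sum of 1 / (n₁^s₁ ⋯ nᵣ^sᵣ) over N ≥ n₁ > n₂ > ⋯ > nᵣ ≥ 1; the terms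
-- with n₁ = suc N are split off in the last clause.
truncated : List ℕ⁺ → ℕ → ℚ
truncated []       N       = 1ℚ
truncated (s ∷ ss) zero    = 0ℚ
truncated (s ∷ ss) (suc N) =
  truncated (s ∷ ss) N ℚ.+ recipPow N (value s) ℚ.* truncated ss N

module Convergence where
  open import Data.Rational.Base using (_+_; _*_; _-_; -_; ∣_∣; _≤_; _<_)
  open import Data.Integer.Solver renaming (module +-*-Solver to ℤ-Solver)
  open import Function.Base using (_∘_)
  open ℚ.≤-Reasoning

  fromℚᵘ-+ : ∀ p q → fromℚᵘ (p ℚᵘ.+ q) ≡ fromℚᵘ p + fromℚᵘ q
  fromℚᵘ-+ p q = ℚ.toℚᵘ-injective (ℚᵘ.≃-trans (ℚ.toℚᵘ-fromℚᵘ (p ℚᵘ.+ q)) (ℚᵘ.≃-sym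
    (ℚᵘ.≃-trans (ℚ.toℚᵘ-homo-+ (fromℚᵘ p) (fromℚᵘ q))
                (ℚᵘ.+-cong (ℚ.toℚᵘ-fromℚᵘ p) (ℚ.toℚᵘ-fromℚᵘ q)))))

  fromℚᵘ-* : ∀ p q → fromℚᵘ (p ℚᵘ.* q) ≡ fromℚᵘ p * fromℚᵘ q
  fromℚᵘ-* p q = ℚ.toℚᵘ-injective (ℚᵘ.≃-trans (ℚ.toℚᵘ-fromℚᵘ (p ℚᵘ.* q)) (ℚᵘ.≃-sym
    (ℚᵘ.≃-trans (ℚ.toℚᵘ-homo-* (fromℚᵘ p) (fromℚᵘ q))
                (ℚᵘ.*-cong (ℚ.toℚᵘ-fromℚᵘ p) (ℚ.toℚᵘ-fromℚᵘ q)))))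

  fromℚᵘ-mono-≤ : ∀ {p q} → p ℚᵘ.≤ q → fromℚᵘ p ≤ fromℚᵘ q
  fromℚᵘ-mono-≤ {p} {q} p≤q = ℚ.toℚᵘ-cancel-≤
    (ℚᵘ.≤-respˡ-≃ (ℚᵘ.≃-sym (ℚ.toℚᵘ-fromℚᵘ p)) (ℚᵘ.≤-respʳ-≃ (ℚᵘ.≃-sym (ℚ.toℚᵘ-fromℚᵘ q)) p≤q))

  fromℚᵘ-mono-< : ∀ {p q} → p ℚᵘ.< q → fromℚᵘ p < fromℚᵘ q
  fromℚᵘ-mono-< {p} {q} p<q = ℚ.toℚᵘ-cancel-<
    (ℚᵘ.<-respˡ-≃ (ℚᵘ.≃-sym (ℚ.toℚᵘ-fromℚᵘ p)) (ℚᵘ.<-respʳ-≃ (ℚᵘ.≃-sym (ℚ.toℚᵘ-fromℚᵘ q)) p<q))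

  ι : ℕ → ℚ
  ι n = + n ℚ./ 1

  recip : (n : ℕ) → .{{_ : NonZero n}} → ℚ
  recip n = + 1 ℚ./ n

  δ : ℕ → ℚ
  δ n = recip (suc n)

  recip-≥0 : ∀ n .{{_ : NonZero n}} → 0ℚ ≤ recip n
  recip-≥0 (suc n) = fromℚᵘ-mono-≤ {mkℚᵘ (+ 0) 0} {mkℚᵘ (+ 1) n} (ℚᵘ.*≤* (ℤ.+≤+ ℕ.z≤n))

  recip-anti : ∀ {m n} .{{_ : NonZero m}} .{{_ : NonZero n}} → m ℕ.≤ n → recip n ≤ recip m
  recip-anti {suc m} {suc n} m≤n = fromℚᵘ-mono-≤ {mkℚᵘ (+ 1) n} {mkℚᵘ (+ 1) m}
    (ℚᵘ.*≤* (subst₂ ℤ._≤_ (sym (ℤ.*-identityˡ (+ suc m))) (sym (ℤ.*-identityˡ (+ suc n))) (ℤ.+≤+ m≤n)))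

  δ*δ : ∀ n → δ n * δ n ≡ recip (suc n ℕ.* suc n)
  δ*δ n = sym (fromℚᵘ-* (mkℚᵘ (+ 1) n) (mkℚᵘ (+ 1) n))

  δ-anti : ∀ n → δ (suc n) ≤ δ n
  δ-anti n = recip-anti (ℕ.n≤1+n (suc n))

  ι≥0 : ∀ n → 0ℚ ≤ ι n
  ι≥0 n = fromℚᵘ-mono-≤ {mkℚᵘ (+ 0) 0} {mkℚᵘ (+ n) 0} (ℚᵘ.*≤* (ℤ.*-monoʳ-≤-nonNeg (+ 1) (ℤ.+≤+ (ℕ.z≤n {n}))))

  ι-suc : ∀ n → ι (suc n) ≡ 1ℚ + ι n
  ι-suc n = trans (ℚ.fromℚᵘ-cong {mkℚᵘ (+ suc n) 0} {mkℚᵘ (+ 1) 0 ℚᵘ.+ mkℚᵘ (+ n) 0}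
    (ℚᵘ.*≡* (cong (ℤ._* + 1) (cong (λ z → + 1 ℤ.+ z) (sym (ℤ.*-identityʳ (+ n)))))))
    (fromℚᵘ-+ (mkℚᵘ (+ 1) 0) (mkℚᵘ (+ n) 0))

  ι≤ι-suc : ∀ n → ι n ≤ ι (suc n)
  ι≤ι-suc n = begin
    ι n       ≡⟨ ℚ.+-identityˡ (ι n) ⟨
    0ℚ + ι n  ≤⟨ ℚ.+-monoˡ-≤ (ι n) 0≤1 ⟩
    1ℚ + ι n  ≡⟨ ι-suc n ⟨
    ι (suc n) ∎

  δ*ι : ∀ n → δ n * ι (suc n) ≡ 1ℚ
  δ*ι n = trans (sym (fromℚᵘ-* (mkℚᵘ (+ 1) n) (mkℚᵘ (+ suc n) 0)))
    (ℚ.fromℚᵘ-cong {mkℚᵘ (+ 1) n ℚᵘ.* mkℚᵘ (+ suc n) 0} {mkℚᵘ (+ 1) 0}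
      (ℚᵘ.*≡* (trans (ℤ.*-identityʳ (+ 1 ℤ.* + suc n)) (cong (λ z → + 1 ℤ.* + suc z) (sym (ℕ.*-identityʳ n))))))

  telescope : ∀ n → δ (suc n) + δ n * δ (suc n) ≡ δ n
  telescope n = trans (cong (λ z → δ (suc n) + z) (sym (fromℚᵘ-* d e)))
    (trans (sym (fromℚᵘ-+ e (d ℚᵘ.* e)))
      (ℚ.fromℚᵘ-cong {e ℚᵘ.+ d ℚᵘ.* e} {d} (ℚᵘ.*≡* (solve 1 (λ a →
        ((con (+ 1) :* ((con (+ 1) :+ a) :* (con (+ 2) :+ a)) :+ con (+ 1) :* (con (+ 2) :+ a)) :* (con (+ 1) :+ a))
        := con (+ 1) :* ((con (+ 2) :+ a) :* ((con (+ 1) :+ a) :* (con (+ 2) :+ a)))) refl (+ n)))))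
    where
    open ℤ-Solver using (solve; _:=_; _:+_; _:*_; con)
    d = mkℚᵘ (+ 1) n
    e = mkℚᵘ (+ 1) (suc n)

  δ-step : ∀ n → δ (suc n) * δ (suc n) + δ (suc n) ≤ δ n
  δ-step n = begin
    δ (suc n) * δ (suc n) + δ (suc n)
      ≤⟨ ℚ.+-monoˡ-≤ (δ (suc n)) (*-mono-≤ (recip-≥0 (2 ℕ.+ n)) (recip-≥0 (2 ℕ.+ n)) (δ-anti n) ℚ.≤-refl) ⟩
    δ n * δ (suc n) + δ (suc n)
      ≡⟨ ℚ.+-comm (δ n * δ (suc n)) (δ (suc n)) ⟩
    δ (suc n) + δ n * δ (suc n)
      ≡⟨ telescope n ⟩
    δ n ∎

  archimedean : ∀ C ε → 0ℚ < ε → ∃ λ N → ∀ n → N ℕ.≤ n → C * δ n < ε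
  archimedean C@(mkℚ c d _) ε@(mkℚ (+ 0) b _) (ℚ.*<* (ℤ.+<+ ()))
  archimedean C@(mkℚ c d _) ε@(mkℚ -[1+ a ] b _) (ℚ.*<* ())
  archimedean C@(mkℚ c d _) ε@(mkℚ +[1+ a ] b _) _ = ℤ.∣ c ∣ ℕ.* suc b , λ n N≤n → begin-strict
    C * δ n               ≤⟨ ℚ.*-monoʳ-≤-nonNeg (δ n) {{ℚ.nonNegative (recip-≥0 (suc n))}} C≤ ⟩
    ι ℤ.∣ c ∣ * δ n       ≡⟨ fromℚᵘ-* (mkℚᵘ (+ ℤ.∣ c ∣) 0) (mkℚᵘ (+ 1) n) ⟨
    fromℚᵘ (mkℚᵘ (+ ℤ.∣ c ∣) 0 ℚᵘ.* mkℚᵘ (+ 1) n)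
                          <⟨ fromℚᵘ-mono-< {mkℚᵘ (+ ℤ.∣ c ∣) 0 ℚᵘ.* mkℚᵘ (+ 1) n} {toℚᵘ ε} (bound n N≤n) ⟩
    fromℚᵘ (toℚᵘ ε)       ≡⟨ ℚ.fromℚᵘ-toℚᵘ ε ⟩
    ε                     ∎
    where
    abs-bound : ∀ i → i ℤ.≤ + ℤ.∣ i ∣
    abs-bound (+ n)    = ℤ.≤-refl
    abs-bound -[1+ n ] = ℤ.-≤+
    C≤ : C ≤ ι ℤ.∣ c ∣
    C≤ = subst (_≤ ι ℤ.∣ c ∣) (ℚ.fromℚᵘ-toℚᵘ C) (fromℚᵘ-mono-≤ {mkℚᵘ c d} {mkℚᵘ (+ ℤ.∣ c ∣) 0}
      (ℚᵘ.*≤* (ℤ.≤-trans (ℤ.≤-reflexive (ℤ.*-identityʳ c)) (ℤ.≤-trans (abs-bound c)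
        (subst (+ ℤ.∣ c ∣ ℤ.≤_) (ℤ.pos-* ℤ.∣ c ∣ (suc d)) (ℤ.+≤+ (ℕ.m≤m*n ℤ.∣ c ∣ (suc d))))))))
    bound : ∀ n → ℤ.∣ c ∣ ℕ.* suc b ℕ.≤ n → (mkℚᵘ (+ ℤ.∣ c ∣) 0 ℚᵘ.* mkℚᵘ (+ 1) n) ℚᵘ.< mkℚᵘ +[1+ a ] b
    bound n N≤n = ℚᵘ.*<* (subst₂ ℤ._<_
      (trans (ℤ.pos-* ℤ.∣ c ∣ (suc b)) (cong (ℤ._* + suc b) (sym (ℤ.*-identityʳ (+ ℤ.∣ c ∣)))))
      (cong (λ z → +[1+ a ] ℤ.* + suc z) (sym (ℕ.+-identityʳ n)))
      (ℤ.+<+ (ℕ.<-≤-trans (ℕ.s≤s N≤n) (ℕ.m≤m+n (suc n) (a ℕ.* suc n)))))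

  monotone : ∀ {f : ℕ → ℚ} → (∀ n → f n ≤ f (suc n)) → ∀ {m n} → m ℕ.≤′ n → f m ≤ f n
  monotone step ℕ.≤′-refl             = ℚ.≤-refl
  monotone step (ℕ.≤′-step {n} m≤n) = ℚ.≤-trans (monotone step m≤n) (step n)

  antitone : ∀ {f : ℕ → ℚ} → (∀ n → f (suc n) ≤ f n) → ∀ {m n} → m ℕ.≤′ n → f n ≤ f m
  antitone step ℕ.≤′-refl             = ℚ.≤-refl
  antitone step (ℕ.≤′-step {n} m≤n) = ℚ.≤-trans (step n) (antitone step m≤n)

  ≤-+ˡ : ∀ p {q} → 0ℚ ≤ q → p ≤ p + q
  ≤-+ˡ p {q} q≥0 = begin
    p       ≡⟨ ℚ.+-identityʳ p ⟨
    p + 0ℚ  ≤⟨ ℚ.+-monoʳ-≤ p q≥0 ⟩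
    p + q   ∎

  0≤q-p : ∀ {p q} → p ≤ q → 0ℚ ≤ q - p
  0≤q-p {p} {q} p≤q = subst (_≤ q - p) (ℚ.+-inverseʳ p) (ℚ.+-monoˡ-≤ (- p) p≤q)

  -- h r N = truncated (ones r) N bounds every truncated sum of depth r.
  h : ℕ → ℕ → ℚ
  h zero    N       = 1ℚ
  h (suc r) zero    = 0ℚ
  h (suc r) (suc N) = h (suc r) N + δ N * h r N

  h≥0 : ∀ r N → 0ℚ ≤ h r N
  h≥0 zero    N       = 0≤1
  h≥0 (suc r) zero    = ℚ.≤-refl
  h≥0 (suc r) (suc N) = +-nonNeg (h≥0 (suc r) N) (*-nonNeg (recip-≥0 (suc N)) (h≥0 r N))

  h-step : ∀ r N → h r N ≤ h r (suc N)
  h-step zero    N = ℚ.≤-refl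
  h-step (suc r) N = ≤-+ˡ (h (suc r) N) (*-nonNeg (recip-≥0 (suc N)) (h≥0 r N))

  recipPow≥0 : ∀ p s → 0ℚ ≤ recipPow p s
  recipPow≥0 p s = recip-≥0 (suc p ^ s) {{ℕ.m^n≢0 (suc p) s}}

  recipPow-anti : ∀ p {s t} → s ℕ.≤ t → recipPow p t ≤ recipPow p s
  recipPow-anti p {s} {t} s≤t =
    recip-anti {suc p ^ s} {suc p ^ t} {{ℕ.m^n≢0 (suc p) s}} {{ℕ.m^n≢0 (suc p) t}} (ℕ.^-monoʳ-≤ (suc p) s≤t)

  recip-cong : ∀ {m n} .{{_ : NonZero m}} .{{_ : NonZero n}} → m ≡ n → recip m ≡ recip n
  recip-cong refl = refl

  recipPow-1 : ∀ p → recipPow p 1 ≡ δ p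
  recipPow-1 p = recip-cong {suc p ^ 1} {suc p} {{ℕ.m^n≢0 (suc p) 1}} (ℕ.*-identityʳ (suc p))

  recipPow-2 : ∀ p → recipPow p 2 ≡ δ p * δ p
  recipPow-2 p = trans
    (recip-cong {suc p ^ 2} {suc p ℕ.* suc p} {{ℕ.m^n≢0 (suc p) 2}}
      (cong (suc p ℕ.*_) (ℕ.*-identityʳ (suc p))))
    (sym (δ*δ p))

  recipPow≤δ : ∀ p (s : ℕ⁺) → recipPow p (value s) ≤ δ p
  recipPow≤δ p (pos (suc s)) =
    ℚ.≤-trans (recipPow-anti p {1} {suc s} (ℕ.s≤s ℕ.z≤n)) (ℚ.≤-reflexive (recipPow-1 p))

  truncated≥0 : ∀ ss N → 0ℚ ≤ truncated ss N
  truncated≥0 []       N       = 0≤1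
  truncated≥0 (s ∷ ss) zero    = ℚ.≤-refl
  truncated≥0 (s ∷ ss) (suc N) =
    +-nonNeg (truncated≥0 (s ∷ ss) N) (*-nonNeg (recipPow≥0 N (value s)) (truncated≥0 ss N))

  truncated≤h : ∀ ss N → truncated ss N ≤ h (length ss) N
  truncated≤h []       N       = ℚ.≤-refl
  truncated≤h (s ∷ ss) zero    = ℚ.≤-refl
  truncated≤h (s ∷ ss) (suc N) = ℚ.+-mono-≤ (truncated≤h (s ∷ ss) N)
    (*-mono-≤ (recipPow≥0 N (value s)) (h≥0 (length ss) N) (recipPow≤δ N s) (truncated≤h ss N))

  Sublinear : (ℕ → ℚ) → Set
  Sublinear f = ∀ ε → 0ℚ < ε → ∃ λ C → ∀ n → f n ≤ C + ε * ι n

  δ-sublinear : ∀ {f} → Sublinear f → ∀ ε → 0ℚ < ε →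
                ∃ λ N → ∀ n → N ℕ.≤ n → δ n * f (suc n) < ε
  δ-sublinear {f} sub ε ε>0 = go (sub (ε * ½) (half-pos ε>0))
    where
    go : (∃ λ C → ∀ n → f n ≤ C + ε * ½ * ι n) → ∃ λ N → ∀ n → N ℕ.≤ n → δ n * f (suc n) < ε
    go (C , f≤) = go′ (archimedean C (ε * ½) (half-pos ε>0))
      where
      go′ : (∃ λ N → ∀ n → N ℕ.≤ n → C * δ n < ε * ½) → ∃ λ N → ∀ n → N ℕ.≤ n → δ n * f (suc n) < ε
      go′ (N , small) = N , λ n N≤n → begin-strict
        δ n * f (suc n)
          ≤⟨ ℚ.*-monoˡ-≤-nonNeg (δ n) {{ℚ.nonNegative (recip-≥0 (suc n))}} (f≤ (suc n)) ⟩
        δ n * (C + ε * ½ * ι (suc n))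
          ≡⟨ rearrange (δ n) C (ε * ½) (ι (suc n)) ⟩
        C * δ n + ε * ½ * (δ n * ι (suc n))
          ≡⟨ cong (λ z → C * δ n + ε * ½ * z) (δ*ι n) ⟩
        C * δ n + ε * ½ * 1ℚ
          ≡⟨ cong (λ z → C * δ n + z) (ℚ.*-identityʳ (ε * ½)) ⟩
        C * δ n + ε * ½
          <⟨ ℚ.+-monoˡ-< (ε * ½) (small n N≤n) ⟩
        ε * ½ + ε * ½
          ≡⟨ halves ε ⟩
        ε ∎

  h-sublinear : ∀ r → Sublinear (h r)
  h-sublinear zero    ε ε>0 = 1ℚ , λ n → ≤-+ˡ 1ℚ (*-nonNeg (ℚ.<⇒≤ ε>0) (ι≥0 n))
  h-sublinear (suc r) ε ε>0 = go (δ-sublinear (h-sublinear r) ε ε>0)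
    where
    go : (∃ λ N → ∀ n → N ℕ.≤ n → δ n * h r (suc n) < ε) → ∃ λ C → ∀ n → h (suc r) n ≤ C + ε * ι n
    go (N , small) = h (suc r) N , λ n →
      ℚ.≤-trans (monotone (h-step (suc r)) (ℕ.≤⇒≤′ (ℕ.m≤m+n n N))) (tail-bound n)
      where
      tail-bound : ∀ k → h (suc r) (k ℕ.+ N) ≤ h (suc r) N + ε * ι k
      tail-bound zero    = ≤-+ˡ (h (suc r) N) (*-nonNeg (ℚ.<⇒≤ ε>0) (ι≥0 0))
      tail-bound (suc k) = begin
        h (suc r) (k ℕ.+ N) + δ (k ℕ.+ N) * h r (k ℕ.+ N)
          ≤⟨ ℚ.+-mono-≤ (tail-bound k) (ℚ.*-monoˡ-≤-nonNeg (δ (k ℕ.+ N))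
               {{ℚ.nonNegative (recip-≥0 (suc (k ℕ.+ N)))}} (h-step r (k ℕ.+ N))) ⟩
        (h (suc r) N + ε * ι k) + δ (k ℕ.+ N) * h r (suc (k ℕ.+ N))
          ≤⟨ ℚ.+-monoʳ-≤ (h (suc r) N + ε * ι k) (ℚ.<⇒≤ (small (k ℕ.+ N) (ℕ.m≤n+m N k))) ⟩
        (h (suc r) N + ε * ι k) + ε
          ≡⟨ rearrange-suc (h (suc r) N) ε (ι k) ⟩
        h (suc r) N + ε * (1ℚ + ι k)
          ≡⟨ cong (λ z → h (suc r) N + ε * z) (ι-suc k) ⟨
        h (suc r) N + ε * ι (suc k) ∎

  g : ℕ → ℕ → ℚ
  g zero    N = h zero N
  g (suc r) N = g r N + h (suc r) N

  g≥0 : ∀ r N → 0ℚ ≤ g r N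
  g≥0 zero    N = h≥0 zero N
  g≥0 (suc r) N = +-nonNeg (g≥0 r N) (h≥0 (suc r) N)

  g-sublinear : ∀ r → Sublinear (g r)
  g-sublinear zero    = h-sublinear zero
  g-sublinear (suc r) ε ε>0 =
    go (g-sublinear r (ε * ½) (half-pos ε>0)) (h-sublinear (suc r) (ε * ½) (half-pos ε>0))
    where
    go : (∃ λ C → ∀ n → g r n ≤ C + ε * ½ * ι n) → (∃ λ C → ∀ n → h (suc r) n ≤ C + ε * ½ * ι n) →
         ∃ λ C → ∀ n → g (suc r) n ≤ C + ε * ι n
    go (A , g≤) (B , h≤) = A + B , λ n → begin
      g r n + h (suc r) n                        ≤⟨ ℚ.+-mono-≤ (g≤ n) (h≤ n) ⟩
      (A + ε * ½ * ι n) + (B + ε * ½ * ι n)      ≡⟨ rearrange-half A B ε (ι n) ⟩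
      (A + B) + ε * ι n                          ∎

  -- δ N * g r (suc N) dominates the tail after suc N of a sum of depth suc r
  -- whose leading exponent is at least 2.
  remainder : ℕ → ℕ → ℚ
  remainder r N = δ N * g r (suc N)

  remainder-step : ∀ r N →
    δ (suc N) * δ (suc N) * h r (suc N) + remainder r (suc N) ≤ remainder r N
  remainder-step zero N = begin
    e * e * 1ℚ + e * 1ℚ   ≡⟨ cong₂ _+_ (ℚ.*-identityʳ (e * e)) (ℚ.*-identityʳ e) ⟩
    e * e + e             ≤⟨ δ-step N ⟩
    δ N                   ≡⟨ ℚ.*-identityʳ (δ N) ⟨
    δ N * 1ℚ              ∎
    where e = δ (suc N)
  remainder-step (suc r) N = begin
    e * e * x + e * (g r (suc (suc N)) + (x + e * h r (suc N)))
      ≡⟨ rearrange-step e x (g r (suc (suc N))) (h r (suc N)) ⟩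
    (e * e * h r (suc N) + e * g r (suc (suc N))) + (e * e + e) * x
      ≤⟨ ℚ.+-mono-≤ (remainder-step r N)
           (ℚ.*-monoʳ-≤-nonNeg x {{ℚ.nonNegative (h≥0 (suc r) (suc N))}} (δ-step N)) ⟩
    δ N * g r (suc N) + δ N * x
      ≡⟨ ℚ.*-distribˡ-+ (δ N) (g r (suc N)) x ⟨
    δ N * (g r (suc N) + x) ∎
    where
    e = δ (suc N)
    x = h (suc r) (suc N)

  squeeze : ∀ (x R : ℕ → ℚ) → (∀ n → x n ≤ x (suc n)) → (∀ n → x (suc n) + R (suc n) ≤ x n + R n) →
            (∀ n → 0ℚ ≤ R n) → (∀ ε → 0ℚ < ε → ∃ λ N → ∀ n → N ℕ.≤ n → R n < ε) → IsCauchy x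
  squeeze x R x↑ x+R↓ R≥0 R→0 ε ε>0 = go (R→0 ε ε>0)
    where
    go : (∃ λ N → ∀ n → N ℕ.≤ n → R n < ε) →
         ∃ λ N → ∀ m n → N ℕ.≤ m → N ℕ.≤ n → ∣ x m - x n ∣ < ε
    go (N , R<) = N , λ m n N≤m N≤n → both m n N≤m N≤n (ℕ.≤-total m n)
      where
      ordered : ∀ m n → N ℕ.≤ m → m ℕ.≤ n → ∣ x n - x m ∣ < ε
      ordered m n N≤m m≤n = begin-strict
        ∣ x n - x m ∣          ≡⟨ ℚ.0≤p⇒∣p∣≡p (0≤q-p (monotone x↑ (ℕ.≤⇒≤′ m≤n))) ⟩
        x n - x m              ≤⟨ ℚ.+-monoˡ-≤ (- x m) (≤-+ˡ (x n) (R≥0 n)) ⟩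
        (x n + R n) - x m      ≤⟨ ℚ.+-monoˡ-≤ (- x m) (antitone {λ i → x i + R i} x+R↓ (ℕ.≤⇒≤′ m≤n)) ⟩
        (x m + R m) - x m      ≡⟨ cancel (x m) (R m) ⟩
        R m                    <⟨ R< m N≤m ⟩
        ε                      ∎
      both : ∀ m n → N ℕ.≤ m → N ℕ.≤ n → m ℕ.≤ n ⊎ n ℕ.≤ m → ∣ x m - x n ∣ < ε
      both m n N≤m N≤n (inj₁ m≤n) = subst (_< ε) (∣-∣-comm (x n) (x m)) (ordered m n N≤m m≤n)
      both m n N≤m N≤n (inj₂ n≤m) = ordered n m N≤n n≤m

  unshift : ∀ x → IsCauchy (x ∘ suc) → IsCauchy x
  unshift x cx ε ε>0 = go (cx ε ε>0)
    where
    go : (∃ λ N → ∀ m n → N ℕ.≤ m → N ℕ.≤ n → ∣ x (suc m) - x (suc n) ∣ < ε) →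
         ∃ λ N → ∀ m n → N ℕ.≤ m → N ℕ.≤ n → ∣ x m - x n ∣ < ε
    go (N , x<) = suc N , λ { (suc m) (suc n) (ℕ.s≤s N≤m) (ℕ.s≤s N≤n) → x< m n N≤m N≤n }

  truncated-cauchy : ∀ s ss → 2 ℕ.≤ value s → IsCauchy (truncated (s ∷ ss))
  truncated-cauchy s ss 2≤s = unshift (truncated (s ∷ ss))
    (squeeze (truncated (s ∷ ss) ∘ suc) (remainder r) increasing decreasing
      (λ n → *-nonNeg (recip-≥0 (suc n)) (g≥0 r (suc n)))
      (δ-sublinear (g-sublinear r)))
    where
    r = length ss
    increasing : ∀ n → truncated (s ∷ ss) (suc n) ≤ truncated (s ∷ ss) (suc (suc n))
    increasing n = ≤-+ˡ (truncated (s ∷ ss) (suc n))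
      (*-nonNeg (recipPow≥0 (suc n) (value s)) (truncated≥0 ss (suc n)))
    decreasing : ∀ n → truncated (s ∷ ss) (suc (suc n)) + remainder r (suc n) ≤
                       truncated (s ∷ ss) (suc n) + remainder r n
    decreasing n = begin
      (t + recipPow (suc n) (value s) * truncated ss (suc n)) + remainder r (suc n)
        ≡⟨ ℚ.+-assoc t (recipPow (suc n) (value s) * truncated ss (suc n)) (remainder r (suc n)) ⟩
      t + (recipPow (suc n) (value s) * truncated ss (suc n) + remainder r (suc n))
        ≤⟨ ℚ.+-monoʳ-≤ t (ℚ.+-monoˡ-≤ (remainder r (suc n))
             (*-mono-≤ (recipPow≥0 (suc n) (value s)) (h≥0 r (suc n)) pow≤ (truncated≤h ss (suc n)))) ⟩
      t + (δ (suc n) * δ (suc n) * h r (suc n) + remainder r (suc n))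
        ≤⟨ ℚ.+-monoʳ-≤ t (remainder-step r n) ⟩
      t + remainder r n ∎
      where
      t = truncated (s ∷ ss) (suc n)
      pow≤ : recipPow (suc n) (value s) ≤ δ (suc n) * δ (suc n)
      pow≤ = ℚ.≤-trans (recipPow-anti (suc n) 2≤s) (ℚ.≤-reflexive (recipPow-2 (suc n)))

open import Data.Nat.Base using (_+_; _*_)
open import Data.Nat.Combinatorics using (_C_)

-- The limit of the truncated sums; the leading exponent must be at least 2.
ζ : (s₁ : ℕ) → .{{_ : NonTrivial s₁}} → List ℕ⁺ → ℝ
ζ s₁ ss = mkℝ (truncated (pos s₁ {{ℕ.nonTrivial⇒nonZero s₁}} ∷ ss))
              (Convergence.truncated-cauchy (pos s₁ {{ℕ.nonTrivial⇒nonZero s₁}}) ss (ℕ.nonTrivial⇒n>1 s₁))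

positive+1>1 : ∀ m .{{_ : NonZero m}} → NonTrivial (m + 1)
positive+1>1 m = ℕ.n>1⇒nonTrivial (ℕ.+-monoˡ-≤ 1 (ℕ.>-nonZero⁻¹ m))

positives>1 : ∀ (a : ℕ⁺) m e .{{_ : NonZero m}} → NonTrivial (value a + m + e)
positives>1 (pos a) m e = ℕ.n>1⇒nonTrivial
  (ℕ.≤-trans (ℕ.+-mono-≤ (ℕ.>-nonZero⁻¹ a) (ℕ.>-nonZero⁻¹ m)) (ℕ.m≤m+n (a + m) e))

-- splitsᵢ n lists the i-tuples of naturals with sum n.
splits₂ : ℕ → List (ℕ × ℕ)
splits₂ n = map (λ i → i , n ∸ i) (upTo (suc n))

splits₃ : ℕ → List (ℕ × ℕ × ℕ)
splits₃ n = concatMap (λ (i , r) → map (i ,_) (splits₂ r)) (splits₂ n)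

splits₄ : ℕ → List (ℕ × ℕ × ℕ × ℕ)
splits₄ n = concatMap (λ (i , r) → map (i ,_) (splits₃ r)) (splits₂ n)

-- compositions ℓ n lists the ℓ-tuples of positive integers with sum n; the entry
-- suc i is at most n because i runs over upTo n.
compositions : (ℓ n : ℕ) → List (Vec ℕ⁺ ℓ)
compositions zero    zero    = [ [] ]
compositions zero    (suc _) = []
compositions (suc ℓ) n       =
  concatMap (λ i → map (pos (suc i) ∷_) (compositions ℓ (n ∸ suc i))) (upTo n)

-- In Σ₁, …, Σ₄, an index running over 1, …, k is written suc i with i
-- running over upTo k.

Σ₁ : (m n j k s t : ℕ) .{{_ : NonZero m}} → ℝ
Σ₁ m n j k s t =
  ∑ (upTo (suc n)) λ n₁ →
  ∑ (splits₄ j) λ (j₁ , j₂ , j₃ , j₄) →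
  ∑ (compositions (suc j₁) (n ∸ n₁ + j₁ + 1)) λ α →
  ∑ (compositions (suc j₃) (s + j₃)) λ α̃ →
    (((m ∸ 1 + n₁) C (m ∸ 1)) * ((j₂ + k ∸ 1) C (k ∸ 1)) * ((j₄ + t ∸ 1) C (t ∸ 1))) ·
    ζ (value (head α) + m + n₁) {{positives>1 (head α) m n₁}}
      (toList (tail α) ++ ones (j₂ + k ∸ 1) ++
       (head α̃ ⊕ 1) ∷ toList (tail α̃) ++ ones (j₄ + t ∸ 1))

-- block q b c is the string b + 1, {1}^(q - 1), c + 1, with the convention
-- that it is the single entry b + c + 1 when q = 0.
block : ℕ → ℕ⁺ → ℕ⁺ → List ℕ⁺
block zero    b c = [ b ⊕ (value c + 1) ]
block (suc q) b c = (b ⊕ 1) ∷ ones q ++ [ c ⊕ 1 ]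

Σ₂ : (m n j k s t : ℕ) .{{_ : NonZero n}} → ℝ
Σ₂ m n j k s t =
  ∑ (upTo k) λ i → let k₁ = suc i in
  ∑ (upTo m) λ m₁ →
  ((m₁ + n ∸ 1) C (n ∸ 1)) ·
  (∑ (splits₃ j) λ (j₁ , j₂ , j₃) →
   ∑ (compositions (suc k₁) (m ∸ m₁ + k₁)) λ β →
   ∑ (compositions (suc j₂) (s + j₂)) λ β̃ →
     (((j₁ + (k ∸ k₁)) C (k ∸ k₁)) * ((j₃ + t ∸ 1) C (t ∸ 1))) ·
     ζ (value (head β) + n + m₁) {{positives>1 (head β) n m₁}}
       (toList (init (tail β)) ++ block (j₁ + (k ∸ k₁)) (last (tail β)) (head β̃) ++
        toList (tail β̃) ++ ones (j₃ + t ∸ 1)))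

Σ₃ : (m n j k s t : ℕ) .{{_ : NonZero n}} .{{_ : NonZero k}} → ℝ
Σ₃ m n j k@(suc _) s t =
  ∑ (upTo s) λ i → let s₁ = suc i in
  ∑ (splits₃ (m ∸ 1)) λ (m₁ , m₂ , m₃) →
  (((m₁ + n ∸ 1) C (n ∸ 1)) * ((m₃ + s₁ ∸ 1) C (s₁ ∸ 1))) ·
  (∑ (splits₂ j) λ (j₁ , j₂) →
   ∑ (compositions (suc k) (m₂ + k + 1)) λ γ →
   ∑ (compositions (suc j₁) (s ∸ s₁ + j₁ + 1)) λ γ̃ →
     ((j₂ + t ∸ 1) C (t ∸ 1)) ·
     ζ (value (head γ) + n + m₁) {{positives>1 (head γ) n m₁}}
       (toList (init (tail γ)) ++ (last (tail γ) ⊕ (value (head γ̃) + m₃ + s₁)) ∷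
        toList (tail γ̃) ++ ones (j₂ + t ∸ 1)))

Σ₄ : (m n j k s t : ℕ) .{{_ : NonZero n}} .{{_ : NonZero k}} → ℝ
Σ₄ m n j k@(suc _) s t =
  ∑ (upTo t) λ i → let t₁ = suc i in
  ∑ (splits₄ (m ∸ 1)) λ (m₁ , m₂ , m₃ , m₄) →
  (((m₁ + n ∸ 1) C (n ∸ 1)) * ((m₃ + s ∸ 1) C (s ∸ 1)) * ((j + (t ∸ t₁)) C j)) ·
  (∑ (compositions k (m₂ + k)) λ δ →
   ∑ (compositions (suc t₁) (m₄ + t₁ + 1)) λ δ̃ →
     ζ (value (head δ) + n + m₁) {{positives>1 (head δ) n m₁}}
       (toList (tail δ) ++ (head δ̃ ⊕ (m₃ + s)) ∷
        toList (init (tail δ̃)) ++ (last (tail δ̃) ⊕ 1) ∷ ones (j + (t ∸ t₁) ∸ 1)))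

{-# OPTIONS --safe #-}
-- Encode an index (s₁, …, sᵣ) by the word x^(s₁-1) y ⋯ x^(sᵣ-1) y. A truncated zeta value is a partial sum of the
-- coefficients of the polylogarithm Li_w(z) at z = 1. The Leibniz rule for z · d/dz shows that the product of the
-- series Li_u and Li_v is the sum of Li_w over the shuffles w of u and v; hence the partial sums of the right-hand
-- side run over the triangle a + b ≤ N and those of the left-hand side over the square a, b ≤ N, and both have the
-- same limit because the terms are nonnegative.
--
-- It remains to enumerate the shuffles of x^m y^j with x^n y^k x^s y^t. The position of the last x of x^m relative to
-- the second word, in x^n, y^k, x^s or y^t, gives Σ₁, Σ₂, Σ₃ and Σ₄. Marking further letters of the second word cuts
-- each shuffle into shuffles of powers: those of a^p with a^q are counted by a binomial coefficient, and those of y^q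
-- with x^p by the compositions of p + q + 1 into q + 1 parts.
module Submission where

open import Defs
open import Algebra.Bundles using (CommutativeMonoid)
import Algebra.Properties.CommutativeMonoid.Mult as Multiples
import Algebra.Properties.CommutativeSemigroup as CommutativeSemigroupProperties
open import Algebra.Structures using (IsCommutativeMonoid)
open import Data.List.Base using (List; []; _∷_; [_]; _++_; map; concatMap; foldr; replicate; upTo)
import Data.List.Properties as List
open import Data.Nat.Base as ℕ using (ℕ; zero; suc; pred; NonZero; NonTrivial; nonTrivial⇒nonZero)
import Data.Nat.Properties as ℕ
open import Data.Product using (∃; _×_; _,_; map₁)
import Data.Rational.Base as ℚ
open import Data.Vec.Base using (Vec; []; _∷_; head; tail; init; last; toList)
open import Function.Base using (_∘_)
open import Relation.Binary.PropositionalEquality hiding ([_])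

-- The shuffle relation fails for truncated sums: for ζ(2)ζ(2) cut off at N = 1 the product is 1,
-- while every term of depth two is 0. It is exact only for coefficients of power series, which is
-- why polylogarithms intervene; the comparison of square and triangle is the only limit in the
-- proof. The passage from shuffles to Σ₁, ..., Σ₄, in contrast, is an exact finite identity at each
-- N, proved for an arbitrary function on words with values in a commutative monoid.
--
-- The last x of x^m y^j is a natural mark because it cuts the first word into pure powers: only x's
-- meet the prefix of the second word, and only y's meet its suffix. What remains are shuffles of
-- one power with a word of at most four blocks. The further marks are first or last letters of
-- these blocks, so that every piece becomes a shuffle of two powers.

module Combinatorics where
  open import Data.Nat.Base using (_+_; _*_; _∸_; _<_; s<s⁻¹; z<s; s<s)
  open import Data.Nat.Combinatorics using (_C_; nCn≡1; nCk+nC[k+1]≡[n+1]C[k+1])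
  open import Data.Nat.Solver using (module +-*-Solver)

  -- Shuffles and cuts of words.

  module _ {A : Set} where

    -- Shuffles are listed with multiplicity, one entry per interleaving, so that equal words add up
    -- to the binomial coefficients of the theorem.
    _⧢_ : List A → List A → List (List A)
    []      ⧢ v       = [ v ]
    (a ∷ u) ⧢ []      = [ a ∷ u ]
    (a ∷ u) ⧢ (b ∷ v) = map (a ∷_) (u ⧢ (b ∷ v)) ++ map (b ∷_) ((a ∷ u) ⧢ v)

    -- The cuts with a nonempty first part. A cut at a border between two blocks is counted with the
    -- earlier block, and the empty first part with the first block; hence n₁ starts at 0 while k₁,
    -- s₁ and t₁ start at 1.
    splits⁺ : List A → List (List A × List A)
    splits⁺ []      = []
    splits⁺ (a ∷ v) = ([ a ] , v) ∷ map (map₁ (a ∷_)) (splits⁺ v)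

    splits : List A → List (List A × List A)
    splits v = ([] , v) ∷ splits⁺ v

    replicate-suc-++ : ∀ n (a : A) v → replicate (suc n) a ++ v ≡ replicate n a ++ a ∷ v
    replicate-suc-++ zero    a v = refl
    replicate-suc-++ (suc n) a v = cong (a ∷_) (replicate-suc-++ n a v)

    replicate-+ : ∀ m n (a : A) → replicate (m + n) a ≡ replicate m a ++ replicate n a
    replicate-+ zero    n a = refl
    replicate-+ (suc m) n a = cong (a ∷_) (replicate-+ m n a)

  -- Words in x and y, and the indices they encode.

  data Letter : Set where
    x y : Letter

  infix 30 _^^_

  _^^_ : Letter → ℕ → List Letter
  a ^^ n = replicate n a

  word : List ℕ⁺ → List Letter
  word []       = []
  word (s ∷ ss) = x ^^ pred (value s) ++ y ∷ word ss

  -- x^(α₁-1) y x^(α₂-1) y ⋯ y x^(α_{q+1}-1)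
  interlace : ∀ {q} → Vec ℕ⁺ (suc q) → List Letter
  interlace (a ∷ [])     = x ^^ pred (value a)
  interlace (a ∷ b ∷ bs) = x ^^ pred (value a) ++ y ∷ interlace (b ∷ bs)

  interlace-pos1 : ∀ {q} (α : Vec ℕ⁺ (suc q)) → interlace (pos 1 ∷ α) ≡ y ∷ interlace α
  interlace-pos1 (a ∷ as) = refl

  interlace-suc : ∀ {q} (α : Vec ℕ⁺ (suc q)) → interlace (pos (suc (value (head α))) ∷ tail α) ≡ x ∷ interlace α
  interlace-suc (pos (suc a) ∷ [])     = refl
  interlace-suc (pos (suc a) ∷ b ∷ bs) = refl

  m+1+n∸1 : ∀ m n → m + suc n ∸ 1 ≡ m + n
  m+1+n∸1 m n = cong pred (ℕ.+-suc m n)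

  ^^-+ : ∀ a m n w → a ^^ (m + n) ++ w ≡ a ^^ m ++ a ^^ n ++ w
  ^^-+ a m n w = trans (cong (_++ w) (replicate-+ m n a)) (List.++-assoc (a ^^ m) (a ^^ n) w)

  word-++ : ∀ ss rs → word (ss ++ rs) ≡ word ss ++ word rs
  word-++ []       rs = refl
  word-++ (s ∷ ss) rs = trans (cong (λ w → x ^^ pred (value s) ++ y ∷ w) (word-++ ss rs))
    (sym (List.++-assoc (x ^^ pred (value s)) (y ∷ word ss) (word rs)))

  word-ones : ∀ p → word (ones p) ≡ y ^^ p
  word-ones zero    = refl
  word-ones (suc p) = cong (y ∷_) (word-ones p)

  word-ones-++ : ∀ p ss → word (ones p ++ ss) ≡ y ^^ p ++ word ss
  word-ones-++ p ss = trans (word-++ (ones p) ss) (cong (_++ word ss) (word-ones p))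

  -- A run of x's in front of a word only enlarges its first entry. The new entry is a variable `b`
  -- with an equation because the sums Σ₁, ..., Σ₄ bracket it in several ways.
  x^^-word : ∀ e a {b} ss .{{_ : NonZero b}} → b ≡ value a + e → x ^^ e ++ word (a ∷ ss) ≡ word (pos b ∷ ss)
  x^^-word e (pos (suc a)) ss refl = trans (sym (^^-+ x e a (y ∷ word ss)))
    (cong (λ d → x ^^ d ++ y ∷ word ss) (ℕ.+-comm e a))

  -- `interlace α` ends in an open run of x's; the y that follows closes this run into the last
  -- entry of α.
  interlace-y : ∀ {q} (α : Vec ℕ⁺ (suc q)) w → interlace α ++ y ∷ w ≡ word (toList α) ++ w
  interlace-y (a ∷ [])     w = sym (List.++-assoc (x ^^ pred (value a)) [ y ] w)
  interlace-y (a ∷ b ∷ bs) w = begin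
    (x ^^ pred (value a) ++ y ∷ interlace (b ∷ bs)) ++ y ∷ w
      ≡⟨ List.++-assoc (x ^^ pred (value a)) (y ∷ interlace (b ∷ bs)) (y ∷ w) ⟩
    x ^^ pred (value a) ++ y ∷ interlace (b ∷ bs) ++ y ∷ w
      ≡⟨ cong (λ v → x ^^ pred (value a) ++ y ∷ v) (interlace-y (b ∷ bs) w) ⟩
    x ^^ pred (value a) ++ y ∷ word (toList (b ∷ bs)) ++ w
      ≡⟨ List.++-assoc (x ^^ pred (value a)) (y ∷ word (toList (b ∷ bs))) w ⟨
    (x ^^ pred (value a) ++ y ∷ word (toList (b ∷ bs))) ++ w ∎
    where open ≡-Reasoning

  -- Suited to a `w` that begins with x: the last run stays open, so that it can merge with the x's
  -- of `w`.
  interlace-init-last : ∀ {q} (α : Vec ℕ⁺ (suc q)) w →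
    interlace α ++ w ≡ word (toList (init α)) ++ x ^^ pred (value (last α)) ++ w
  interlace-init-last (a ∷ [])     w = refl
  interlace-init-last (a ∷ b ∷ bs) w = begin
    (x ^^ pred (value a) ++ y ∷ interlace (b ∷ bs)) ++ w
      ≡⟨ List.++-assoc (x ^^ pred (value a)) (y ∷ interlace (b ∷ bs)) w ⟩
    x ^^ pred (value a) ++ y ∷ interlace (b ∷ bs) ++ w
      ≡⟨ cong (λ v → x ^^ pred (value a) ++ y ∷ v) (interlace-init-last (b ∷ bs) w) ⟩
    x ^^ pred (value a) ++ y ∷ word (toList (init (b ∷ bs))) ++ x ^^ pred (value (last (b ∷ bs))) ++ w
      ≡⟨ List.++-assoc (x ^^ pred (value a)) (y ∷ word (toList (init (b ∷ bs)))) _ ⟨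
    (x ^^ pred (value a) ++ y ∷ word (toList (init (b ∷ bs)))) ++ x ^^ pred (value (last (b ∷ bs))) ++ w ∎
    where open ≡-Reasoning

  x^^-interlace-y : ∀ e {q} (α : Vec ℕ⁺ (suc q)) {b w} ss .{{_ : NonZero b}} → b ≡ value (head α) + e →
    w ≡ word ss → x ^^ e ++ interlace α ++ y ∷ w ≡ word (pos b ∷ toList (tail α) ++ ss)
  x^^-interlace-y e (a ∷ as) {b} {w} ss b≡ w≡ = begin
    x ^^ e ++ interlace (a ∷ as) ++ y ∷ w
      ≡⟨ cong (x ^^ e ++_) (interlace-y (a ∷ as) w) ⟩
    x ^^ e ++ word (a ∷ toList as) ++ w
      ≡⟨ cong (λ v → x ^^ e ++ word (a ∷ toList as) ++ v) w≡ ⟩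
    x ^^ e ++ word (a ∷ toList as) ++ word ss
      ≡⟨ cong (x ^^ e ++_) (word-++ (a ∷ toList as) ss) ⟨
    x ^^ e ++ word (a ∷ toList as ++ ss)
      ≡⟨ x^^-word e a (toList as ++ ss) b≡ ⟩
    word (pos b ∷ toList as ++ ss) ∎
    where open ≡-Reasoning

  x^^-interlace : ∀ e {q} (α : Vec ℕ⁺ (suc (suc q))) {b w} ss .{{_ : NonZero b}} → b ≡ value (head α) + e →
    x ^^ pred (value (last (tail α))) ++ w ≡ word ss →
    x ^^ e ++ interlace α ++ w ≡ word (pos b ∷ toList (init (tail α)) ++ ss)
  x^^-interlace e (a ∷ b ∷ bs) {_} {w} ss b≡ w≡ = begin
    x ^^ e ++ interlace (a ∷ b ∷ bs) ++ w
      ≡⟨ cong (x ^^ e ++_) (interlace-init-last (a ∷ b ∷ bs) w) ⟩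
    x ^^ e ++ word (a ∷ toList (init (b ∷ bs))) ++ x ^^ pred (value (last (b ∷ bs))) ++ w
      ≡⟨ cong (λ v → x ^^ e ++ word (a ∷ toList (init (b ∷ bs))) ++ v) w≡ ⟩
    x ^^ e ++ word (a ∷ toList (init (b ∷ bs))) ++ word ss
      ≡⟨ cong (x ^^ e ++_) (word-++ (a ∷ toList (init (b ∷ bs))) ss) ⟨
    x ^^ e ++ word (a ∷ toList (init (b ∷ bs)) ++ ss)
      ≡⟨ x^^-word e a (toList (init (b ∷ bs)) ++ ss) b≡ ⟩
    word (pos _ ∷ toList (init (b ∷ bs)) ++ ss) ∎
    where open ≡-Reasoning

  x∷interlace-y : ∀ {q} (α : Vec ℕ⁺ (suc q)) {w} ss → w ≡ word ss →
    x ∷ interlace α ++ y ∷ w ≡ word ((head α ⊕ 1) ∷ toList (tail α) ++ ss)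
  x∷interlace-y α@(pos (suc a) ∷ as) ss w≡ = x^^-interlace-y 1 α ss refl w≡

  -- Between the open run of `b` and the first run of `γ` stand two extra x's, one before and one
  -- after y^q. For q = 0 nothing separates them, and (b - 1) + 2 + (c - 1) = b + c letters x form
  -- the single entry b + c + 1, where c is the head of `γ`. This is the origin of the convention in
  -- `block`.
  word-block : ∀ q b {r} (γ : Vec ℕ⁺ (suc r)) p →
    x ^^ pred (value b) ++ x ∷ y ^^ q ++ x ∷ interlace γ ++ y ^^ suc p ≡
    word (block q b (head γ) ++ toList (tail γ) ++ ones p)
  word-block zero b@(pos (suc b′)) γ@(pos (suc c) ∷ cs) p = begin
    x ^^ b′ ++ x ∷ x ∷ interlace γ ++ y ∷ y ^^ p
      ≡⟨ replicate-suc-++ b′ x (x ∷ interlace γ ++ y ∷ y ^^ p) ⟨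
    x ^^ suc b′ ++ x ∷ interlace γ ++ y ∷ y ^^ p
      ≡⟨ replicate-suc-++ (suc b′) x (interlace γ ++ y ∷ y ^^ p) ⟨
    x ^^ suc (suc b′) ++ interlace γ ++ y ∷ y ^^ p
      ≡⟨ x^^-interlace-y (suc (suc b′)) γ (ones p)
           (solve 2 (λ b c → con 1 :+ b :+ (con 1 :+ c :+ con 1) := con 1 :+ c :+ (con 2 :+ b)) refl b′ c)
           (sym (word-ones p)) ⟩
    word ((b ⊕ (suc c + 1)) ∷ toList cs ++ ones p) ∎
    where
    open ≡-Reasoning
    open +-*-Solver
  word-block (suc q) b@(pos (suc b′)) γ@(c ∷ cs) p = begin
    x ^^ b′ ++ x ∷ y ∷ y ^^ q ++ x ∷ interlace γ ++ y ∷ y ^^ p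
      ≡⟨ replicate-suc-++ b′ x (y ∷ y ^^ q ++ x ∷ interlace γ ++ y ∷ y ^^ p) ⟨
    x ^^ suc b′ ++ y ∷ y ^^ q ++ x ∷ interlace γ ++ y ∷ y ^^ p
      ≡⟨ cong₂ (λ e w → x ^^ e ++ y ∷ y ^^ q ++ w) (sym (ℕ.+-comm b′ 1))
           (x∷interlace-y γ (ones p) (sym (word-ones p))) ⟩
    x ^^ (b′ + 1) ++ y ∷ y ^^ q ++ word ((c ⊕ 1) ∷ toList cs ++ ones p)
      ≡⟨ cong (λ w → x ^^ (b′ + 1) ++ y ∷ w) (word-ones-++ q _) ⟨
    word ((b ⊕ 1) ∷ ones q ++ (c ⊕ 1) ∷ toList cs ++ ones p)
      ≡⟨ cong (λ ss → word ((b ⊕ 1) ∷ ss)) (List.++-assoc (ones q) [ c ⊕ 1 ] (toList cs ++ ones p)) ⟨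
    word (block (suc q) b c ++ toList cs ++ ones p) ∎
    where open ≡-Reasoning

  -- No y occurs before the end of the first run of `γ̃`, so the runs of lengths g - 1, m₃ + i + 1,
  -- 1 and γ̃₁ - 1 join into one entry.
  word-merge : ∀ (g : ℕ⁺) {j₁} (γ̃ : Vec ℕ⁺ (suc j₁)) m₃ i p →
    x ^^ pred (value g) ++ x ^^ suc (m₃ + i) ++ x ∷ interlace γ̃ ++ y ∷ y ^^ p ≡
    word ((g ⊕ (value (head γ̃) + m₃ + suc i)) ∷ toList (tail γ̃) ++ ones p)
  word-merge (pos (suc g)) γ̃ m₃ i p = begin
    x ^^ g ++ x ^^ suc (m₃ + i) ++ x ∷ interlace γ̃ ++ y ∷ y ^^ p
      ≡⟨ ^^-+ x g (suc (m₃ + i)) (x ∷ interlace γ̃ ++ y ∷ y ^^ p) ⟨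
    x ^^ (g + suc (m₃ + i)) ++ x ∷ interlace γ̃ ++ y ∷ y ^^ p
      ≡⟨ replicate-suc-++ (g + suc (m₃ + i)) x (interlace γ̃ ++ y ∷ y ^^ p) ⟨
    x ^^ suc (g + suc (m₃ + i)) ++ interlace γ̃ ++ y ∷ y ^^ p
      ≡⟨ x^^-interlace-y (suc (g + suc (m₃ + i))) γ̃ (ones p)
           (solve 4 (λ g h m i → con 1 :+ g :+ (h :+ m :+ (con 1 :+ i)) := h :+ (con 1 :+ (g :+ (con 1 :+ (m :+ i)))))
             refl g (value (head γ̃)) m₃ i)
           (sym (word-ones p)) ⟩
    word ((pos (suc g) ⊕ (value (head γ̃) + m₃ + suc i)) ∷ toList (tail γ̃) ++ ones p) ∎
    where
    open ≡-Reasoning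
    open +-*-Solver

  x^^-interlace-⊕ : ∀ e {q} (α : Vec ℕ⁺ (suc (suc q))) p →
    x ^^ e ++ interlace α ++ x ∷ y ^^ suc p ≡
    word ((head α ⊕ e) ∷ toList (init (tail α)) ++ (last (tail α) ⊕ 1) ∷ ones p)
  x^^-interlace-⊕ e α@(pos (suc a) ∷ as) p = x^^-interlace e α ((last as ⊕ 1) ∷ ones p) refl
    (trans (x^^-x (last as)) (cong (λ w → x ^^ pred (value (last as ⊕ 1)) ++ y ∷ w) (sym (word-ones p))))
    where
    x^^-x : ∀ (s : ℕ⁺) {w} → x ^^ pred (value s) ++ x ∷ w ≡ x ^^ pred (value (s ⊕ 1)) ++ w
    x^^-x (pos (suc s)) {w} = trans (sym (replicate-suc-++ s x w)) (cong (λ d → x ^^ d ++ w) (ℕ.+-comm 1 s))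

  -- The four sums of the theorem over an arbitrary type of values.

  -- Abstracting from ζ, ∑ and · allows values both in ℝ and, for each truncation, in ℚ.
  module RightHandSide {A : Set} (⨁ : (B : Set) → List B → (B → A) → A) (_⊙_ : ℕ → A → A)
                       (F : (s₁ : ℕ) → .{{_ : NonTrivial s₁}} → List ℕ⁺ → A) where

    S₁ : (m n j k s t : ℕ) .{{_ : NonZero m}} → A
    S₁ m n j k s t =
      ⨁ _ (upTo (suc n)) λ n₁ →
      ⨁ _ (splits₄ j) λ (j₁ , j₂ , j₃ , j₄) →
      ⨁ _ (compositions (suc j₁) (n ∸ n₁ + j₁ + 1)) λ α →
      ⨁ _ (compositions (suc j₃) (s + j₃)) λ α̃ →
        (((m ∸ 1 + n₁) C (m ∸ 1)) * ((j₂ + k ∸ 1) C (k ∸ 1)) * ((j₄ + t ∸ 1) C (t ∸ 1))) ⊙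
        F (value (head α) + m + n₁) {{positives>1 (head α) m n₁}}
           (toList (tail α) ++ ones (j₂ + k ∸ 1) ++
            (head α̃ ⊕ 1) ∷ toList (tail α̃) ++ ones (j₄ + t ∸ 1))

    S₂ : (m n j k s t : ℕ) .{{_ : NonZero n}} → A
    S₂ m n j k s t =
      ⨁ _ (upTo k) λ i →
      ⨁ _ (upTo m) λ m₁ →
      ((m₁ + n ∸ 1) C (n ∸ 1)) ⊙
      (⨁ _ (splits₃ j) λ (j₁ , j₂ , j₃) →
       ⨁ _ (compositions (suc (suc i)) (m ∸ m₁ + suc i)) λ β →
       ⨁ _ (compositions (suc j₂) (s + j₂)) λ β̃ →
         (((j₁ + (k ∸ suc i)) C (k ∸ suc i)) * ((j₃ + t ∸ 1) C (t ∸ 1))) ⊙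
         F (value (head β) + n + m₁) {{positives>1 (head β) n m₁}}
            (toList (init (tail β)) ++ block (j₁ + (k ∸ suc i)) (last (tail β)) (head β̃) ++
             toList (tail β̃) ++ ones (j₃ + t ∸ 1)))

    S₃ : (m n j k s t : ℕ) .{{_ : NonZero n}} .{{_ : NonZero k}} → A
    S₃ m n j k@(suc _) s t =
      ⨁ _ (upTo s) λ i →
      ⨁ _ (splits₃ (m ∸ 1)) λ (m₁ , m₂ , m₃) →
      (((m₁ + n ∸ 1) C (n ∸ 1)) * ((m₃ + suc i ∸ 1) C (suc i ∸ 1))) ⊙
      (⨁ _ (splits₂ j) λ (j₁ , j₂) →
       ⨁ _ (compositions (suc k) (m₂ + k + 1)) λ γ →
       ⨁ _ (compositions (suc j₁) (s ∸ suc i + j₁ + 1)) λ γ̃ →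
         ((j₂ + t ∸ 1) C (t ∸ 1)) ⊙
         F (value (head γ) + n + m₁) {{positives>1 (head γ) n m₁}}
            (toList (init (tail γ)) ++ (last (tail γ) ⊕ (value (head γ̃) + m₃ + suc i)) ∷
             toList (tail γ̃) ++ ones (j₂ + t ∸ 1)))

    S₄ : (m n j k s t : ℕ) .{{_ : NonZero n}} .{{_ : NonZero k}} → A
    S₄ m n j k@(suc _) s t =
      ⨁ _ (upTo t) λ i →
      ⨁ _ (splits₄ (m ∸ 1)) λ (m₁ , m₂ , m₃ , m₄) →
      (((m₁ + n ∸ 1) C (n ∸ 1)) * ((m₃ + s ∸ 1) C (s ∸ 1)) * ((j + (t ∸ suc i)) C j)) ⊙
      (⨁ _ (compositions k (m₂ + k)) λ δ →
       ⨁ _ (compositions (suc (suc i)) (m₄ + suc i + 1)) λ δ̃ →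
         F (value (head δ) + n + m₁) {{positives>1 (head δ) n m₁}}
            (toList (tail δ) ++ (head δ̃ ⊕ (m₃ + s)) ∷
             toList (init (tail δ̃)) ++ (last (tail δ̃) ⊕ 1) ∷ ones (j + (t ∸ suc i) ∸ 1)))

  open RightHandSide public

  -- Used with φ the evaluation at a truncation. Compatibility with sums asks for a pointwise
  -- equality of the summands, so that nested sums are treated one layer at a time without function
  -- extensionality.
  module RightHandSideHomomorphism {A A′ : Set}
           (⨁ : (B : Set) → List B → (B → A) → A) (⨁′ : (B : Set) → List B → (B → A′) → A′)
           (_⊙_ : ℕ → A → A) (_⊙′_ : ℕ → A′ → A′)
           (F : (s₁ : ℕ) → .{{_ : NonTrivial s₁}} → List ℕ⁺ → A) (F′ : (s₁ : ℕ) → .{{_ : NonTrivial s₁}} → List ℕ⁺ → A′)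
           (φ : A → A′)
           (φ-⨁ : ∀ {B : Set} (bs : List B) g {g′} → (∀ b → φ (g b) ≡ g′ b) → φ (⨁ B bs g) ≡ ⨁′ B bs g′)
           (φ-⊙ : ∀ c a {a′} → φ a ≡ a′ → φ (c ⊙ a) ≡ c ⊙′ a′)
           (φ-F : ∀ s₁ .{{_ : NonTrivial s₁}} ss → φ (F s₁ ss) ≡ F′ s₁ ss)
           (m n j k s t : ℕ) where

    φ-S₁ : .{{_ : NonZero m}} → φ (S₁ ⨁ _⊙_ F m n j k s t) ≡ S₁ ⨁′ _⊙′_ F′ m n j k s t
    φ-S₁ =
      φ-⨁ (upTo (suc n)) _ λ n₁ →
      φ-⨁ (splits₄ j) _ λ (j₁ , j₂ , j₃ , j₄) →
      φ-⨁ (compositions (suc j₁) (n ∸ n₁ + j₁ + 1)) _ λ α →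
      φ-⨁ (compositions (suc j₃) (s + j₃)) _ λ α̃ →
      φ-⊙ _ _ (φ-F _ {{positives>1 (head α) m n₁}} _)

    φ-S₂ : .{{_ : NonZero n}} → φ (S₂ ⨁ _⊙_ F m n j k s t) ≡ S₂ ⨁′ _⊙′_ F′ m n j k s t
    φ-S₂ =
      φ-⨁ (upTo k) _ λ i →
      φ-⨁ (upTo m) _ λ m₁ →
      φ-⊙ _ _ (
      φ-⨁ (splits₃ j) _ λ (j₁ , j₂ , j₃) →
      φ-⨁ (compositions (suc (suc i)) (m ∸ m₁ + suc i)) _ λ β →
      φ-⨁ (compositions (suc j₂) (s + j₂)) _ λ β̃ →
      φ-⊙ _ _ (φ-F _ {{positives>1 (head β) n m₁}} _))

    φ-S₃ : .{{_ : NonZero n}} → φ (S₃ ⨁ _⊙_ F m n j (suc k) s t) ≡ S₃ ⨁′ _⊙′_ F′ m n j (suc k) s t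
    φ-S₃ =
      φ-⨁ (upTo s) _ λ i →
      φ-⨁ (splits₃ (m ∸ 1)) _ λ (m₁ , m₂ , m₃) →
      φ-⊙ _ _ (
      φ-⨁ (splits₂ j) _ λ (j₁ , j₂) →
      φ-⨁ (compositions (suc (suc k)) (m₂ + suc k + 1)) _ λ γ →
      φ-⨁ (compositions (suc j₁) (s ∸ suc i + j₁ + 1)) _ λ γ̃ →
      φ-⊙ _ _ (φ-F _ {{positives>1 (head γ) n m₁}} _))

    φ-S₄ : .{{_ : NonZero n}} → φ (S₄ ⨁ _⊙_ F m n j (suc k) s t) ≡ S₄ ⨁′ _⊙′_ F′ m n j (suc k) s t
    φ-S₄ =
      φ-⨁ (upTo t) _ λ i →
      φ-⨁ (splits₄ (m ∸ 1)) _ λ (m₁ , m₂ , m₃ , m₄) →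
      φ-⊙ _ _ (
      φ-⨁ (compositions (suc k) (m₂ + suc k)) _ λ δ →
      φ-⨁ (compositions (suc (suc i)) (m₄ + suc i + 1)) _ λ δ̃ →
      φ-F _ {{positives>1 (head δ) n m₁}} _)

  -- Finite sums in a commutative monoid.

  module Sums {A : Set} {_∙_ : A → A → A} {ε : A} (isCM : IsCommutativeMonoid _≡_ _∙_ ε) where

    commutativeMonoid : CommutativeMonoid _ _
    commutativeMonoid = record { isCommutativeMonoid = isCM }

    open CommutativeMonoid commutativeMonoid using (assoc; comm; identityˡ; identityʳ; commutativeSemigroup)
    open Multiples commutativeMonoid public
      using (×-assocˡ; ×-homo-+) renaming (_×_ to infixr 21 _⋆_)
    open CommutativeSemigroupProperties commutativeSemigroup using (interchange)
    open ≡-Reasoning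

    ⨁ : {B : Set} → List B → (B → A) → A
    ⨁ bs f = foldr (λ b a → f b ∙ a) ε bs

    module _ {B : Set} where

      ⨁-cong : ∀ (bs : List B) {f g : B → A} → (∀ b → f b ≡ g b) → ⨁ bs f ≡ ⨁ bs g
      ⨁-cong []       f≡g = refl
      ⨁-cong (b ∷ bs) f≡g = cong₂ _∙_ (f≡g b) (⨁-cong bs f≡g)

      ⨁-++ : ∀ (bs cs : List B) {f : B → A} → ⨁ (bs ++ cs) f ≡ ⨁ bs f ∙ ⨁ cs f
      ⨁-++ []       cs {f} = sym (identityˡ (⨁ cs f))
      ⨁-++ (b ∷ bs) cs {f} = trans (cong (f b ∙_) (⨁-++ bs cs)) (sym (assoc (f b) (⨁ bs f) (⨁ cs f)))

      ⨁-ε : ∀ (bs : List B) → ⨁ bs (λ _ → ε) ≡ ε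
      ⨁-ε []       = refl
      ⨁-ε (b ∷ bs) = trans (identityˡ _) (⨁-ε bs)

      ⨁-∙ : ∀ (bs : List B) (f g : B → A) → ⨁ bs (λ b → f b ∙ g b) ≡ ⨁ bs f ∙ ⨁ bs g
      ⨁-∙ []       f g = sym (identityˡ ε)
      ⨁-∙ (b ∷ bs) f g = trans (cong (_ ∙_) (⨁-∙ bs f g)) (interchange (f b) (g b) (⨁ bs f) (⨁ bs g))

      ⨁-⋆ : ∀ n (bs : List B) (f : B → A) → ⨁ bs (λ b → n ⋆ f b) ≡ n ⋆ ⨁ bs f
      ⨁-⋆ zero    bs f = ⨁-ε bs
      ⨁-⋆ (suc n) bs f = trans (⨁-∙ bs f (λ b → n ⋆ f b)) (cong (⨁ bs f ∙_) (⨁-⋆ n bs f))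

    ⨁-swap : ∀ {B C : Set} (bs : List B) (cs : List C) {f : B → C → A} →
             ⨁ bs (λ b → ⨁ cs (f b)) ≡ ⨁ cs (λ c → ⨁ bs (λ b → f b c))
    ⨁-swap []       cs     = sym (⨁-ε cs)
    ⨁-swap (b ∷ bs) cs {f} =
      trans (cong (⨁ cs (f b) ∙_) (⨁-swap bs cs)) (sym (⨁-∙ cs (f b) (λ c → ⨁ bs (λ b′ → f b′ c))))

    ⨁-map : ∀ {B C : Set} (h : B → C) bs {f : C → A} → ⨁ (map h bs) f ≡ ⨁ bs (f ∘ h)
    ⨁-map h []           = refl
    ⨁-map h (b ∷ bs) {f} = cong (f (h b) ∙_) (⨁-map h bs)

    ⨁-concatMap : ∀ {B C : Set} (h : B → List C) bs {f : C → A} →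
                  ⨁ (concatMap h bs) f ≡ ⨁ bs (λ b → ⨁ (h b) f)
    ⨁-concatMap h []           = refl
    ⨁-concatMap h (b ∷ bs) {f} = trans (⨁-++ (h b) (concatMap h bs)) (cong (⨁ (h b) f ∙_) (⨁-concatMap h bs))

    ⨁-upTo-suc : ∀ n {f : ℕ → A} → ⨁ (upTo (suc n)) f ≡ f 0 ∙ ⨁ (upTo n) (f ∘ suc)
    ⨁-upTo-suc n {f} = cong (f 0 ∙_) (trans (cong (λ bs → ⨁ bs f) (sym (List.map-upTo suc n))) (⨁-map suc (upTo n)))

    -- The bound on `i` is made available for truncated subtractions that behave well only in the
    -- range of summation.
    ⨁-upTo-cong : ∀ n {f g : ℕ → A} → (∀ i → i < n → f i ≡ g i) → ⨁ (upTo n) f ≡ ⨁ (upTo n) g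
    ⨁-upTo-cong zero            f≡g = refl
    ⨁-upTo-cong (suc n) {f} {g} f≡g = begin
      ⨁ (upTo (suc n)) f          ≡⟨ ⨁-upTo-suc n ⟩
      f 0 ∙ ⨁ (upTo n) (f ∘ suc)  ≡⟨ cong₂ _∙_ (f≡g 0 z<s) (⨁-upTo-cong n λ i i<n → f≡g (suc i) (s<s i<n)) ⟩
      g 0 ∙ ⨁ (upTo n) (g ∘ suc)  ≡⟨ ⨁-upTo-suc n ⟨
      ⨁ (upTo (suc n)) g          ∎

    ⨁-splits₂ : ∀ n {f : ℕ × ℕ → A} → ⨁ (splits₂ n) f ≡ ⨁ (upTo (suc n)) (λ i → f (i , n ∸ i))
    ⨁-splits₂ n = ⨁-map (λ i → i , n ∸ i) (upTo (suc n))

    ⨁-splits₃ : ∀ n {f : ℕ × ℕ × ℕ → A} →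
                ⨁ (splits₃ n) f ≡ ⨁ (splits₂ n) (λ (i , r) → ⨁ (splits₂ r) (λ p → f (i , p)))
    ⨁-splits₃ n = trans (⨁-concatMap (λ (i , r) → map (i ,_) (splits₂ r)) (splits₂ n))
      (⨁-cong (splits₂ n) λ (i , r) → ⨁-map (i ,_) (splits₂ r))

    ⨁-splits₄ : ∀ n {f : ℕ × ℕ × ℕ × ℕ → A} →
                ⨁ (splits₄ n) f ≡ ⨁ (splits₂ n) (λ (i , r) → ⨁ (splits₃ r) (λ p → f (i , p)))
    ⨁-splits₄ n = trans (⨁-concatMap (λ (i , r) → map (i ,_) (splits₃ r)) (splits₂ n))
      (⨁-cong (splits₂ n) λ (i , r) → ⨁-map (i ,_) (splits₃ r))

    -- A composition either starts with 1 or arises from a composition of n by raising its first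
    -- entry. For at least two parts, these alternatives say that its `interlace` starts with y or
    -- with x.
    ⨁-compositions-suc : ∀ ℓ n {f : Vec ℕ⁺ (suc ℓ) → A} →
      ⨁ (compositions (suc ℓ) (suc n)) f ≡
      ⨁ (compositions ℓ n) (λ α → f (pos 1 ∷ α)) ∙
      ⨁ (compositions (suc ℓ) n) (λ α → f (pos (suc (value (head α))) ∷ tail α))
    ⨁-compositions-suc ℓ n {f} = begin
      ⨁ (compositions (suc ℓ) (suc n)) f
        ≡⟨ ⨁-concatMap (λ i → map (pos (suc i) ∷_) (compositions ℓ (suc n ∸ suc i))) (upTo (suc n)) ⟩
      ⨁ (upTo (suc n)) (λ i → ⨁ (map (pos (suc i) ∷_) (compositions ℓ (n ∸ i))) f)
        ≡⟨ ⨁-cong (upTo (suc n)) (λ i → ⨁-map (pos (suc i) ∷_) (compositions ℓ (n ∸ i))) ⟩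
      ⨁ (upTo (suc n)) (λ i → ⨁ (compositions ℓ (n ∸ i)) (λ α → f (pos (suc i) ∷ α)))
        ≡⟨ ⨁-upTo-suc n ⟩
      ⨁ (compositions ℓ n) (λ α → f (pos 1 ∷ α)) ∙
      ⨁ (upTo n) (λ i → ⨁ (compositions ℓ (n ∸ suc i)) (λ α → f (pos (suc (suc i)) ∷ α)))
        ≡⟨ cong (⨁ (compositions ℓ n) (λ α → f (pos 1 ∷ α)) ∙_) (⨁-cong (upTo n) λ i →
             ⨁-map (pos (suc i) ∷_) (compositions ℓ (n ∸ suc i))) ⟨
      ⨁ (compositions ℓ n) (λ α → f (pos 1 ∷ α)) ∙
      ⨁ (upTo n) (λ i → ⨁ (map (pos (suc i) ∷_) (compositions ℓ (n ∸ suc i))) f⁺)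
        ≡⟨ cong (⨁ (compositions ℓ n) (λ α → f (pos 1 ∷ α)) ∙_)
             (⨁-concatMap (λ i → map (pos (suc i) ∷_) (compositions ℓ (n ∸ suc i))) (upTo n)) ⟨
      ⨁ (compositions ℓ n) (λ α → f (pos 1 ∷ α)) ∙ ⨁ (compositions (suc ℓ) n) f⁺ ∎
      where
      f⁺ : Vec ℕ⁺ (suc ℓ) → A
      f⁺ α = f (pos (suc (value (head α))) ∷ tail α)

    ⨁-compositions-short : ∀ {ℓ n} → n < ℓ → {f : Vec ℕ⁺ ℓ → A} → ⨁ (compositions ℓ n) f ≡ ε
    ⨁-compositions-short {suc ℓ} {zero}  _   = refl
    ⨁-compositions-short {suc ℓ} {suc n} n<ℓ = trans (⨁-compositions-suc ℓ n) (trans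
      (cong₂ _∙_ (⨁-compositions-short (s<s⁻¹ n<ℓ)) (⨁-compositions-short (ℕ.<-trans (ℕ.n<1+n n) n<ℓ)))
      (identityˡ ε))

    -- Sums over shuffles.

    module _ {L : Set} where

      ⨁-⧢-[] : ∀ (u : List L) {f : List L → A} → ⨁ (u ⧢ []) f ≡ f u
      ⨁-⧢-[] []      = identityʳ _
      ⨁-⧢-[] (a ∷ u) = identityʳ _

      ⨁-⧢-∷ : ∀ (a : L) u b v {f : List L → A} →
        ⨁ ((a ∷ u) ⧢ (b ∷ v)) f ≡ ⨁ (u ⧢ (b ∷ v)) (f ∘ (a ∷_)) ∙ ⨁ ((a ∷ u) ⧢ v) (f ∘ (b ∷_))
      ⨁-⧢-∷ a u b v = trans (⨁-++ (map (a ∷_) (u ⧢ (b ∷ v))) _)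
        (cong₂ _∙_ (⨁-map (a ∷_) (u ⧢ (b ∷ v))) (⨁-map (b ∷_) ((a ∷ u) ⧢ v)))

      ⨁-⧢-comm : ∀ (u v : List L) {f : List L → A} → ⨁ (u ⧢ v) f ≡ ⨁ (v ⧢ u) f
      ⨁-⧢-comm []      v           = trans (identityʳ _) (sym (⨁-⧢-[] v))
      ⨁-⧢-comm (a ∷ u) []          = refl
      ⨁-⧢-comm (a ∷ u) (b ∷ v) {f} = begin
        ⨁ ((a ∷ u) ⧢ (b ∷ v)) f
          ≡⟨ ⨁-⧢-∷ a u b v ⟩
        ⨁ (u ⧢ (b ∷ v)) (f ∘ (a ∷_)) ∙ ⨁ ((a ∷ u) ⧢ v) (f ∘ (b ∷_))
          ≡⟨ comm _ _ ⟩
        ⨁ ((a ∷ u) ⧢ v) (f ∘ (b ∷_)) ∙ ⨁ (u ⧢ (b ∷ v)) (f ∘ (a ∷_))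
          ≡⟨ cong₂ _∙_ (⨁-⧢-comm (a ∷ u) v) (⨁-⧢-comm u (b ∷ v)) ⟩
        ⨁ (v ⧢ (a ∷ u)) (f ∘ (b ∷_)) ∙ ⨁ ((b ∷ v) ⧢ u) (f ∘ (a ∷_))
          ≡⟨ ⨁-⧢-∷ b v a u ⟨
        ⨁ ((b ∷ v) ⧢ (a ∷ u)) f ∎

      ⨁-splits-∷ : ∀ (b : L) v {f : List L × List L → A} →
        ⨁ (splits (b ∷ v)) f ≡ f ([] , b ∷ v) ∙ ⨁ (splits v) (f ∘ map₁ (b ∷_))
      ⨁-splits-∷ b v {f} = cong (f ([] , b ∷ v) ∙_) (cong (f ([ b ] , v) ∙_) (⨁-map (map₁ (b ∷_)) (splits⁺ v)))

      -- In a shuffle of u a u′ with v, the marked letter a separates a prefix of v from the rest of v.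
      ⨁-⧢-split : ∀ u a u′ (v : List L) {f : List L → A} →
        ⨁ ((u ++ a ∷ u′) ⧢ v) f ≡
        ⨁ (splits v) (λ (v₁ , v₂) → ⨁ (u ⧢ v₁) λ w₁ → ⨁ (u′ ⧢ v₂) λ w₂ → f (w₁ ++ a ∷ w₂))
      ⨁-⧢-split [] a u′ [] {f} = begin
        f (a ∷ u′) ∙ ε ≡⟨ cong (_∙ ε) (⨁-⧢-[] u′) ⟨
        ⨁ (u′ ⧢ []) (λ w → f (a ∷ w)) ∙ ε ≡⟨ cong (_∙ ε) (identityʳ _) ⟨
        (⨁ (u′ ⧢ []) (λ w → f (a ∷ w)) ∙ ε) ∙ ε ∎
      ⨁-⧢-split [] a u′ (b ∷ v) {f} = begin
        ⨁ ((a ∷ u′) ⧢ (b ∷ v)) f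
          ≡⟨ ⨁-⧢-∷ a u′ b v ⟩
        ⨁ (u′ ⧢ (b ∷ v)) (f ∘ (a ∷_)) ∙ ⨁ ((a ∷ u′) ⧢ v) (f ∘ (b ∷_))
          ≡⟨ cong₂ _∙_ (sym (identityʳ _)) (⨁-⧢-split [] a u′ v) ⟩
        ⨁ ([] ⧢ []) (λ w₁ → ⨁ (u′ ⧢ (b ∷ v)) λ w₂ → f (w₁ ++ a ∷ w₂)) ∙
        ⨁ (splits v) (λ (v₁ , v₂) → ⨁ ([] ⧢ (b ∷ v₁)) λ w₁ → ⨁ (u′ ⧢ v₂) λ w₂ → f (w₁ ++ a ∷ w₂))
          ≡⟨ ⨁-splits-∷ b v ⟨
        ⨁ (splits (b ∷ v)) (λ (v₁ , v₂) → ⨁ ([] ⧢ v₁) λ w₁ → ⨁ (u′ ⧢ v₂) λ w₂ → f (w₁ ++ a ∷ w₂)) ∎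
      ⨁-⧢-split (c ∷ u) a u′ [] {f} = begin
        f (c ∷ u ++ a ∷ u′) ∙ ε ≡⟨ cong (_∙ ε) (⨁-⧢-[] u′) ⟨
        ⨁ (u′ ⧢ []) (λ w₂ → f (c ∷ u ++ a ∷ w₂)) ∙ ε ≡⟨ cong (_∙ ε) (identityʳ _) ⟨
        (⨁ (u′ ⧢ []) (λ w₂ → f (c ∷ u ++ a ∷ w₂)) ∙ ε) ∙ ε ∎
      ⨁-⧢-split (c ∷ u) a u′ (b ∷ v) {f} = begin
        ⨁ ((c ∷ u ++ a ∷ u′) ⧢ (b ∷ v)) f
          ≡⟨ ⨁-⧢-∷ c (u ++ a ∷ u′) b v ⟩
        ⨁ ((u ++ a ∷ u′) ⧢ (b ∷ v)) (f ∘ (c ∷_)) ∙ ⨁ ((c ∷ u ++ a ∷ u′) ⧢ v) (f ∘ (b ∷_))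
          -- The shuffle starts with c or with b. In the second case b lies in the prefix, so only
          -- `v` is cut; the remaining steps pair these cuts with the cuts of b ∷ v that have a
          -- nonempty prefix.
          ≡⟨ cong₂ _∙_ (⨁-⧢-split u a u′ (b ∷ v)) (⨁-⧢-split (c ∷ u) a u′ v) ⟩
        ⨁ (splits (b ∷ v)) (λ (v₁ , v₂) → ⨁ (u ⧢ v₁) λ w₁ → R (c ∷ w₁) v₂) ∙
        ⨁ (splits v) (λ (v₁ , v₂) → ⨁ ((c ∷ u) ⧢ v₁) λ w₁ → R (b ∷ w₁) v₂)
          ≡⟨ cong (_∙ ⨁ (splits v) (λ (v₁ , v₂) → ⨁ ((c ∷ u) ⧢ v₁) λ w₁ → R (b ∷ w₁) v₂)) (⨁-splits-∷ b v) ⟩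
        (⨁ (u ⧢ []) (λ w₁ → R (c ∷ w₁) (b ∷ v)) ∙
         ⨁ (splits v) (λ (v₁ , v₂) → ⨁ (u ⧢ (b ∷ v₁)) λ w₁ → R (c ∷ w₁) v₂)) ∙
        ⨁ (splits v) (λ (v₁ , v₂) → ⨁ ((c ∷ u) ⧢ v₁) λ w₁ → R (b ∷ w₁) v₂)
          ≡⟨ assoc _ _ _ ⟩
        ⨁ (u ⧢ []) (λ w₁ → R (c ∷ w₁) (b ∷ v)) ∙
        (⨁ (splits v) (λ (v₁ , v₂) → ⨁ (u ⧢ (b ∷ v₁)) λ w₁ → R (c ∷ w₁) v₂) ∙
         ⨁ (splits v) (λ (v₁ , v₂) → ⨁ ((c ∷ u) ⧢ v₁) λ w₁ → R (b ∷ w₁) v₂))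
          ≡⟨ cong₂ _∙_ (trans (⨁-⧢-[] u) (sym (identityʳ _))) (trans (sym (⨁-∙ (splits v) _ _))
               (⨁-cong (splits v) λ (v₁ , v₂) → sym (⨁-⧢-∷ c u b v₁))) ⟩
        ⨁ ((c ∷ u) ⧢ []) (λ w₁ → R w₁ (b ∷ v)) ∙
        ⨁ (splits v) (λ (v₁ , v₂) → ⨁ ((c ∷ u) ⧢ (b ∷ v₁)) λ w₁ → R w₁ v₂)
          ≡⟨ ⨁-splits-∷ b v ⟨
        ⨁ (splits (b ∷ v)) (λ (v₁ , v₂) → ⨁ ((c ∷ u) ⧢ v₁) λ w₁ → R w₁ v₂) ∎
        where
        R : List L → List L → A
        R w₁ v₂ = ⨁ (u′ ⧢ v₂) λ w₂ → f (w₁ ++ a ∷ w₂)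

      ⨁-splits⁺-replicate : ∀ n (a : L) v {f : List L × List L → A} →
        ⨁ (splits⁺ (replicate n a ++ v)) f ≡
        ⨁ (upTo n) (λ i → f (replicate (suc i) a , replicate (n ∸ suc i) a ++ v)) ∙
        ⨁ (splits⁺ v) (f ∘ map₁ (replicate n a ++_))
      ⨁-splits⁺-replicate zero    a v     = sym (identityˡ _)
      ⨁-splits⁺-replicate (suc n) a v {f} = begin
        f ([ a ] , replicate n a ++ v) ∙ ⨁ (map (map₁ (a ∷_)) (splits⁺ (replicate n a ++ v))) f
          ≡⟨ cong (f ([ a ] , replicate n a ++ v) ∙_)
               (trans (⨁-map (map₁ (a ∷_)) (splits⁺ (replicate n a ++ v))) (⨁-splits⁺-replicate n a v)) ⟩
        f ([ a ] , replicate n a ++ v) ∙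
        (⨁ (upTo n) (λ i → f (replicate (suc (suc i)) a , replicate (n ∸ suc i) a ++ v)) ∙
         ⨁ (splits⁺ v) (f ∘ map₁ (replicate (suc n) a ++_)))
          ≡⟨ assoc _ _ _ ⟨
        (f ([ a ] , replicate n a ++ v) ∙
         ⨁ (upTo n) (λ i → f (replicate (suc (suc i)) a , replicate (n ∸ suc i) a ++ v))) ∙
        ⨁ (splits⁺ v) (f ∘ map₁ (replicate (suc n) a ++_))
          ≡⟨ cong (_∙ ⨁ (splits⁺ v) (f ∘ map₁ (replicate (suc n) a ++_))) (⨁-upTo-suc n) ⟨
        ⨁ (upTo (suc n)) (λ i → f (replicate (suc i) a , replicate (suc n ∸ suc i) a ++ v)) ∙
        ⨁ (splits⁺ v) (f ∘ map₁ (replicate (suc n) a ++_)) ∎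

      ⨁-splits-replicate-++ : ∀ n (a : L) v {f : List L × List L → A} →
        ⨁ (splits (replicate n a ++ v)) f ≡
        ⨁ (upTo (suc n)) (λ i → f (replicate i a , replicate (n ∸ i) a ++ v)) ∙
        ⨁ (splits⁺ v) (f ∘ map₁ (replicate n a ++_))
      ⨁-splits-replicate-++ n a v {f} = begin
        f ([] , replicate n a ++ v) ∙ ⨁ (splits⁺ (replicate n a ++ v)) f
          ≡⟨ cong (f ([] , replicate n a ++ v) ∙_) (⨁-splits⁺-replicate n a v) ⟩
        f ([] , replicate n a ++ v) ∙
        (⨁ (upTo n) (λ i → f (replicate (suc i) a , replicate (n ∸ suc i) a ++ v)) ∙
         ⨁ (splits⁺ v) (f ∘ map₁ (replicate n a ++_)))
          ≡⟨ assoc _ _ _ ⟨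
        (f ([] , replicate n a ++ v) ∙
         ⨁ (upTo n) (λ i → f (replicate (suc i) a , replicate (n ∸ suc i) a ++ v))) ∙
        ⨁ (splits⁺ v) (f ∘ map₁ (replicate n a ++_))
          ≡⟨ cong (_∙ ⨁ (splits⁺ v) (f ∘ map₁ (replicate n a ++_))) (⨁-upTo-suc n) ⟨
        ⨁ (upTo (suc n)) (λ i → f (replicate i a , replicate (n ∸ i) a ++ v)) ∙
        ⨁ (splits⁺ v) (f ∘ map₁ (replicate n a ++_)) ∎

      ⨁-splits-replicate : ∀ n (a : L) {f : List L × List L → A} →
        ⨁ (splits (replicate n a)) f ≡ ⨁ (splits₂ n) (λ (i , r) → f (replicate i a , replicate r a))
      ⨁-splits-replicate n a {f} = begin
        ⨁ (splits (replicate n a)) f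
          ≡⟨ cong (λ v → ⨁ (splits v) f) (List.++-identityʳ (replicate n a)) ⟨
        ⨁ (splits (replicate n a ++ [])) f
          ≡⟨ ⨁-splits-replicate-++ n a [] ⟩
        ⨁ (upTo (suc n)) (λ i → f (replicate i a , replicate (n ∸ i) a ++ [])) ∙ ε
          ≡⟨ identityʳ _ ⟩
        ⨁ (upTo (suc n)) (λ i → f (replicate i a , replicate (n ∸ i) a ++ []))
          ≡⟨ ⨁-cong (upTo (suc n)) (λ i → cong (λ v → f (replicate i a , v)) (List.++-identityʳ (replicate (n ∸ i) a))) ⟩
        ⨁ (upTo (suc n)) (λ i → f (replicate i a , replicate (n ∸ i) a))
          ≡⟨ ⨁-splits₂ n ⟨
        ⨁ (splits₂ n) (λ (i , r) → f (replicate i a , replicate r a)) ∎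

      ⨁-replicate-⧢-split : ∀ j (b : L) u a u′ {f : List L → A} →
        ⨁ (replicate j b ⧢ (u ++ a ∷ u′)) f ≡
        ⨁ (splits₂ j) (λ (i , r) → ⨁ (replicate i b ⧢ u) λ w₁ → ⨁ (replicate r b ⧢ u′) λ w₂ → f (w₁ ++ a ∷ w₂))
      ⨁-replicate-⧢-split j b u a u′ {f} = begin
        ⨁ (replicate j b ⧢ (u ++ a ∷ u′)) f
          ≡⟨ ⨁-⧢-comm (replicate j b) (u ++ a ∷ u′) ⟩
        ⨁ ((u ++ a ∷ u′) ⧢ replicate j b) f
          ≡⟨ ⨁-⧢-split u a u′ (replicate j b) ⟩
        ⨁ (splits (replicate j b)) (λ (v₁ , v₂) → ⨁ (u ⧢ v₁) λ w₁ → ⨁ (u′ ⧢ v₂) λ w₂ → f (w₁ ++ a ∷ w₂))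
          ≡⟨ ⨁-splits-replicate j b ⟩
        ⨁ (splits₂ j) (λ (i , r) → ⨁ (u ⧢ replicate i b) λ w₁ → ⨁ (u′ ⧢ replicate r b) λ w₂ → f (w₁ ++ a ∷ w₂))
          ≡⟨ ⨁-cong (splits₂ j) (λ (i , r) → trans (⨁-⧢-comm u (replicate i b))
               (⨁-cong (replicate i b ⧢ u) λ w₁ → ⨁-⧢-comm u′ (replicate r b))) ⟩
        ⨁ (splits₂ j) (λ (i , r) → ⨁ (replicate i b ⧢ u) λ w₁ → ⨁ (replicate r b ⧢ u′) λ w₂ → f (w₁ ++ a ∷ w₂)) ∎

      -- All these shuffles are the same word. Whether the first letter comes from one factor or the
      -- other is Pascal's rule.
      ⨁-replicate-⧢-replicate : ∀ p q (a : L) {f : List L → A} →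
        ⨁ (replicate p a ⧢ replicate q a) f ≡ ((p + q) C q) ⋆ f (replicate (p + q) a)
      ⨁-replicate-⧢-replicate zero q a {f} = cong (_⋆ f (replicate q a)) (sym (nCn≡1 q))
      ⨁-replicate-⧢-replicate (suc p) zero a {f} = cong (λ n → f (a ∷ replicate n a) ∙ ε) (sym (ℕ.+-identityʳ p))
      ⨁-replicate-⧢-replicate (suc p) (suc q) a {f} = begin
        ⨁ (replicate (suc p) a ⧢ replicate (suc q) a) f
          ≡⟨ ⨁-⧢-∷ a (replicate p a) a (replicate q a) ⟩
        ⨁ (replicate p a ⧢ replicate (suc q) a) (f ∘ (a ∷_)) ∙ ⨁ (replicate (suc p) a ⧢ replicate q a) (f ∘ (a ∷_))
          ≡⟨ cong₂ _∙_ (⨁-replicate-⧢-replicate p (suc q) a) (⨁-replicate-⧢-replicate (suc p) q a) ⟩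
        ((p + suc q) C suc q) ⋆ f⁺ (p + suc q) ∙ ((suc p + q) C q) ⋆ f⁺ (suc p + q)
          ≡⟨ cong (λ n → ((p + suc q) C suc q) ⋆ f⁺ (p + suc q) ∙ (n C q) ⋆ f⁺ n) (ℕ.+-suc p q) ⟨
        ((p + suc q) C suc q) ⋆ f⁺ (p + suc q) ∙ ((p + suc q) C q) ⋆ f⁺ (p + suc q)
          ≡⟨ comm _ _ ⟩
        ((p + suc q) C q) ⋆ f⁺ (p + suc q) ∙ ((p + suc q) C suc q) ⋆ f⁺ (p + suc q)
          ≡⟨ ×-homo-+ (f⁺ (p + suc q)) ((p + suc q) C q) ((p + suc q) C suc q) ⟨
        ((p + suc q) C q + (p + suc q) C suc q) ⋆ f⁺ (p + suc q)
          ≡⟨ cong (_⋆ f⁺ (p + suc q)) (nCk+nC[k+1]≡[n+1]C[k+1] (p + suc q) q) ⟩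
        ((suc p + suc q) C suc q) ⋆ f (replicate (suc p + suc q) a) ∎
        where
        f⁺ : ℕ → A
        f⁺ n = f (a ∷ replicate n a)

      -- The last letter of a^(n+1) is marked. Of the other factor, i letters precede the mark and
      -- mix with n letters only, whence the binomial coefficient of i + n over n.
      ⨁-replicate-⧢-replicate-++ : ∀ m n (a : L) v {f : List L → A} →
        ⨁ (replicate m a ⧢ (replicate (suc n) a ++ v)) f ≡
        ⨁ (splits₂ m) (λ (i , r) → ((i + n) C n) ⋆ ⨁ (replicate r a ⧢ v) λ w → f (replicate (suc (i + n)) a ++ w))
      ⨁-replicate-⧢-replicate-++ m n a v {f} = begin
        ⨁ (replicate m a ⧢ (replicate (suc n) a ++ v)) f
          ≡⟨ cong (λ v′ → ⨁ (replicate m a ⧢ v′) f) (replicate-suc-++ n a v) ⟩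
        ⨁ (replicate m a ⧢ (replicate n a ++ a ∷ v)) f
          ≡⟨ ⨁-replicate-⧢-split m a (replicate n a) a v ⟩
        ⨁ (splits₂ m) (λ (i , r) → ⨁ (replicate i a ⧢ replicate n a) λ w₁ → ⨁ (replicate r a ⧢ v) λ w₂ → f (w₁ ++ a ∷ w₂))
          ≡⟨ ⨁-cong (splits₂ m) (λ (i , r) → trans (⨁-replicate-⧢-replicate i n a)
               (cong (((i + n) C n) ⋆_) (⨁-cong (replicate r a ⧢ v) λ w → cong f (sym (replicate-suc-++ (i + n) a w))))) ⟩
        ⨁ (splits₂ m) (λ (i , r) → ((i + n) C n) ⋆ ⨁ (replicate r a ⧢ v) λ w → f (replicate (suc (i + n)) a ++ w)) ∎

    -- The y's leave q + 1 gaps, and each entry is one more than the number of x's in its gap, so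
    -- the total is p + q + 1. The induction matches the first letter of a shuffle with the two
    -- alternatives of `⨁-compositions-suc`. The total is a variable so that it can be written as in
    -- the theorem.
    ⨁-y⧢x : ∀ q p {n} → n ≡ suc (p + q) → ∀ {f : List Letter → A} →
            ⨁ (y ^^ q ⧢ x ^^ p) f ≡ ⨁ (compositions (suc q) n) (f ∘ interlace)
    ⨁-y⧢x zero    zero    refl     = refl
    ⨁-y⧢x zero    (suc p) refl {f} = begin
      f (x ^^ suc p) ∙ ε
        ≡⟨ ⨁-y⧢x zero p refl {f ∘ (x ∷_)} ⟩
      ⨁ (compositions 1 (suc (p + 0))) (λ α → f (x ∷ interlace α))
        ≡⟨ identityˡ _ ⟨
      ε ∙ ⨁ (compositions 1 (suc (p + 0))) (λ α → f (x ∷ interlace α))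
        ≡⟨ cong (ε ∙_) (⨁-cong (compositions 1 (suc (p + 0))) λ α → cong f (interlace-suc α)) ⟨
      ε ∙ ⨁ (compositions 1 (suc (p + 0))) (λ α → f (interlace (pos (suc (value (head α))) ∷ tail α)))
        ≡⟨ ⨁-compositions-suc 0 (suc (p + 0)) ⟨
      ⨁ (compositions 1 (suc (suc (p + 0)))) (f ∘ interlace) ∎
    ⨁-y⧢x (suc q) zero    refl {f} = begin
      f (y ^^ suc q) ∙ ε
        ≡⟨ cong (_∙ ε) (⨁-⧢-[] (y ^^ q)) ⟨
      ⨁ (y ^^ q ⧢ []) (f ∘ (y ∷_)) ∙ ε
        -- There are no compositions of q + 1 into q + 2 parts; this supplies the missing second
        -- alternative.
        ≡⟨ cong₂ _∙_ (⨁-y⧢x q zero refl) (sym (⨁-compositions-short (ℕ.n<1+n (suc q)))) ⟩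
      ⨁ (compositions (suc q) (suc q)) (λ α → f (y ∷ interlace α)) ∙
      ⨁ (compositions (suc (suc q)) (suc q)) (λ α → f (interlace (pos (suc (value (head α))) ∷ tail α)))
        ≡⟨ cong (_∙ ⨁ (compositions (suc (suc q)) (suc q)) (λ α → f (interlace (pos (suc (value (head α))) ∷ tail α))))
             (⨁-cong (compositions (suc q) (suc q)) λ α → cong f (interlace-pos1 α)) ⟨
      ⨁ (compositions (suc q) (suc q)) (λ α → f (interlace (pos 1 ∷ α))) ∙
      ⨁ (compositions (suc (suc q)) (suc q)) (λ α → f (interlace (pos (suc (value (head α))) ∷ tail α)))
        ≡⟨ ⨁-compositions-suc (suc q) (suc q) ⟨
      ⨁ (compositions (suc (suc q)) (suc (suc q))) (f ∘ interlace) ∎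
    ⨁-y⧢x (suc q) (suc p) refl {f} = begin
      ⨁ (y ^^ suc q ⧢ x ^^ suc p) f
        ≡⟨ ⨁-⧢-∷ y (y ^^ q) x (x ^^ p) ⟩
      ⨁ (y ^^ q ⧢ x ^^ suc p) (f ∘ (y ∷_)) ∙ ⨁ (y ^^ suc q ⧢ x ^^ p) (f ∘ (x ∷_))
        ≡⟨ cong₂ _∙_ (⨁-y⧢x q (suc p) (cong suc (ℕ.+-suc p q))) (⨁-y⧢x (suc q) p refl) ⟩
      ⨁ (compositions (suc q) n) (λ α → f (y ∷ interlace α)) ∙
      ⨁ (compositions (suc (suc q)) n) (λ α → f (x ∷ interlace α))
        ≡⟨ cong₂ _∙_ (⨁-cong (compositions (suc q) n) λ α → cong f (interlace-pos1 α))
                     (⨁-cong (compositions (suc (suc q)) n) λ α → cong f (interlace-suc α)) ⟨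
      ⨁ (compositions (suc q) n) (λ α → f (interlace (pos 1 ∷ α))) ∙
      ⨁ (compositions (suc (suc q)) n) (λ α → f (interlace (pos (suc (value (head α))) ∷ tail α)))
        ≡⟨ ⨁-compositions-suc (suc q) n ⟨
      ⨁ (compositions (suc (suc q)) (suc n)) (f ∘ interlace) ∎
      where
      n = suc (p + suc q)

    ⨁-x⧢y : ∀ p q {n} → n ≡ suc (p + q) → ∀ {f : List Letter → A} →
            ⨁ (x ^^ p ⧢ y ^^ q) f ≡ ⨁ (compositions (suc q) n) (f ∘ interlace)
    ⨁-x⧢y p q n≡ = trans (⨁-⧢-comm (x ^^ p) (y ^^ q)) (⨁-y⧢x q p n≡)

    -- Shuffles of a power with words of two, three or four blocks.

    ⨁-y⧢xy : ∀ j p t {f : List Letter → A} →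
      ⨁ (y ^^ j ⧢ (x ^^ p ++ y ^^ suc t)) f ≡
      ⨁ (splits₂ j) λ (j₁ , j₂) →
      ⨁ (compositions (suc j₁) (p + j₁ + 1)) λ α →
        ((j₂ + t) C t) ⋆ f (interlace α ++ y ^^ suc (j₂ + t))
    ⨁-y⧢xy j p t {f} = begin
      ⨁ (y ^^ j ⧢ (x ^^ p ++ y ^^ suc t)) f
        -- The first y of y^(t+1) is marked: before it y's mix with x's, after it only y's are left.
        ≡⟨ ⨁-replicate-⧢-split j y (x ^^ p) y (y ^^ t) ⟩
      ⨁ (splits₂ j) (λ (j₁ , j₂) → ⨁ (y ^^ j₁ ⧢ x ^^ p) λ w₁ → ⨁ (y ^^ j₂ ⧢ y ^^ t) λ w₂ → f (w₁ ++ y ∷ w₂))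
        ≡⟨ ⨁-cong (splits₂ j) (λ (j₁ , j₂) → trans
             (⨁-cong (y ^^ j₁ ⧢ x ^^ p) λ w₁ → ⨁-replicate-⧢-replicate j₂ t y)
             (⨁-y⧢x j₁ p (ℕ.+-comm (p + j₁) 1))) ⟩
      (⨁ (splits₂ j) λ (j₁ , j₂) →
       ⨁ (compositions (suc j₁) (p + j₁ + 1)) λ α →
         ((j₂ + t) C t) ⋆ f (interlace α ++ y ^^ suc (j₂ + t))) ∎

    -- The first x of x^(s+1) is marked, which leaves x^s for `⨁-y⧢xy`. The total s + j₂ + 1
    -- obtained there is the one in the theorem, with s + 1 in the role of its s.
    ⨁-y⧢yxy : ∀ j q s t {f : List Letter → A} →
      ⨁ (y ^^ j ⧢ (y ^^ q ++ x ^^ suc s ++ y ^^ suc t)) f ≡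
      ⨁ (splits₃ j) λ (j₁ , j₂ , j₃) →
      ⨁ (compositions (suc j₂) (suc s + j₂)) λ β →
        (((j₁ + q) C q) * ((j₃ + t) C t)) ⋆ f (y ^^ (j₁ + q) ++ x ∷ interlace β ++ y ^^ suc (j₃ + t))
    ⨁-y⧢yxy j q s t {f} = begin
      ⨁ (y ^^ j ⧢ (y ^^ q ++ x ^^ suc s ++ y ^^ suc t)) f
        ≡⟨ ⨁-replicate-⧢-split j y (y ^^ q) x (x ^^ s ++ y ^^ suc t) ⟩
      ⨁ (splits₂ j) (λ (j₁ , r) → ⨁ (y ^^ j₁ ⧢ y ^^ q) λ w₁ → ⨁ (y ^^ r ⧢ (x ^^ s ++ y ^^ suc t)) λ w₂ → f (w₁ ++ x ∷ w₂))
        ≡⟨ ⨁-cong (splits₂ j) (λ (j₁ , r) → trans (⨁-replicate-⧢-replicate j₁ q y)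
             (trans (cong (((j₁ + q) C q) ⋆_) (⨁-y⧢xy r s t)) (trans
               (sym (⨁-⋆ ((j₁ + q) C q) (splits₂ r) _))
               (⨁-cong (splits₂ r) λ (j₂ , j₃) → trans
                 (sym (⨁-⋆ ((j₁ + q) C q) (compositions (suc j₂) (s + j₂ + 1)) _))
                 (trans (⨁-cong (compositions (suc j₂) (s + j₂ + 1)) λ β →
                   ×-assocˡ (g j₁ j₃ (interlace β)) ((j₁ + q) C q) ((j₃ + t) C t))
                 (cong (λ n → ⨁ (compositions (suc j₂) n) λ β →
                          (((j₁ + q) C q) * ((j₃ + t) C t)) ⋆ g j₁ j₃ (interlace β))
                       (ℕ.+-comm (s + j₂) 1))))))) ⟩
      (⨁ (splits₂ j) λ (j₁ , r) →
       ⨁ (splits₂ r) λ (j₂ , j₃) →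
       ⨁ (compositions (suc j₂) (suc s + j₂)) λ β →
         (((j₁ + q) C q) * ((j₃ + t) C t)) ⋆ f (y ^^ (j₁ + q) ++ x ∷ interlace β ++ y ^^ suc (j₃ + t)))
        ≡⟨ ⨁-splits₃ j ⟨
      (⨁ (splits₃ j) λ (j₁ , j₂ , j₃) →
       ⨁ (compositions (suc j₂) (suc s + j₂)) λ β →
         (((j₁ + q) C q) * ((j₃ + t) C t)) ⋆ f (y ^^ (j₁ + q) ++ x ∷ interlace β ++ y ^^ suc (j₃ + t))) ∎
      where
      g : ℕ → ℕ → List Letter → A
      g j₁ j₃ w = f (y ^^ (j₁ + q) ++ x ∷ w ++ y ^^ suc (j₃ + t))

    -- The first y of y^(k+1) is marked. The sum over α comes from the left of the mark and is moved
    -- inside the sum over the cuts on the right.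
    ⨁-y⧢xyxy : ∀ j p k s t {f : List Letter → A} →
      ⨁ (y ^^ j ⧢ (x ^^ p ++ y ^^ suc k ++ x ^^ suc s ++ y ^^ suc t)) f ≡
      ⨁ (splits₄ j) λ (j₁ , j₂ , j₃ , j₄) →
      ⨁ (compositions (suc j₁) (p + j₁ + 1)) λ α →
      ⨁ (compositions (suc j₃) (suc s + j₃)) λ β →
        (((j₂ + k) C k) * ((j₄ + t) C t)) ⋆
        f (interlace α ++ y ∷ y ^^ (j₂ + k) ++ x ∷ interlace β ++ y ^^ suc (j₄ + t))
    ⨁-y⧢xyxy j p k s t {f} = begin
      ⨁ (y ^^ j ⧢ (x ^^ p ++ y ^^ suc k ++ x ^^ suc s ++ y ^^ suc t)) f
        ≡⟨ ⨁-replicate-⧢-split j y (x ^^ p) y (y ^^ k ++ x ^^ suc s ++ y ^^ suc t) ⟩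
      ⨁ (splits₂ j) (λ (j₁ , r) → ⨁ (y ^^ j₁ ⧢ x ^^ p) λ w₁ →
        ⨁ (y ^^ r ⧢ (y ^^ k ++ x ^^ suc s ++ y ^^ suc t)) λ w₂ → f (w₁ ++ y ∷ w₂))
        ≡⟨ ⨁-cong (splits₂ j) (λ (j₁ , r) → trans
             (⨁-cong (y ^^ j₁ ⧢ x ^^ p) λ w₁ → ⨁-y⧢yxy r k s t)
             (trans (⨁-y⧢x j₁ p (ℕ.+-comm (p + j₁) 1))
               (⨁-swap (compositions (suc j₁) (p + j₁ + 1)) (splits₃ r)))) ⟩
      (⨁ (splits₂ j) λ (j₁ , r) →
       ⨁ (splits₃ r) λ (j₂ , j₃ , j₄) →
       ⨁ (compositions (suc j₁) (p + j₁ + 1)) λ α →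
       ⨁ (compositions (suc j₃) (suc s + j₃)) λ β →
         (((j₂ + k) C k) * ((j₄ + t) C t)) ⋆
         f (interlace α ++ y ∷ y ^^ (j₂ + k) ++ x ∷ interlace β ++ y ^^ suc (j₄ + t)))
        ≡⟨ ⨁-splits₄ j ⟨
      (⨁ (splits₄ j) λ (j₁ , j₂ , j₃ , j₄) →
       ⨁ (compositions (suc j₁) (p + j₁ + 1)) λ α →
       ⨁ (compositions (suc j₃) (suc s + j₃)) λ β →
         (((j₂ + k) C k) * ((j₄ + t) C t)) ⋆
         f (interlace α ++ y ∷ y ^^ (j₂ + k) ++ x ∷ interlace β ++ y ^^ suc (j₄ + t))) ∎

    ⨁-x⧢xy : ∀ m n q {f : List Letter → A} →
      ⨁ (x ^^ m ⧢ (x ^^ suc n ++ y ^^ q)) f ≡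
      ⨁ (splits₂ m) λ (m₁ , r) →
      ((m₁ + n) C n) ⋆
      (⨁ (compositions (suc q) (r + q + 1)) λ β → f (x ^^ suc (m₁ + n) ++ interlace β))
    ⨁-x⧢xy m n q {f} = trans (⨁-replicate-⧢-replicate-++ m n x (y ^^ q))
      (⨁-cong (splits₂ m) λ (m₁ , r) → cong (((m₁ + n) C n) ⋆_) (⨁-x⧢y r q (ℕ.+-comm (r + q) 1)))

    -- Two marks: the last x of x^(n+1) and the first x of x^(s+1). Between them m₂ x's are
    -- distributed over the k + 1 gaps of y^k.
    ⨁-x⧢xyx : ∀ m n k s {f : List Letter → A} →
      ⨁ (x ^^ m ⧢ (x ^^ suc n ++ y ^^ k ++ x ^^ suc s)) f ≡
      ⨁ (splits₃ m) λ (m₁ , m₂ , m₃) →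
      (((m₁ + n) C n) * ((m₃ + s) C s)) ⋆
      (⨁ (compositions (suc k) (m₂ + k + 1)) λ γ → f (x ^^ suc (m₁ + n) ++ interlace γ ++ x ^^ suc (m₃ + s)))
    ⨁-x⧢xyx m n k s {f} = begin
      ⨁ (x ^^ m ⧢ (x ^^ suc n ++ y ^^ k ++ x ^^ suc s)) f
        ≡⟨ ⨁-replicate-⧢-replicate-++ m n x (y ^^ k ++ x ^^ suc s) ⟩
      (⨁ (splits₂ m) λ (m₁ , r) → ((m₁ + n) C n) ⋆
        ⨁ (x ^^ r ⧢ (y ^^ k ++ x ^^ suc s)) λ w → f (x ^^ suc (m₁ + n) ++ w))
        ≡⟨ ⨁-cong (splits₂ m) (λ (m₁ , r) → trans (cong (((m₁ + n) C n) ⋆_) (inner m₁ r))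
             (trans (sym (⨁-⋆ ((m₁ + n) C n) (splits₂ r) _))
               (⨁-cong (splits₂ r) λ (m₂ , m₃) → ×-assocˡ _ ((m₁ + n) C n) ((m₃ + s) C s)))) ⟩
      (⨁ (splits₂ m) λ (m₁ , r) →
       ⨁ (splits₂ r) λ (m₂ , m₃) →
       (((m₁ + n) C n) * ((m₃ + s) C s)) ⋆
       (⨁ (compositions (suc k) (m₂ + k + 1)) λ γ → f (x ^^ suc (m₁ + n) ++ interlace γ ++ x ^^ suc (m₃ + s))))
        ≡⟨ ⨁-splits₃ m ⟨
      (⨁ (splits₃ m) λ (m₁ , m₂ , m₃) →
       (((m₁ + n) C n) * ((m₃ + s) C s)) ⋆
       (⨁ (compositions (suc k) (m₂ + k + 1)) λ γ → f (x ^^ suc (m₁ + n) ++ interlace γ ++ x ^^ suc (m₃ + s)))) ∎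
      where
      inner : ∀ m₁ r →
        ⨁ (x ^^ r ⧢ (y ^^ k ++ x ^^ suc s)) (λ w → f (x ^^ suc (m₁ + n) ++ w)) ≡
        ⨁ (splits₂ r) λ (m₂ , m₃) → ((m₃ + s) C s) ⋆
        (⨁ (compositions (suc k) (m₂ + k + 1)) λ γ → f (x ^^ suc (m₁ + n) ++ interlace γ ++ x ^^ suc (m₃ + s)))
      inner m₁ r = trans (⨁-replicate-⧢-split r x (y ^^ k) x (x ^^ s))
        (⨁-cong (splits₂ r) λ (m₂ , m₃) → trans
          (⨁-cong (x ^^ m₂ ⧢ y ^^ k) λ w₁ → ⨁-replicate-⧢-replicate m₃ s x)
          (trans (⨁-⋆ ((m₃ + s) C s) (x ^^ m₂ ⧢ y ^^ k) _)
            (cong (((m₃ + s) C s) ⋆_) (⨁-x⧢y m₂ k (ℕ.+-comm (m₂ + k) 1)))))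

    -- Three marks: the last x of x^(n+1), the last y of y^(k+1) and the last x of x^(s+1). The
    -- marked y closes the last entry of δ, so k y's are left to separate its k + 1 entries.
    ⨁-x⧢xyxy : ∀ m n k s q {f : List Letter → A} →
      ⨁ (x ^^ m ⧢ (x ^^ suc n ++ y ^^ suc k ++ x ^^ suc s ++ y ^^ q)) f ≡
      ⨁ (splits₄ m) λ (m₁ , m₂ , m₃ , m₄) →
      (((m₁ + n) C n) * ((m₃ + s) C s)) ⋆
      (⨁ (compositions (suc k) (m₂ + suc k)) λ δ →
       ⨁ (compositions (suc q) (m₄ + q + 1)) λ δ̃ →
         f (x ^^ suc (m₁ + n) ++ interlace δ ++ y ∷ x ^^ suc (m₃ + s) ++ interlace δ̃))
    ⨁-x⧢xyxy m n k s q {f} = begin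
      ⨁ (x ^^ m ⧢ (x ^^ suc n ++ y ^^ suc k ++ x ^^ suc s ++ y ^^ q)) f
        ≡⟨ ⨁-replicate-⧢-replicate-++ m n x (y ^^ suc k ++ x ^^ suc s ++ y ^^ q) ⟩
      (⨁ (splits₂ m) λ (m₁ , r) → ((m₁ + n) C n) ⋆
        ⨁ (x ^^ r ⧢ (y ^^ suc k ++ x ^^ suc s ++ y ^^ q)) λ w → f (x ^^ suc (m₁ + n) ++ w))
        ≡⟨ ⨁-cong (splits₂ m) (λ (m₁ , r) → trans (cong (((m₁ + n) C n) ⋆_) (inner m₁ r))
             (trans (sym (⨁-⋆ ((m₁ + n) C n) (splits₃ r) _))
               (⨁-cong (splits₃ r) λ (m₂ , m₃ , m₄) → ×-assocˡ _ ((m₁ + n) C n) ((m₃ + s) C s)))) ⟩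
      (⨁ (splits₂ m) λ (m₁ , r) → ⨁ (splits₃ r) λ (m₂ , m₃ , m₄) →
        (((m₁ + n) C n) * ((m₃ + s) C s)) ⋆ term m₁ m₂ m₃ m₄)
        ≡⟨ ⨁-splits₄ m ⟨
      (⨁ (splits₄ m) λ (m₁ , m₂ , m₃ , m₄) → (((m₁ + n) C n) * ((m₃ + s) C s)) ⋆ term m₁ m₂ m₃ m₄) ∎
      where
      term : ℕ → ℕ → ℕ → ℕ → A
      term m₁ m₂ m₃ m₄ =
        ⨁ (compositions (suc k) (m₂ + suc k)) λ δ →
        ⨁ (compositions (suc q) (m₄ + q + 1)) λ δ̃ →
          f (x ^^ suc (m₁ + n) ++ interlace δ ++ y ∷ x ^^ suc (m₃ + s) ++ interlace δ̃)

      inner : ∀ m₁ r →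
        ⨁ (x ^^ r ⧢ (y ^^ suc k ++ x ^^ suc s ++ y ^^ q)) (λ w → f (x ^^ suc (m₁ + n) ++ w)) ≡
        ⨁ (splits₃ r) λ (m₂ , m₃ , m₄) → ((m₃ + s) C s) ⋆ term m₁ m₂ m₃ m₄
      inner m₁ r = begin
        ⨁ (x ^^ r ⧢ (y ^^ suc k ++ x ^^ suc s ++ y ^^ q)) (λ w → f (x ^^ suc (m₁ + n) ++ w))
          ≡⟨ cong (λ v → ⨁ (x ^^ r ⧢ v) (λ w → f (x ^^ suc (m₁ + n) ++ w))) (replicate-suc-++ k y (x ^^ suc s ++ y ^^ q)) ⟩
        ⨁ (x ^^ r ⧢ (y ^^ k ++ y ∷ x ^^ suc s ++ y ^^ q)) (λ w → f (x ^^ suc (m₁ + n) ++ w))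
          ≡⟨ ⨁-replicate-⧢-split r x (y ^^ k) y (x ^^ suc s ++ y ^^ q) ⟩
        (⨁ (splits₂ r) λ (m₂ , r′) → ⨁ (x ^^ m₂ ⧢ y ^^ k) λ w₁ → ⨁ (x ^^ r′ ⧢ (x ^^ suc s ++ y ^^ q)) λ w₂ →
          f (x ^^ suc (m₁ + n) ++ w₁ ++ y ∷ w₂))
          ≡⟨ ⨁-cong (splits₂ r) (λ (m₂ , r′) → trans
               (⨁-cong (x ^^ m₂ ⧢ y ^^ k) λ w₁ → ⨁-x⧢xy r′ s q)
               (trans (⨁-x⧢y m₂ k (ℕ.+-suc m₂ k))
               (trans (⨁-swap (compositions (suc k) (m₂ + suc k)) (splits₂ r′))
               (⨁-cong (splits₂ r′) λ (m₃ , m₄) → ⨁-⋆ ((m₃ + s) C s) (compositions (suc k) (m₂ + suc k)) _)))) ⟩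
        (⨁ (splits₂ r) λ (m₂ , r′) → ⨁ (splits₂ r′) λ (m₃ , m₄) → ((m₃ + s) C s) ⋆ term m₁ m₂ m₃ m₄)
          ≡⟨ ⨁-splits₃ r ⟨
        (⨁ (splits₃ r) λ (m₂ , m₃ , m₄) → ((m₃ + s) C s) ⋆ term m₁ m₂ m₃ m₄) ∎

    -- The four positions of the last x.

    module _ (f : List Letter → A) (F : (s₁ : ℕ) → .{{_ : NonTrivial s₁}} → List ℕ⁺ → A)
             (f-word : ∀ s₁ .{{_ : NonTrivial s₁}} ss → f (word (pos s₁ {{nonTrivial⇒nonZero s₁}} ∷ ss)) ≡ F s₁ ss) where

      -- The shuffles in which the last x of x^(m+1) y^j splits the other word into v₁ and v₂.
      around-last-x : ℕ → ℕ → List Letter × List Letter → A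
      around-last-x m j (v₁ , v₂) = ⨁ (x ^^ m ⧢ v₁) λ w₁ → ⨁ (y ^^ j ⧢ v₂) λ w₂ → f (w₁ ++ x ∷ w₂)

      case₁ : ∀ m j n k s t .{{_ : NonZero n}} →
        ⨁ (upTo (suc n)) (λ i → around-last-x m j (x ^^ i , x ^^ (n ∸ i) ++ y ^^ suc k ++ x ^^ suc s ++ y ^^ suc t)) ≡
        S₁ (λ B → ⨁ {B}) _⋆_ F (suc m) n j (suc k) (suc s) (suc t)
      case₁ m j n k s t = ⨁-cong (upTo (suc n)) λ n₁ → begin
        around-last-x m j (x ^^ n₁ , x ^^ (n ∸ n₁) ++ y ^^ suc k ++ x ^^ suc s ++ y ^^ suc t)
          -- Both pieces are powers of x. They are exchanged so that the binomial coefficient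
          -- chooses the places of the m x's, as in Σ₁.
          ≡⟨ ⨁-⧢-comm (x ^^ m) (x ^^ n₁) ⟩
        ⨁ (x ^^ n₁ ⧢ x ^^ m) (λ w₁ → ⨁ (y ^^ j ⧢ v n₁) λ w₂ → f (w₁ ++ x ∷ w₂))
          ≡⟨ ⨁-replicate-⧢-replicate n₁ m x ⟩
        ((n₁ + m) C m) ⋆ ⨁ (y ^^ j ⧢ v n₁) (λ w₂ → f (x ^^ (n₁ + m) ++ x ∷ w₂))
          ≡⟨ cong (λ p → (p C m) ⋆ ⨁ (y ^^ j ⧢ v n₁) (λ w₂ → f (x ^^ p ++ x ∷ w₂))) (ℕ.+-comm n₁ m) ⟩
        ((m + n₁) C m) ⋆ ⨁ (y ^^ j ⧢ v n₁) (λ w₂ → f (x ^^ (m + n₁) ++ x ∷ w₂))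
          ≡⟨ cong (((m + n₁) C m) ⋆_) (⨁-y⧢xyxy j (n ∸ n₁) k s t) ⟩
        ((m + n₁) C m) ⋆ ⨁ (splits₄ j) _
          ≡⟨ ⨁-⋆ ((m + n₁) C m) (splits₄ j) _ ⟨
        ⨁ (splits₄ j) _
          ≡⟨ ⨁-cong (splits₄ j) (λ (j₁ , j₂ , j₃ , j₄) → trans
               (sym (⨁-⋆ ((m + n₁) C m) (compositions (suc j₁) (n ∸ n₁ + j₁ + 1)) _))
               (⨁-cong (compositions (suc j₁) (n ∸ n₁ + j₁ + 1)) λ α → trans
               (sym (⨁-⋆ ((m + n₁) C m) (compositions (suc j₃) (suc s + j₃)) _))
               (⨁-cong (compositions (suc j₃) (suc s + j₃)) λ α̃ → trans
               (×-assocˡ _ ((m + n₁) C m) (((j₂ + k) C k) * ((j₄ + t) C t)))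
               (cong₂ _⋆_
                 (trans (sym (ℕ.*-assoc ((m + n₁) C m) ((j₂ + k) C k) ((j₄ + t) C t)))
                   (cong₂ (λ c d → ((m + n₁) C m) * (c C k) * (d C t)) (sym (m+1+n∸1 j₂ k)) (sym (m+1+n∸1 j₄ t))))
                 (trans (cong f (index n₁ j₂ j₄ α α̃)) (f-word _ {{positives>1 (head α) (suc m) n₁}} _)))))) ⟩
        ⨁ (splits₄ j) _ ∎
        where
        v : ℕ → List Letter
        v n₁ = x ^^ (n ∸ n₁) ++ y ^^ suc k ++ x ^^ suc s ++ y ^^ suc t
        index : ∀ n₁ j₂ j₄ {j₁ j₃} (α : Vec ℕ⁺ (suc j₁)) (α̃ : Vec ℕ⁺ (suc j₃)) →
          x ^^ (m + n₁) ++ x ∷ interlace α ++ y ∷ y ^^ (j₂ + k) ++ x ∷ interlace α̃ ++ y ^^ suc (j₄ + t) ≡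
          word (pos (value (head α) + suc m + n₁) {{nonTrivial⇒nonZero _ {{positives>1 (head α) (suc m) n₁}}}} ∷
                toList (tail α) ++ ones (j₂ + suc k ∸ 1) ++
                (head α̃ ⊕ 1) ∷ toList (tail α̃) ++ ones (j₄ + suc t ∸ 1))
        index n₁ j₂ j₄ α α̃ = trans
          (sym (replicate-suc-++ (m + n₁) x _))
          (x^^-interlace-y (suc (m + n₁)) α _ {{nonTrivial⇒nonZero _ {{positives>1 (head α) (suc m) n₁}}}}
            (ℕ.+-assoc (value (head α)) (suc m) n₁) (trans
            (cong₂ (λ p w → y ^^ p ++ w) (sym (m+1+n∸1 j₂ k))
              (x∷interlace-y α̃ (ones (j₄ + suc t ∸ 1))
                (trans (cong (y ^^_) (sym (m+1+n∸1 j₄ t))) (sym (word-ones (j₄ + suc t ∸ 1))))))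
            (sym (word-ones-++ (j₂ + suc k ∸ 1) _))))

      case₂ : ∀ m j n k s t →
        ⨁ (upTo k) (λ i → around-last-x m j (x ^^ suc n ++ y ^^ suc i , y ^^ (k ∸ suc i) ++ x ^^ suc s ++ y ^^ suc t)) ≡
        S₂ (λ B → ⨁ {B}) _⋆_ F (suc m) (suc n) j k (suc s) (suc t)
      case₂ m j n k s t = ⨁-cong (upTo k) λ i → begin
        around-last-x m j (x ^^ suc n ++ y ^^ suc i , v i)
          ≡⟨ ⨁-x⧢xy m n (suc i) ⟩
        ⨁ (splits₂ m) (λ (m₁ , r) → ((m₁ + n) C n) ⋆
          (⨁ (compositions (suc (suc i)) (r + suc i + 1)) λ β →
           ⨁ (y ^^ j ⧢ v i) λ w₂ → f ((x ^^ suc (m₁ + n) ++ interlace β) ++ x ∷ w₂)))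
          ≡⟨ ⨁-splits₂ m ⟩
        ⨁ (upTo (suc m)) (λ m₁ → ((m₁ + n) C n) ⋆
          (⨁ (compositions (suc (suc i)) (m ∸ m₁ + suc i + 1)) λ β →
           ⨁ (y ^^ j ⧢ v i) λ w₂ → f ((x ^^ suc (m₁ + n) ++ interlace β) ++ x ∷ w₂)))
          -- Since m₁ ≤ m, truncated subtraction satisfies 1 + (m ∸ m₁) = (1 + m) ∸ m₁, which gives
          -- the total of β in Σ₂.
          ≡⟨ ⨁-upTo-cong (suc m) (λ m₁ m₁<1+m → cong₂ _⋆_
               (cong (_C n) (sym (m+1+n∸1 m₁ n)))
               (trans (cong (λ d → ⨁ (compositions (suc (suc i)) d) λ β →
                              ⨁ (y ^^ j ⧢ v i) λ w₂ → f ((x ^^ suc (m₁ + n) ++ interlace β) ++ x ∷ w₂))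
                            (trans (ℕ.+-comm (m ∸ m₁ + suc i) 1) (cong (_+ suc i) (sym (ℕ.+-∸-assoc 1 (ℕ.≤-pred m₁<1+m))))))
               (trans (⨁-cong (compositions (suc (suc i)) (suc m ∸ m₁ + suc i)) λ β → ⨁-y⧢yxy j (k ∸ suc i) s t)
               (trans (⨁-swap (compositions (suc (suc i)) (suc m ∸ m₁ + suc i)) (splits₃ j))
               (⨁-cong (splits₃ j) λ (j₁ , j₂ , j₃) →
                ⨁-cong (compositions (suc (suc i)) (suc m ∸ m₁ + suc i)) λ β →
                ⨁-cong (compositions (suc j₂) (suc s + j₂)) λ β̃ → cong₂ _⋆_
                  (cong (λ p → ((j₁ + (k ∸ suc i)) C (k ∸ suc i)) * (p C t)) (sym (m+1+n∸1 j₃ t)))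
                  (trans (cong f (index i m₁ (j₁ + (k ∸ suc i)) j₃ β β̃)) (f-word _ {{positives>1 (head β) (suc n) m₁}} _))))))) ⟩
        ⨁ (upTo (suc m)) _ ∎
        where
        v : ℕ → List Letter
        v i = y ^^ (k ∸ suc i) ++ x ^^ suc s ++ y ^^ suc t
        index : ∀ i m₁ q j₃ {j₂} (β : Vec ℕ⁺ (suc (suc i))) (β̃ : Vec ℕ⁺ (suc j₂)) →
          (x ^^ suc (m₁ + n) ++ interlace β) ++ x ∷ y ^^ q ++ x ∷ interlace β̃ ++ y ^^ suc (j₃ + t) ≡
          word (pos (value (head β) + suc n + m₁) {{nonTrivial⇒nonZero _ {{positives>1 (head β) (suc n) m₁}}}} ∷
                toList (init (tail β)) ++ block q (last (tail β)) (head β̃) ++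
                toList (tail β̃) ++ ones (j₃ + suc t ∸ 1))
        index i m₁ q j₃ β β̃ = trans
          (List.++-assoc (x ^^ suc (m₁ + n)) (interlace β) _)
          (x^^-interlace (suc (m₁ + n)) β _ {{nonTrivial⇒nonZero _ {{positives>1 (head β) (suc n) m₁}}}}
            (trans (ℕ.+-assoc (value (head β)) (suc n) m₁) (cong (λ e → value (head β) + suc e) (ℕ.+-comm n m₁)))
            (trans (word-block q (last (tail β)) β̃ (j₃ + t))
              (cong (λ p → word (block q (last (tail β)) (head β̃) ++ toList (tail β̃) ++ ones p)) (sym (m+1+n∸1 j₃ t)))))

      -- The last x falls into the second run of x's, so no y separates the run before it from the
      -- run after it. This produces the entry that combines γ and γ̃.
      case₃ : ∀ m j n k s t →
        ⨁ (upTo s) (λ i → around-last-x m j (x ^^ suc n ++ y ^^ suc k ++ x ^^ suc i , x ^^ (s ∸ suc i) ++ y ^^ suc t)) ≡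
        S₃ (λ B → ⨁ {B}) _⋆_ F (suc m) (suc n) j (suc k) s (suc t)
      case₃ m j n k s t = ⨁-cong (upTo s) λ i → begin
        around-last-x m j (x ^^ suc n ++ y ^^ suc k ++ x ^^ suc i , x ^^ (s ∸ suc i) ++ y ^^ suc t)
          ≡⟨ ⨁-x⧢xyx m n (suc k) i ⟩
        ⨁ (splits₃ m) _
          ≡⟨ ⨁-cong (splits₃ m) (λ (m₁ , m₂ , m₃) → cong₂ _⋆_
               (cong₂ (λ c d → (c C n) * (d C i)) (sym (m+1+n∸1 m₁ n)) (sym (m+1+n∸1 m₃ i)))
               (trans (⨁-cong (compositions (suc (suc k)) (m₂ + suc k + 1)) λ γ → ⨁-y⧢xy j (s ∸ suc i) t)
               (trans (⨁-swap (compositions (suc (suc k)) (m₂ + suc k + 1)) (splits₂ j))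
               (⨁-cong (splits₂ j) λ (j₁ , j₂) →
                ⨁-cong (compositions (suc (suc k)) (m₂ + suc k + 1)) λ γ →
                ⨁-cong (compositions (suc j₁) (s ∸ suc i + j₁ + 1)) λ γ̃ → cong₂ _⋆_
                  (cong (_C t) (sym (m+1+n∸1 j₂ t)))
                  (trans (cong f (index i m₁ m₃ j₂ γ γ̃)) (f-word _ {{positives>1 (head γ) (suc n) m₁}} _)))))) ⟩
        ⨁ (splits₃ m) _ ∎
        where
        index : ∀ i m₁ m₃ j₂ {j₁} (γ : Vec ℕ⁺ (suc (suc k))) (γ̃ : Vec ℕ⁺ (suc j₁)) →
          (x ^^ suc (m₁ + n) ++ interlace γ ++ x ^^ suc (m₃ + i)) ++ x ∷ interlace γ̃ ++ y ^^ suc (j₂ + t) ≡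
          word (pos (value (head γ) + suc n + m₁) {{nonTrivial⇒nonZero _ {{positives>1 (head γ) (suc n) m₁}}}} ∷
                toList (init (tail γ)) ++ (last (tail γ) ⊕ (value (head γ̃) + m₃ + suc i)) ∷
                toList (tail γ̃) ++ ones (j₂ + suc t ∸ 1))
        index i m₁ m₃ j₂ γ γ̃ = trans
          (List.++-assoc (x ^^ suc (m₁ + n)) (interlace γ ++ x ^^ suc (m₃ + i)) _)
          (trans (cong (x ^^ suc (m₁ + n) ++_) (List.++-assoc (interlace γ) (x ^^ suc (m₃ + i)) _))
          (x^^-interlace (suc (m₁ + n)) γ _ {{nonTrivial⇒nonZero _ {{positives>1 (head γ) (suc n) m₁}}}}
            (trans (ℕ.+-assoc (value (head γ)) (suc n) m₁) (cong (λ e → value (head γ) + suc e) (ℕ.+-comm n m₁)))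
            (trans (word-merge (last (tail γ)) γ̃ m₃ i (j₂ + t))
              (cong (λ p → word ((last (tail γ) ⊕ (value (head γ̃) + m₃ + suc i)) ∷ toList (tail γ̃) ++ ones p))
                (sym (m+1+n∸1 j₂ t))))))

      -- After the last x only powers of y are left, and their shuffles give the constant factor
      -- `c i`. The exponent is written `suc j` because at least one y must follow the last x in
      -- order to close the last entry of δ̃.
      case₄ : ∀ m j n k s t →
        ⨁ (upTo t) (λ i → around-last-x m (suc j) (x ^^ suc n ++ y ^^ suc k ++ x ^^ suc s ++ y ^^ suc i , y ^^ (t ∸ suc i))) ≡
        S₄ (λ B → ⨁ {B}) _⋆_ F (suc m) (suc n) (suc j) (suc k) (suc s) t
      case₄ m j n k s t = ⨁-cong (upTo t) λ i → begin
        around-last-x m (suc j) (x ^^ suc n ++ y ^^ suc k ++ x ^^ suc s ++ y ^^ suc i , y ^^ (t ∸ suc i))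
          ≡⟨ ⨁-cong (x ^^ m ⧢ (x ^^ suc n ++ y ^^ suc k ++ x ^^ suc s ++ y ^^ suc i)) (λ w → trans
               (⨁-⧢-comm (y ^^ suc j) (y ^^ (t ∸ suc i)))
               (trans (⨁-replicate-⧢-replicate (t ∸ suc i) (suc j) y)
                 (cong (λ p → (p C suc j) ⋆ f (w ++ x ∷ y ^^ p)) (ℕ.+-comm (t ∸ suc i) (suc j))))) ⟩
        ⨁ (x ^^ m ⧢ (x ^^ suc n ++ y ^^ suc k ++ x ^^ suc s ++ y ^^ suc i)) (λ w → c i ⋆ g i w)
          ≡⟨ ⨁-⋆ (c i) (x ^^ m ⧢ (x ^^ suc n ++ y ^^ suc k ++ x ^^ suc s ++ y ^^ suc i)) (g i) ⟩
        c i ⋆ ⨁ (x ^^ m ⧢ (x ^^ suc n ++ y ^^ suc k ++ x ^^ suc s ++ y ^^ suc i)) (g i)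
          ≡⟨ cong (c i ⋆_) (⨁-x⧢xyxy m n k s (suc i)) ⟩
        c i ⋆ ⨁ (splits₄ m) _
          ≡⟨ ⨁-⋆ (c i) (splits₄ m) _ ⟨
        ⨁ (splits₄ m) _
          ≡⟨ ⨁-cong (splits₄ m) (λ (m₁ , m₂ , m₃ , m₄) → trans
               (×-assocˡ _ (c i) (((m₁ + n) C n) * ((m₃ + s) C s)))
               (cong₂ _⋆_
                 (trans (ℕ.*-comm (c i) (((m₁ + n) C n) * ((m₃ + s) C s)))
                   (cong₂ (λ p q → (p C n) * (q C s) * c i) (sym (m+1+n∸1 m₁ n)) (sym (m+1+n∸1 m₃ s))))
                 (⨁-cong (compositions (suc k) (m₂ + suc k)) λ δ →
                  ⨁-cong (compositions (suc (suc i)) (m₄ + suc i + 1)) λ δ̃ →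
                  trans (cong f (index i m₁ m₃ δ δ̃)) (f-word _ {{positives>1 (head δ) (suc n) m₁}} _)))) ⟩
        ⨁ (splits₄ m) _ ∎
        where
        c : ℕ → ℕ
        c i = (suc j + (t ∸ suc i)) C suc j
        g : ℕ → List Letter → A
        g i w = f (w ++ x ∷ y ^^ (suc j + (t ∸ suc i)))
        index : ∀ i m₁ m₃ (δ : Vec ℕ⁺ (suc k)) (δ̃ : Vec ℕ⁺ (suc (suc i))) →
          (x ^^ suc (m₁ + n) ++ interlace δ ++ y ∷ x ^^ suc (m₃ + s) ++ interlace δ̃) ++ x ∷ y ^^ (suc j + (t ∸ suc i)) ≡
          word (pos (value (head δ) + suc n + m₁) {{nonTrivial⇒nonZero _ {{positives>1 (head δ) (suc n) m₁}}}} ∷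
                toList (tail δ) ++ (head δ̃ ⊕ (m₃ + suc s)) ∷
                toList (init (tail δ̃)) ++ (last (tail δ̃) ⊕ 1) ∷ ones (suc j + (t ∸ suc i) ∸ 1))
        index i m₁ m₃ δ δ̃ = begin
          (x ^^ suc (m₁ + n) ++ interlace δ ++ y ∷ x ^^ suc (m₃ + s) ++ interlace δ̃) ++ u
            ≡⟨ List.++-assoc (x ^^ suc (m₁ + n)) (interlace δ ++ y ∷ x ^^ suc (m₃ + s) ++ interlace δ̃) u ⟩
          x ^^ suc (m₁ + n) ++ (interlace δ ++ y ∷ x ^^ suc (m₃ + s) ++ interlace δ̃) ++ u
            ≡⟨ cong (x ^^ suc (m₁ + n) ++_) (trans
                 (List.++-assoc (interlace δ) (y ∷ x ^^ suc (m₃ + s) ++ interlace δ̃) u)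
                 (cong (λ w → interlace δ ++ y ∷ w) (List.++-assoc (x ^^ suc (m₃ + s)) (interlace δ̃) u))) ⟩
          x ^^ suc (m₁ + n) ++ interlace δ ++ y ∷ x ^^ suc (m₃ + s) ++ interlace δ̃ ++ u
            ≡⟨ cong (λ e → x ^^ suc (m₁ + n) ++ interlace δ ++ y ∷ x ^^ e ++ interlace δ̃ ++ u) (ℕ.+-suc m₃ s) ⟨
          x ^^ suc (m₁ + n) ++ interlace δ ++ y ∷ x ^^ (m₃ + suc s) ++ interlace δ̃ ++ u
            ≡⟨ x^^-interlace-y (suc (m₁ + n)) δ _ {{nonTrivial⇒nonZero _ {{positives>1 (head δ) (suc n) m₁}}}}
                 (trans (ℕ.+-assoc (value (head δ)) (suc n) m₁) (cong (λ e → value (head δ) + suc e) (ℕ.+-comm n m₁)))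
                 (x^^-interlace-⊕ (m₃ + suc s) δ̃ (j + (t ∸ suc i))) ⟩
          word (pos (value (head δ) + suc n + m₁) {{nonTrivial⇒nonZero _ {{positives>1 (head δ) (suc n) m₁}}}} ∷
                toList (tail δ) ++ (head δ̃ ⊕ (m₃ + suc s)) ∷
                toList (init (tail δ̃)) ++ (last (tail δ̃) ⊕ 1) ∷ ones (suc j + (t ∸ suc i) ∸ 1)) ∎
          where
          u = x ∷ y ^^ (suc j + (t ∸ suc i))

      ⨁-⧢-cases : ∀ m n j k s t →
        ⨁ ((x ^^ suc m ++ y ^^ suc j) ⧢ (x ^^ suc n ++ y ^^ suc k ++ x ^^ suc s ++ y ^^ suc t)) f ≡
        ((S₁ (λ B → ⨁ {B}) _⋆_ F (suc m) (suc n) (suc j) (suc k) (suc s) (suc t) ∙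
          S₂ (λ B → ⨁ {B}) _⋆_ F (suc m) (suc n) (suc j) (suc k) (suc s) (suc t)) ∙
          S₃ (λ B → ⨁ {B}) _⋆_ F (suc m) (suc n) (suc j) (suc k) (suc s) (suc t)) ∙
          S₄ (λ B → ⨁ {B}) _⋆_ F (suc m) (suc n) (suc j) (suc k) (suc s) (suc t)
      ⨁-⧢-cases m n j k s t = begin
        ⨁ ((x ^^ suc m ++ y ^^ suc j) ⧢ v) f
          ≡⟨ cong (λ u → ⨁ (u ⧢ v) f) (replicate-suc-++ m x (y ^^ suc j)) ⟩
        ⨁ ((x ^^ m ++ x ∷ y ^^ suc j) ⧢ v) f
          ≡⟨ ⨁-⧢-split (x ^^ m) x (y ^^ suc j) v ⟩
        ⨁ (splits v) h
          -- The cuts of the second word are sorted by the block in which the prefix ends; cuts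
          -- beyond the current block are passed on as `splits⁺` of the rest.
          ≡⟨ ⨁-splits-replicate-++ (suc n) x (y ^^ suc k ++ x ^^ suc s ++ y ^^ suc t) ⟩
        _ ∙ ⨁ (splits⁺ (y ^^ suc k ++ x ^^ suc s ++ y ^^ suc t)) (h ∘ map₁ (x ^^ suc n ++_))
          ≡⟨ cong₂ _∙_ (case₁ m (suc j) (suc n) k s t)
               (⨁-splits⁺-replicate (suc k) y (x ^^ suc s ++ y ^^ suc t)) ⟩
        s₁ ∙ (_ ∙ ⨁ (splits⁺ (x ^^ suc s ++ y ^^ suc t)) (h ∘ map₁ (x ^^ suc n ++_) ∘ map₁ (y ^^ suc k ++_)))
          ≡⟨ cong (s₁ ∙_) (cong₂ _∙_ (case₂ m (suc j) n (suc k) s t)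
               (⨁-splits⁺-replicate (suc s) x (y ^^ suc t))) ⟩
        s₁ ∙ (s₂ ∙ (_ ∙ ⨁ (splits⁺ (y ^^ suc t)) h₄))
          ≡⟨ cong (λ a → s₁ ∙ (s₂ ∙ a)) (cong₂ _∙_ (case₃ m (suc j) n k (suc s) t) (begin
               ⨁ (splits⁺ (y ^^ suc t)) h₄
                 ≡⟨ cong (λ u → ⨁ (splits⁺ u) h₄) (List.++-identityʳ (y ^^ suc t)) ⟨
               ⨁ (splits⁺ (y ^^ suc t ++ [])) h₄
                 ≡⟨ ⨁-splits⁺-replicate (suc t) y [] ⟩
               ⨁ (upTo (suc t)) (λ i → h₄ (y ^^ suc i , y ^^ (suc t ∸ suc i) ++ [])) ∙ ε
                 ≡⟨ identityʳ _ ⟩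
               ⨁ (upTo (suc t)) (λ i → h₄ (y ^^ suc i , y ^^ (suc t ∸ suc i) ++ []))
                 ≡⟨ ⨁-cong (upTo (suc t)) (λ i → cong (λ u → h₄ (y ^^ suc i , u)) (List.++-identityʳ (y ^^ (suc t ∸ suc i)))) ⟩
               ⨁ (upTo (suc t)) (λ i → h₄ (y ^^ suc i , y ^^ (suc t ∸ suc i)))
                 ≡⟨ case₄ m j n k s (suc t) ⟩
               s₄ ∎)) ⟩
        s₁ ∙ (s₂ ∙ (s₃ ∙ s₄))
          ≡⟨ assoc s₁ s₂ (s₃ ∙ s₄) ⟨
        (s₁ ∙ s₂) ∙ (s₃ ∙ s₄)
          ≡⟨ assoc (s₁ ∙ s₂) s₃ s₄ ⟨
        ((s₁ ∙ s₂) ∙ s₃) ∙ s₄ ∎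
        where
        v : List Letter
        v = x ^^ suc n ++ y ^^ suc k ++ x ^^ suc s ++ y ^^ suc t
        s₁ s₂ s₃ s₄ : A
        s₁ = S₁ (λ B → ⨁ {B}) _⋆_ F (suc m) (suc n) (suc j) (suc k) (suc s) (suc t)
        s₂ = S₂ (λ B → ⨁ {B}) _⋆_ F (suc m) (suc n) (suc j) (suc k) (suc s) (suc t)
        s₃ = S₃ (λ B → ⨁ {B}) _⋆_ F (suc m) (suc n) (suc j) (suc k) (suc s) (suc t)
        s₄ = S₄ (λ B → ⨁ {B}) _⋆_ F (suc m) (suc n) (suc j) (suc k) (suc s) (suc t)
        h h₄ : List Letter × List Letter → A
        h  = around-last-x m (suc j)
        h₄ = h ∘ map₁ (x ^^ suc n ++_) ∘ map₁ (y ^^ suc k ++_) ∘ map₁ (x ^^ suc s ++_)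

    ⨁-⧢-homomorphism : ∀ {R : Set}
      (sum : (B : Set) → List B → (B → R) → R) (_⊙_ : ℕ → R → R)
      (F : (s₁ : ℕ) → .{{_ : NonTrivial s₁}} → List ℕ⁺ → R) {F′ : (s₁ : ℕ) → .{{_ : NonTrivial s₁}} → List ℕ⁺ → A}
      (φ : R → A)
      (φ-sum : ∀ {B : Set} (bs : List B) g {g′} → (∀ b → φ (g b) ≡ g′ b) → φ (sum B bs g) ≡ ⨁ bs g′)
      (φ-⊙ : ∀ c a {a′} → φ a ≡ a′ → φ (c ⊙ a) ≡ c ⋆ a′)
      (φ-F : ∀ s₁ .{{_ : NonTrivial s₁}} ss → φ (F s₁ ss) ≡ F′ s₁ ss)
      (f : List Letter → A)
      (f-word : ∀ s₁ .{{_ : NonTrivial s₁}} ss → f (word (pos s₁ {{nonTrivial⇒nonZero s₁}} ∷ ss)) ≡ F′ s₁ ss)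
      -- If these instances were left to instance search, comparing zᵢ = Σᵢ with Sᵢ would unfold the real numbers.
      m n j k s t .{{m≢0 : NonZero (suc m)}} .{{n≢0 : NonZero (suc n)}} .{{k≢0 : NonZero (suc k)}} z₁ z₂ z₃ z₄ →
      z₁ ≡ S₁ sum _⊙_ F (suc m) (suc n) (suc j) (suc k) (suc s) (suc t) {{m≢0}} →
      z₂ ≡ S₂ sum _⊙_ F (suc m) (suc n) (suc j) (suc k) (suc s) (suc t) {{n≢0}} →
      z₃ ≡ S₃ sum _⊙_ F (suc m) (suc n) (suc j) (suc k) (suc s) (suc t) {{n≢0}} {{k≢0}} →
      z₄ ≡ S₄ sum _⊙_ F (suc m) (suc n) (suc j) (suc k) (suc s) (suc t) {{n≢0}} {{k≢0}} →
      ⨁ ((x ^^ suc m ++ y ^^ suc j) ⧢ (x ^^ suc n ++ y ^^ suc k ++ x ^^ suc s ++ y ^^ suc t)) f ≡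
      ((φ z₁ ∙ φ z₂) ∙ φ z₃) ∙ φ z₄
    ⨁-⧢-homomorphism sum _⊙_ F {F′} φ φ-sum φ-⊙ φ-F f f-word m n j k s t _ _ _ _ refl refl refl refl =
      trans (⨁-⧢-cases f F′ f-word m n j k s t)
        (sym (cong₂ _∙_ (cong₂ _∙_ (cong₂ _∙_ H⁺.φ-S₁ H⁺.φ-S₂) H.φ-S₃) H.φ-S₄))
      where
      module Φ = RightHandSideHomomorphism sum (λ B → ⨁ {B}) _⊙_ _⋆_ F F′ φ φ-sum φ-⊙ φ-F
      -- `S₃` and `S₄` match on their k, so `φ-S₃` and `φ-S₄` insert the successor themselves and
      -- are taken at k, the other two at `suc k`.
      module H  = Φ (suc m) (suc n) (suc j) k (suc s) (suc t)
      module H⁺ = Φ (suc m) (suc n) (suc j) (suc k) (suc s) (suc t)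

open Combinatorics

-- Multiple polylogarithms as power series.

module Analysis where
  open import Data.Rational.Base using (ℚ; 0ℚ; 1ℚ; _+_; _*_; _-_; ∣_∣; _≤_; _<_)
  import Data.Rational.Properties as ℚ
  open import Data.Rational.Solver using (module +-*-Solver)
  open RealArithmetic
  open Convergence using (ι; δ; ι-suc; δ*ι; recip-≥0; ≤-+ˡ; 0≤q-p; monotone; fromℚᵘ-*)

  open Sums ℚ.+-0-isCommutativeMonoid

  prefixSum : (ℕ → ℚ) → ℕ → ℚ
  prefixSum f zero    = f 0
  prefixSum f (suc n) = prefixSum f n + f (suc n)

  -- The coefficients of the product of two power series, by recursion on the first factor so that
  -- no difference n - i occurs.
  conv : (ℕ → ℚ) → (ℕ → ℚ) → ℕ → ℚ
  conv f g zero    = f 0 * g 0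
  conv f g (suc n) = f 0 * g (suc n) + conv (f ∘ suc) g n

  -- The coefficients of z · d/dz Li_{aw} as a function of those of Li_w.
  D : Letter → (ℕ → ℚ) → ℕ → ℚ
  D x f n       = f n
  D y f zero    = 0ℚ
  D y f (suc n) = prefixSum f n

  -- The coefficients of the multiple polylogarithm Li_w, as a word in x = dz/z and y = dz/(1 - z).
  coeff : List Letter → ℕ → ℚ
  coeff []      zero    = 1ℚ
  coeff []      (suc n) = 0ℚ
  coeff (a ∷ w) zero    = 0ℚ
  coeff (a ∷ w) (suc n) = δ n * D a (coeff w) (suc n)

  -- Products of polylogarithms.

  module _ where
    open ≡-Reasoning
    open +-*-Solver using (solve; _:=_; _:+_; _:*_; con)

    conv-cong : ∀ {f f′ g g′} → f ≗ f′ → g ≗ g′ → conv f g ≗ conv f′ g′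
    conv-cong f≗ g≗ zero    = cong₂ _*_ (f≗ 0) (g≗ 0)
    conv-cong f≗ g≗ (suc n) = cong₂ _+_ (cong₂ _*_ (f≗ 0) (g≗ (suc n))) (conv-cong (f≗ ∘ suc) g≗ n)

    conv-+ : ∀ f f′ g n → conv (λ i → f i + f′ i) g n ≡ conv f g n + conv f′ g n
    conv-+ f f′ g zero    = ℚ.*-distribʳ-+ (g 0) (f 0) (f′ 0)
    conv-+ f f′ g (suc n) = trans (cong ((f 0 + f′ 0) * g (suc n) +_) (conv-+ (f ∘ suc) (f′ ∘ suc) g n))
      (solve 5 (λ a b c d e → (a :+ b) :* c :+ (d :+ e) := (a :* c :+ d) :+ (b :* c :+ e)) refl
        (f 0) (f′ 0) (g (suc n)) (conv (f ∘ suc) g n) (conv (f′ ∘ suc) g n))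

    -- `prefixSum` is multiplication by 1/(1 - z), so it passes from a factor to the product.
    conv-prefixSumˡ : ∀ f g n → conv (prefixSum f) g n ≡ prefixSum (conv f g) n
    conv-prefixSumˡ f g zero    = refl
    conv-prefixSumˡ f g (suc n) = begin
      f 0 * g (suc n) + conv (λ i → prefixSum f i + f (suc i)) g n
        ≡⟨ cong (f 0 * g (suc n) +_) (conv-+ (prefixSum f) (f ∘ suc) g n) ⟩
      f 0 * g (suc n) + (conv (prefixSum f) g n + conv (f ∘ suc) g n)
        ≡⟨ solve 3 (λ a b c → a :+ (b :+ c) := b :+ (a :+ c)) refl
             (f 0 * g (suc n)) (conv (prefixSum f) g n) (conv (f ∘ suc) g n) ⟩
      conv (prefixSum f) g n + conv f g (suc n)
        ≡⟨ cong (_+ conv f g (suc n)) (conv-prefixSumˡ f g n) ⟩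
      prefixSum (conv f g) (suc n) ∎

    prefixSum-conv-suc : ∀ f g n →
      prefixSum (conv f g) (suc n) ≡ f 0 * prefixSum g (suc n) + prefixSum (conv (f ∘ suc) g) n
    prefixSum-conv-suc f g zero    =
      solve 4 (λ a b c d → a :* b :+ (a :* c :+ d) := a :* (b :+ c) :+ d) refl (f 0) (g 0) (g 1) (f 1 * g 0)
    prefixSum-conv-suc f g (suc n) = begin
      prefixSum (conv f g) (suc n) + (f 0 * g (suc (suc n)) + conv (f ∘ suc) g (suc n))
        ≡⟨ cong (_+ (f 0 * g (suc (suc n)) + conv (f ∘ suc) g (suc n))) (prefixSum-conv-suc f g n) ⟩
      (f 0 * prefixSum g (suc n) + prefixSum (conv (f ∘ suc) g) n) + (f 0 * g (suc (suc n)) + conv (f ∘ suc) g (suc n))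
        ≡⟨ solve 5 (λ a b c d e → (a :* b :+ c) :+ (a :* d :+ e) := a :* (b :+ d) :+ (c :+ e)) refl
             (f 0) (prefixSum g (suc n)) (prefixSum (conv (f ∘ suc) g) n) (g (suc (suc n))) (conv (f ∘ suc) g (suc n)) ⟩
      f 0 * prefixSum g (suc (suc n)) + prefixSum (conv (f ∘ suc) g) (suc n) ∎

    conv-prefixSumʳ : ∀ f g n → conv f (prefixSum g) n ≡ prefixSum (conv f g) n
    conv-prefixSumʳ f g zero    = refl
    conv-prefixSumʳ f g (suc n) = begin
      f 0 * prefixSum g (suc n) + conv (f ∘ suc) (prefixSum g) n
        ≡⟨ cong (f 0 * prefixSum g (suc n) +_) (conv-prefixSumʳ (f ∘ suc) g n) ⟩
      f 0 * prefixSum g (suc n) + prefixSum (conv (f ∘ suc) g) n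
        ≡⟨ prefixSum-conv-suc f g n ⟨
      prefixSum (conv f g) (suc n) ∎

    conv-sucʳ : ∀ f g n → g 0 ≡ 0ℚ → conv f g (suc n) ≡ conv f (g ∘ suc) n
    conv-sucʳ f g zero    g0≡0 = begin
      f 0 * g 1 + f 1 * g 0  ≡⟨ cong (λ q → f 0 * g 1 + f 1 * q) g0≡0 ⟩
      f 0 * g 1 + f 1 * 0ℚ   ≡⟨ solve 2 (λ a b → a :+ b :* con 0ℚ := a) refl (f 0 * g 1) (f 1) ⟩
      f 0 * g 1              ∎
    conv-sucʳ f g (suc n) g0≡0 = cong (f 0 * g (suc (suc n)) +_) (conv-sucʳ (f ∘ suc) g n g0≡0)

    -- `D y` is multiplication by z/(1 - z) and `D x` is the identity, so both pass from a factor to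
    -- the product.
    conv-Dˡ : ∀ a f g n → g 0 ≡ 0ℚ → conv (D a f) g n ≡ D a (conv f g) n
    conv-Dˡ x f g n       g0≡0 = conv-cong (λ _ → refl) (λ _ → refl) n
    conv-Dˡ y f g zero    g0≡0 = ℚ.*-zeroˡ (g 0)
    conv-Dˡ y f g (suc n) g0≡0 = begin
      0ℚ * g (suc n) + conv (prefixSum f) g n  ≡⟨ solve 2 (λ a b → con 0ℚ :* a :+ b := b) refl (g (suc n)) (conv (prefixSum f) g n) ⟩
      conv (prefixSum f) g n                   ≡⟨ conv-prefixSumˡ f g n ⟩
      prefixSum (conv f g) n                   ∎

    conv-Dʳ : ∀ a f g n → conv f (D a g) n ≡ D a (conv f g) n
    conv-Dʳ x f g n       = conv-cong (λ _ → refl) (λ _ → refl) n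
    conv-Dʳ y f g zero    = ℚ.*-zeroʳ (f 0)
    conv-Dʳ y f g (suc n) = trans (conv-sucʳ f (D y g) n refl) (conv-prefixSumʳ f g n)

    -- The Leibniz rule for z · d/dz; the shift k is needed because the induction replaces f by f ∘ suc.
    conv-leibniz : ∀ k f g n →
      ι (k ℕ.+ n) * conv f g n ≡ conv (λ i → ι (k ℕ.+ i) * f i) g n + conv f (λ i → ι i * g i) n
    conv-leibniz k f g zero    = solve 3 (λ a b c → a :* (b :* c) := a :* b :* c :+ b :* (con 0ℚ :* c)) refl
      (ι (k ℕ.+ 0)) (f 0) (g 0)
    conv-leibniz k f g (suc n) = begin
      ι (k ℕ.+ suc n) * (f 0 * g (suc n) + conv (f ∘ suc) g n)
        ≡⟨ ℚ.*-distribˡ-+ (ι (k ℕ.+ suc n)) _ _ ⟩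
      ι (k ℕ.+ suc n) * (f 0 * g (suc n)) + ι (k ℕ.+ suc n) * conv (f ∘ suc) g n
        ≡⟨ cong₂ (λ a b → a * (f 0 * g (suc n)) + b) (ι-+ k (suc n)) (begin
             ι (k ℕ.+ suc n) * conv (f ∘ suc) g n
               ≡⟨ cong (λ m → ι m * conv (f ∘ suc) g n) (ℕ.+-suc k n) ⟩
             ι (suc k ℕ.+ n) * conv (f ∘ suc) g n
               ≡⟨ conv-leibniz (suc k) (f ∘ suc) g n ⟩
             conv (λ i → ι (suc k ℕ.+ i) * f (suc i)) g n + conv (f ∘ suc) (λ i → ι i * g i) n
               ≡⟨ cong (_+ conv (f ∘ suc) (λ i → ι i * g i) n)
                    (conv-cong (λ i → cong (λ m → ι m * f (suc i)) (sym (ℕ.+-suc k i))) (λ _ → refl) n) ⟩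
             P + Q ∎) ⟩
      (ι k + ι (suc n)) * (f 0 * g (suc n)) + (P + Q)
        ≡⟨ solve 6 (λ a b c d e f → (a :+ b) :* (c :* d) :+ (e :+ f) := (a :* c :* d :+ e) :+ (c :* (b :* d) :+ f)) refl
             (ι k) (ι (suc n)) (f 0) (g (suc n)) P Q ⟩
      (ι k * f 0 * g (suc n) + P) + (f 0 * (ι (suc n) * g (suc n)) + Q)
        ≡⟨ cong (λ m → (ι m * f 0 * g (suc n) + P) + (f 0 * (ι (suc n) * g (suc n)) + Q)) (ℕ.+-identityʳ k) ⟨
      (ι (k ℕ.+ 0) * f 0 * g (suc n) + P) + (f 0 * (ι (suc n) * g (suc n)) + Q) ∎
      where
      P = conv (λ i → ι (k ℕ.+ suc i) * f (suc i)) g n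
      Q = conv (f ∘ suc) (λ i → ι i * g i) n
      ι-+ : ∀ m n → ι (m ℕ.+ n) ≡ ι m + ι n
      ι-+ zero    n = sym (ℚ.+-identityˡ (ι n))
      ι-+ (suc m) n = trans (ι-suc (m ℕ.+ n)) (trans (cong (1ℚ +_) (ι-+ m n))
        (trans (sym (ℚ.+-assoc 1ℚ (ι m) (ι n))) (cong (_+ ι n) (sym (ι-suc m)))))

    -- Words not ending in x: z · d/dz Li_x = Li_[] fails at z^0, where coeff x vanishes and coeff [] does not.
    data Regular : List Letter → Set where
      []  : Regular []
      y∷_ : ∀ {w} → Regular w → Regular (y ∷ w)
      x∷_ : ∀ {a w} → Regular (a ∷ w) → Regular (x ∷ a ∷ w)

    regular-tail : ∀ {a w} → Regular (a ∷ w) → Regular w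
    regular-tail (y∷ r) = r
    regular-tail (x∷ r) = r

    -- The factor `ι n` cancels the division in `coeff`. At n = 0 there is nothing to cancel and
    -- `D a (coeff w)` must vanish by itself, which for a = x holds because regularity makes w
    -- nonempty.
    ι*coeff : ∀ {a w} → Regular (a ∷ w) → ∀ n → ι n * coeff (a ∷ w) n ≡ D a (coeff w) n
    ι*coeff (y∷ r) zero = refl
    ι*coeff (x∷ r) zero = refl
    ι*coeff {a} {w} _ (suc n) = begin
      ι (suc n) * (δ n * D a (coeff w) (suc n))
        ≡⟨ solve 3 (λ a b c → a :* (b :* c) := b :* a :* c) refl (ι (suc n)) (δ n) (D a (coeff w) (suc n)) ⟩
      δ n * ι (suc n) * D a (coeff w) (suc n)
        ≡⟨ cong (_* D a (coeff w) (suc n)) (δ*ι n) ⟩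
      1ℚ * D a (coeff w) (suc n)
        ≡⟨ ℚ.*-identityˡ _ ⟩
      D a (coeff w) (suc n) ∎

    prefixSum-cong : ∀ {f g} → f ≗ g → prefixSum f ≗ prefixSum g
    prefixSum-cong f≗g zero    = f≗g 0
    prefixSum-cong f≗g (suc n) = cong₂ _+_ (prefixSum-cong f≗g n) (f≗g (suc n))

    prefixSum-⨁ : ∀ {B : Set} (bs : List B) (f : B → ℕ → ℚ) n →
                  prefixSum (λ i → ⨁ bs λ b → f b i) n ≡ ⨁ bs λ b → prefixSum (f b) n
    prefixSum-⨁ bs f zero    = refl
    prefixSum-⨁ bs f (suc n) = trans (cong (_+ ⨁ bs (λ b → f b (suc n))) (prefixSum-⨁ bs f n))
      (sym (⨁-∙ bs (λ b → prefixSum (f b) n) (λ b → f b (suc n))))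

    D-cong : ∀ a {f g} → f ≗ g → D a f ≗ D a g
    D-cong x f≗g n       = f≗g n
    D-cong y f≗g zero    = refl
    D-cong y f≗g (suc n) = prefixSum-cong f≗g n

    D-⨁ : ∀ a {B : Set} (bs : List B) (f : B → ℕ → ℚ) n →
          D a (λ i → ⨁ bs λ b → f b i) n ≡ ⨁ bs λ b → D a (f b) n
    D-⨁ x bs f n       = refl
    D-⨁ y bs f zero    = sym (⨁-ε bs)
    D-⨁ y bs f (suc n) = prefixSum-⨁ bs f n

    *-⨁ : ∀ q {B : Set} (bs : List B) (f : B → ℚ) → q * ⨁ bs f ≡ ⨁ bs λ b → q * f b
    *-⨁ q []       f = ℚ.*-zeroʳ q
    *-⨁ q (b ∷ bs) f = trans (ℚ.*-distribˡ-+ q (f b) (⨁ bs f)) (cong (q * f b +_) (*-⨁ q bs f))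

    conv-1 : ∀ f n → conv f (coeff []) n ≡ f n
    conv-1 f zero    = ℚ.*-identityʳ (f 0)
    conv-1 f (suc n) = trans (cong (f 0 * 0ℚ +_) (conv-1 (f ∘ suc) n))
      (solve 2 (λ a b → a :* con 0ℚ :+ b := b) refl (f 0) (f (suc n)))

    1-conv : ∀ g n → conv (coeff []) g n ≡ g n
    1-conv g zero    = ℚ.*-identityˡ (g 0)
    1-conv g (suc n) = trans (cong (1ℚ * g (suc n) +_) (0-conv g n))
      (solve 1 (λ a → con 1ℚ :* a :+ con 0ℚ := a) refl (g (suc n)))
      where
      0-conv : ∀ g n → conv (λ _ → 0ℚ) g n ≡ 0ℚ
      0-conv g zero    = ℚ.*-zeroˡ (g 0)
      0-conv g (suc n) = trans (cong (0ℚ * g (suc n) +_) (0-conv g n))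
        (solve 1 (λ a → con 0ℚ :* a :+ con 0ℚ := con 0ℚ) refl (g (suc n)))

    -- For nonempty words both sides have constant term 0, and z · d/dz determines all other
    -- coefficients. By the Leibniz rule, differentiation removes the first letter of one factor;
    -- integration puts this letter in front of every shuffle of the remaining words, which is the
    -- recursion of `⧢`.
    conv-coeff : ∀ {u v} → Regular u → Regular v → ∀ n → conv (coeff u) (coeff v) n ≡ ⨁ (u ⧢ v) λ w → coeff w n
    conv-coeff {[]}    {v}     _ _ n = trans (1-conv (coeff v) n) (sym (ℚ.+-identityʳ (coeff v n)))
    conv-coeff {a ∷ u} {[]}    _ _ n = trans (conv-1 (coeff (a ∷ u)) n) (sym (ℚ.+-identityʳ (coeff (a ∷ u) n)))
    conv-coeff {a ∷ u} {b ∷ v} ru rv zero    = sym (trans (⨁-⧢-∷ a u b v {λ w → coeff w 0})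
      (trans (cong₂ _+_ (⨁-ε (u ⧢ (b ∷ v))) (⨁-ε ((a ∷ u) ⧢ v))) refl))
    conv-coeff {a ∷ u} {b ∷ v} ru rv (suc n) = begin
      c
        ≡⟨ ℚ.*-identityˡ c ⟨
      1ℚ * c
        -- Multiplying by `δ n * ι (suc n)` differentiates and then integrates.
        ≡⟨ cong (_* c) (δ*ι n) ⟨
      δ n * ι (suc n) * c
        ≡⟨ ℚ.*-assoc (δ n) (ι (suc n)) c ⟩
      δ n * (ι (suc n) * c)
        ≡⟨ cong (δ n *_) (conv-leibniz 0 (coeff (a ∷ u)) (coeff (b ∷ v)) (suc n)) ⟩
      δ n * (conv (λ i → ι i * coeff (a ∷ u) i) (coeff (b ∷ v)) (suc n) +
             conv (coeff (a ∷ u)) (λ i → ι i * coeff (b ∷ v) i) (suc n))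
        ≡⟨ cong (δ n *_) (cong₂ _+_
             (trans (conv-cong {g = coeff (b ∷ v)} (ι*coeff ru) (λ _ → refl) (suc n))
             (trans (conv-Dˡ a (coeff u) (coeff (b ∷ v)) (suc n) refl)
             (trans (D-cong a (conv-coeff (regular-tail ru) rv) (suc n))
                    (D-⨁ a (u ⧢ (b ∷ v)) coeff (suc n)))))
             (trans (conv-cong {coeff (a ∷ u)} (λ _ → refl) (ι*coeff rv) (suc n))
             (trans (conv-Dʳ b (coeff (a ∷ u)) (coeff v) (suc n))
             (trans (D-cong b (conv-coeff ru (regular-tail rv)) (suc n))
                    (D-⨁ b ((a ∷ u) ⧢ v) coeff (suc n)))))) ⟩
      δ n * (⨁ (u ⧢ (b ∷ v)) (λ w → D a (coeff w) (suc n)) + ⨁ ((a ∷ u) ⧢ v) (λ w → D b (coeff w) (suc n)))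
        ≡⟨ ℚ.*-distribˡ-+ (δ n) _ _ ⟩
      δ n * ⨁ (u ⧢ (b ∷ v)) (λ w → D a (coeff w) (suc n)) + δ n * ⨁ ((a ∷ u) ⧢ v) (λ w → D b (coeff w) (suc n))
        ≡⟨ cong₂ _+_ (*-⨁ (δ n) (u ⧢ (b ∷ v)) _) (*-⨁ (δ n) ((a ∷ u) ⧢ v) _) ⟩
      ⨁ (u ⧢ (b ∷ v)) (λ w → coeff (a ∷ w) (suc n)) + ⨁ ((a ∷ u) ⧢ v) (λ w → coeff (b ∷ w) (suc n))
        ≡⟨ ⨁-⧢-∷ a u b v {λ w → coeff w (suc n)} ⟨
      ⨁ ((a ∷ u) ⧢ (b ∷ v)) (λ w → coeff w (suc n)) ∎
      where
      c = conv (coeff (a ∷ u)) (coeff (b ∷ v)) (suc n)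

    -- Truncated zeta values as partial sums of coefficients.

    recipPow-suc : ∀ n s → recipPow n (suc s) ≡ δ n * recipPow n s
    recipPow-suc n s = go (suc n ℕ.^ s) {{ℕ.m^n≢0 (suc n) s}} {{ℕ.m^n≢0 (suc n) (suc s)}}
      where
      open import Data.Integer.Base using (+_)
      open import Data.Rational.Unnormalised.Base using (mkℚᵘ)
      go : ∀ p .{{_ : NonZero p}} .{{_ : NonZero (suc n ℕ.* p)}} → (+ 1 ℚ./ (suc n ℕ.* p)) ≡ δ n * (+ 1 ℚ./ p)
      go (suc p) = fromℚᵘ-* (mkℚᵘ (+ 1) n) (mkℚᵘ (+ 1) p)

    -- Each of the s letters contributes a factor 1/(n + 1), and the closing y also the sum over the
    -- next index. `D y` stops this sum at n, which makes the inequality between the indices strict.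
    coeff-word : ∀ s ss n → coeff (word (s ∷ ss)) (suc n) ≡ recipPow n (value s) * prefixSum (coeff (word ss)) n
    coeff-word (pos (suc s)) ss n = go s
      where
      go : ∀ s → coeff (x ^^ s ++ y ∷ word ss) (suc n) ≡ recipPow n (suc s) * prefixSum (coeff (word ss)) n
      go zero    = cong (_* prefixSum (coeff (word ss)) n) (sym (Convergence.recipPow-1 n))
      go (suc s) = begin
        δ n * coeff (x ^^ s ++ y ∷ word ss) (suc n)
          ≡⟨ cong (δ n *_) (go s) ⟩
        δ n * (recipPow n (suc s) * prefixSum (coeff (word ss)) n)
          ≡⟨ ℚ.*-assoc (δ n) (recipPow n (suc s)) _ ⟨
        δ n * recipPow n (suc s) * prefixSum (coeff (word ss)) n
          ≡⟨ cong (_* prefixSum (coeff (word ss)) n) (recipPow-suc n (suc s)) ⟨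
        recipPow n (suc (suc s)) * prefixSum (coeff (word ss)) n ∎

    truncated-word : ∀ ss N → truncated ss N ≡ prefixSum (coeff (word ss)) N
    truncated-word []       zero    = refl
    truncated-word []       (suc N) = trans (truncated-word [] N) (sym (ℚ.+-identityʳ _))
    truncated-word (s ∷ ss) zero    = go s
      where
      go : ∀ s → 0ℚ ≡ coeff (word (s ∷ ss)) 0
      go (pos (suc zero))    = refl
      go (pos (suc (suc s))) = refl
    truncated-word (s ∷ ss) (suc N) = cong₂ _+_ (truncated-word (s ∷ ss) N)
      (trans (cong (recipPow N (value s) *_) (truncated-word ss N)) (sym (coeff-word s ss N)))

    regular-word : ∀ ss → Regular (word ss)
    regular-word []                 = []
    regular-word (pos (suc s) ∷ ss) = go s
      where
      go : ∀ s → Regular (x ^^ s ++ y ∷ word ss)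
      go zero          = y∷ regular-word ss
      go (suc zero)    = x∷ go zero
      go (suc (suc s)) = x∷ go (suc s)

  -- Cauchy products of nonnegative series.

  module _ where
    open ℚ.≤-Reasoning

    NonNeg : (ℕ → ℚ) → Set
    NonNeg f = ∀ n → 0ℚ ≤ f n

    prefixSum-nonNeg : ∀ {f} → NonNeg f → NonNeg (prefixSum f)
    prefixSum-nonNeg f≥0 zero    = f≥0 0
    prefixSum-nonNeg f≥0 (suc n) = +-nonNeg (prefixSum-nonNeg f≥0 n) (f≥0 (suc n))

    prefixSum-mono : ∀ {f} → NonNeg f → ∀ {m n} → m ℕ.≤ n → prefixSum f m ≤ prefixSum f n
    prefixSum-mono {f} f≥0 m≤n = monotone {prefixSum f} (λ n → ≤-+ˡ (prefixSum f n) (f≥0 (suc n))) (ℕ.≤⇒≤′ m≤n)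

    coeff-nonNeg : ∀ w → NonNeg (coeff w)
    coeff-nonNeg []      zero    = 0≤1
    coeff-nonNeg []      (suc n) = ℚ.≤-refl
    coeff-nonNeg (a ∷ w) zero    = ℚ.≤-refl
    coeff-nonNeg (x ∷ w) (suc n) = *-nonNeg (recip-≥0 (suc n)) (coeff-nonNeg w (suc n))
    coeff-nonNeg (y ∷ w) (suc n) = *-nonNeg (recip-≥0 (suc n)) (prefixSum-nonNeg (coeff-nonNeg w) n)

    prefixSum-suc : ∀ f n → prefixSum f (suc n) ≡ f 0 + prefixSum (f ∘ suc) n
    prefixSum-suc f zero    = refl
    prefixSum-suc f (suc n) = trans (cong (_+ f (suc (suc n))) (prefixSum-suc f n)) (ℚ.+-assoc (f 0) _ _)

    conv-nonNeg : ∀ {f g} → NonNeg f → NonNeg g → NonNeg (conv f g)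
    conv-nonNeg f≥0 g≥0 zero    = *-nonNeg (f≥0 0) (g≥0 0)
    conv-nonNeg f≥0 g≥0 (suc n) = +-nonNeg (*-nonNeg (f≥0 0) (g≥0 (suc n))) (conv-nonNeg (f≥0 ∘ suc) g≥0 n)

    -- In the application `g` is itself a prefix sum, so that `conv f g n` is a sum over a triangle,
    -- and `B` is its value at n, so that the bound is a sum over a square.
    conv-upper : ∀ {f g B} n → NonNeg f → 0ℚ ≤ B → (∀ i → i ℕ.≤ n → g i ≤ B) → conv f g n ≤ prefixSum f n * B
    conv-upper {f} {g} {B} zero    f≥0 B≥0 g≤B = *-mono-≤ (f≥0 0) B≥0 ℚ.≤-refl (g≤B 0 ℕ.z≤n)
    conv-upper {f} {g} {B} (suc n) f≥0 B≥0 g≤B = begin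
      f 0 * g (suc n) + conv (f ∘ suc) g n
        ≤⟨ ℚ.+-mono-≤ (*-mono-≤ (f≥0 0) B≥0 ℚ.≤-refl (g≤B (suc n) ℕ.≤-refl))
             (conv-upper n (f≥0 ∘ suc) B≥0 λ i i≤n → g≤B i (ℕ.m≤n⇒m≤1+n i≤n)) ⟩
      f 0 * B + prefixSum (f ∘ suc) n * B
        ≡⟨ ℚ.*-distribʳ-+ B (f 0) (prefixSum (f ∘ suc) n) ⟨
      (f 0 + prefixSum (f ∘ suc) n) * B
        ≡⟨ cong (_* B) (prefixSum-suc f n) ⟨
      prefixSum f (suc n) * B ∎

    -- The terms with first index i > k are dropped. In the others the second index k + l - i is at
    -- least l, where `B` bounds `g` from below.
    conv-lower : ∀ {f g B} k l → NonNeg f → NonNeg g → (∀ i → l ℕ.≤ i → B ≤ g i) →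
                 prefixSum f k * B ≤ conv f g (k ℕ.+ l)
    conv-lower {f} {g} {B} zero zero f≥0 g≥0 B≤g = *-mono-≤ (f≥0 0) (g≥0 0) ℚ.≤-refl (B≤g 0 ℕ.≤-refl)
    conv-lower {f} {g} {B} zero (suc l) f≥0 g≥0 B≤g = begin
      f 0 * B
        ≤⟨ *-mono-≤ (f≥0 0) (g≥0 (suc l)) ℚ.≤-refl (B≤g (suc l) ℕ.≤-refl) ⟩
      f 0 * g (suc l)
        ≤⟨ ≤-+ˡ (f 0 * g (suc l)) (conv-nonNeg (f≥0 ∘ suc) g≥0 l) ⟩
      f 0 * g (suc l) + conv (f ∘ suc) g l ∎
    conv-lower {f} {g} {B} (suc k) l f≥0 g≥0 B≤g = begin
      prefixSum f (suc k) * B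
        ≡⟨ cong (_* B) (prefixSum-suc f k) ⟩
      (f 0 + prefixSum (f ∘ suc) k) * B
        ≡⟨ ℚ.*-distribʳ-+ B (f 0) (prefixSum (f ∘ suc) k) ⟩
      f 0 * B + prefixSum (f ∘ suc) k * B
        ≤⟨ ℚ.+-mono-≤ (*-mono-≤ (f≥0 0) (g≥0 _) ℚ.≤-refl (B≤g _ (ℕ.m≤n+m l (suc k))))
             (conv-lower k l (f≥0 ∘ suc) g≥0 B≤g) ⟩
      f 0 * g (suc k ℕ.+ l) + conv (f ∘ suc) g (k ℕ.+ l) ∎

    -- {(a, b) : a, b ≤ N} ⊆ {(a, b) : a + b ≤ n} ⊆ {(a, b) : a, b ≤ n} for n ≥ 2 N.
    cauchy-product : ∀ {f g} → NonNeg f → NonNeg g → IsCauchy (λ n → prefixSum f n * prefixSum g n) →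
      ∀ ε → 0ℚ < ε → ∃ λ N → ∀ n → N ℕ.≤ n →
      ∣ prefixSum f n * prefixSum g n - prefixSum (conv f g) n ∣ < ε
    cauchy-product {f} {g} f≥0 g≥0 c ε ε>0 = go (c ε ε>0)
      where
      p : ℕ → ℚ
      p n = prefixSum f n * prefixSum g n
      upper : ∀ n → prefixSum (conv f g) n ≤ p n
      upper n = begin
        prefixSum (conv f g) n   ≡⟨ conv-prefixSumʳ f g n ⟨
        conv f (prefixSum g) n   ≤⟨ conv-upper n f≥0 (prefixSum-nonNeg g≥0 n) (λ i → prefixSum-mono g≥0) ⟩
        p n                      ∎
      lower : ∀ N n → N ℕ.+ N ℕ.≤ n → p N ≤ prefixSum (conv f g) n
      lower N n 2N≤n = begin
        p N
          ≤⟨ conv-lower N (n ℕ.∸ N) f≥0 (prefixSum-nonNeg g≥0)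
               (λ i n∸N≤i → prefixSum-mono g≥0 (ℕ.≤-trans (ℕ.m+n≤o⇒m≤o∸n N 2N≤n) n∸N≤i)) ⟩
        conv f (prefixSum g) (N ℕ.+ (n ℕ.∸ N))
          ≡⟨ cong (conv f (prefixSum g)) (ℕ.m+[n∸m]≡n (ℕ.m+n≤o⇒m≤o N 2N≤n)) ⟩
        conv f (prefixSum g) n
          ≡⟨ conv-prefixSumʳ f g n ⟩
        prefixSum (conv f g) n ∎
      go : (∃ λ N → ∀ m n → N ℕ.≤ m → N ℕ.≤ n → ∣ p m - p n ∣ < ε) →
           ∃ λ N → ∀ n → N ℕ.≤ n → ∣ p n - prefixSum (conv f g) n ∣ < ε
      -- The triangle sum at n lies between `p N` and `p n`, so its distance from `p n` is at most
      -- `p n - p N`.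
      go (N , close) = N ℕ.+ N , λ n 2N≤n → begin-strict
        ∣ p n - prefixSum (conv f g) n ∣
          ≡⟨ ℚ.0≤p⇒∣p∣≡p (0≤q-p (upper n)) ⟩
        p n - prefixSum (conv f g) n
          ≤⟨ ℚ.+-monoʳ-≤ (p n) (ℚ.neg-antimono-≤ (lower N n 2N≤n)) ⟩
        p n - p N
          ≡⟨ ℚ.0≤p⇒∣p∣≡p (0≤q-p (ℚ.≤-trans (lower N n 2N≤n) (upper n))) ⟨
        ∣ p n - p N ∣
          <⟨ close n N (ℕ.m+n≤o⇒m≤o N 2N≤n) ℕ.≤-refl ⟩
        ε ∎

  -- From truncations to real numbers.

  module _ where
    open ≡-Reasoning

    -- Reconciles `_·_`, which multiplies by a rational number, with the repeated addition used in
    -- `Sums`.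
    ι*≡⋆ : ∀ n q → ι n * q ≡ n ⋆ q
    ι*≡⋆ zero    q = ℚ.*-zeroˡ q
    ι*≡⋆ (suc n) q = begin
      ι (suc n) * q      ≡⟨ cong (_* q) (ι-suc n) ⟩
      (1ℚ + ι n) * q     ≡⟨ ℚ.*-distribʳ-+ q 1ℚ (ι n) ⟩
      1ℚ * q + ι n * q   ≡⟨ cong₂ _+_ (ℚ.*-identityˡ q) (ι*≡⋆ n q) ⟩
      q + n ⋆ q          ∎

  isCauchy-cong : ∀ {p q} → p ≗ q → IsCauchy p → IsCauchy q
  isCauchy-cong p≗q c ε ε>0 with c ε ε>0
  ... | N , close = N , λ m n N≤m N≤n → subst₂ (λ a b → ∣ a - b ∣ < ε) (p≗q m) (p≗q n) (close m n N≤m N≤n)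

  partial : ℕ → List Letter → ℚ
  partial N w = prefixSum (coeff w) N

  partial-product : ∀ {u v} → Regular u → Regular v → IsCauchy (λ n → partial n u * partial n v) →
    ∀ ε → 0ℚ < ε → ∃ λ N → ∀ n → N ℕ.≤ n → ∣ partial n u * partial n v - ⨁ (u ⧢ v) (partial n) ∣ < ε
  partial-product {u} {v} ru rv c ε ε>0 with cauchy-product (coeff-nonNeg u) (coeff-nonNeg v) c ε ε>0
  ... | N , close = N , λ n N≤n → subst (λ q → ∣ partial n u * partial n v - q ∣ < ε)
    (trans (prefixSum-cong (conv-coeff ru rv) n) (prefixSum-⨁ (u ⧢ v) coeff n)) (close n N≤n)

  ζ[_] : ℕ → (s₁ : ℕ) → .{{_ : NonTrivial s₁}} → List ℕ⁺ → ℚ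
  ζ[ N ] s₁ ss = truncated (pos s₁ {{nonTrivial⇒nonZero s₁}} ∷ ss) N

  seq-∑ : ∀ N {B : Set} (bs : List B) g {h} → (∀ b → seq (g b) N ≡ h b) → seq (∑ bs g) N ≡ ⨁ bs h
  seq-∑ N []       g g≡h = refl
  seq-∑ N (b ∷ bs) g g≡h = cong₂ _+_ (g≡h b) (seq-∑ N bs g g≡h)

  seq-· : ∀ N c z {q} → seq z N ≡ q → seq (c · z) N ≡ c ⋆ q
  seq-· N c z refl = ι*≡⋆ c (seq z N)

  seq-ζ : ∀ N s₁ .{{_ : NonTrivial s₁}} ss → seq (ζ s₁ ss) N ≡ ζ[ N ] s₁ ss
  seq-ζ N s₁ ss = refl

  seq-*ᴿ : ∀ a b N {p q} → seq a N ≡ p → seq b N ≡ q → seq (a *ᴿ b) N ≡ p * q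
  seq-*ᴿ a b N refl refl = refl

  seq-+ᴿ : ∀ a b c d N → seq (a +ᴿ b +ᴿ c +ᴿ d) N ≡ ((seq a N + seq b N) + seq c N) + seq d N
  seq-+ᴿ a b c d N = refl

  *ᴿ≃ : ∀ {u v} → Regular u → Regular v → ∀ a b c →
    (∀ N → seq a N ≡ partial N u) → (∀ N → seq b N ≡ partial N v) → (∀ N → seq c N ≡ ⨁ (u ⧢ v) (partial N)) →
    a *ᴿ b ≃ c
  *ᴿ≃ ru rv a b c a≡ b≡ c≡ ε ε>0 =
    -- That the square sums form a Cauchy sequence is part of the real number `a *ᴿ b`.
    let N , close = partial-product ru rv (isCauchy-cong (λ N → seq-*ᴿ a b N (a≡ N) (b≡ N)) (cauchy (a *ᴿ b))) ε ε>0
    in  N , λ N′ N≤N′ → subst₂ (λ p q → ∣ p - q ∣ < ε)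
          (sym (seq-*ᴿ a b N′ (a≡ N′) (b≡ N′))) (sym (c≡ N′)) (close N′ N≤N′)

  module _ (m n j k s t : ℕ) where

    is₁ is₂ : List ℕ⁺
    is₁ = pos (suc m ℕ.+ 1) ∷ ones j
    is₂ = pos (suc n ℕ.+ 1) ∷ ones k ++ (pos (suc s) ⊕ 1) ∷ ones t

    word-is₁ : word is₁ ≡ x ^^ suc m ++ y ^^ suc j
    word-is₁ = cong₂ (λ p w → x ^^ p ++ y ∷ w) (ℕ.+-comm m 1) (word-ones j)

    word-is₂ : word is₂ ≡ x ^^ suc n ++ y ^^ suc k ++ x ^^ suc s ++ y ^^ suc t
    word-is₂ = cong₂ (λ p w → x ^^ p ++ y ∷ w) (ℕ.+-comm n 1)
      (trans (word-ones-++ k _) (cong₂ (λ p w → y ^^ k ++ x ^^ p ++ y ∷ w) (ℕ.+-comm s 1) (word-ones t)))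

    -- No limit is involved: evaluation at N commutes with finite sums and multiples, so every
    -- truncation of the right-hand side is exactly a sum over shuffles.
    seq-rhs : .{{m≢0 : NonZero (suc m)}} .{{n≢0 : NonZero (suc n)}} .{{k≢0 : NonZero (suc k)}} → ∀ z₁ z₂ z₃ z₄ →
      z₁ ≡ S₁ (λ B → ∑ {B}) _·_ ζ (suc m) (suc n) (suc j) (suc k) (suc s) (suc t) {{m≢0}} →
      z₂ ≡ S₂ (λ B → ∑ {B}) _·_ ζ (suc m) (suc n) (suc j) (suc k) (suc s) (suc t) {{n≢0}} →
      z₃ ≡ S₃ (λ B → ∑ {B}) _·_ ζ (suc m) (suc n) (suc j) (suc k) (suc s) (suc t) {{n≢0}} {{k≢0}} →
      z₄ ≡ S₄ (λ B → ∑ {B}) _·_ ζ (suc m) (suc n) (suc j) (suc k) (suc s) (suc t) {{n≢0}} {{k≢0}} →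
      ∀ N → seq (z₁ +ᴿ z₂ +ᴿ z₃ +ᴿ z₄) N ≡ ⨁ (word is₁ ⧢ word is₂) (partial N)
    seq-rhs {{m≢0}} {{n≢0}} {{k≢0}} z₁ z₂ z₃ z₄ z₁≡ z₂≡ z₃≡ z₄≡ N = trans (seq-+ᴿ z₁ z₂ z₃ z₄ N) (trans
      (sym (⨁-⧢-homomorphism (λ B → ∑ {B}) _·_ ζ (λ z → seq z N) (seq-∑ N) (seq-· N) (seq-ζ N) (partial N)
        (λ s₁ ss → sym (truncated-word (pos s₁ {{nonTrivial⇒nonZero s₁}} ∷ ss) N))
        m n j k s t {{m≢0}} {{n≢0}} {{k≢0}} z₁ z₂ z₃ z₄ z₁≡ z₂≡ z₃≡ z₄≡))
      (sym (cong₂ (λ u v → ⨁ (u ⧢ v) (partial N)) word-is₁ word-is₂)))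

open Analysis
open import Data.Nat.Base using (_+_; _∸_)

theorem1p3 : ∀ (m n j k s t : ℕ)
    .{{_ : NonZero m}} .{{_ : NonZero n}} .{{_ : NonZero j}}
    .{{_ : NonZero k}} .{{_ : NonZero s}} .{{_ : NonZero t}} →
    ζ (m + 1) {{positive+1>1 m}} (ones (j ∸ 1)) *ᴿ
    ζ (n + 1) {{positive+1>1 n}} (ones (k ∸ 1) ++ (pos s ⊕ 1) ∷ ones (t ∸ 1))
    ≃ Σ₁ m n j k s t +ᴿ Σ₂ m n j k s t +ᴿ Σ₃ m n j k s t +ᴿ Σ₄ m n j k s t
theorem1p3 m@(suc m′) n@(suc n′) j@(suc j′) k@(suc k′) s@(suc s′) t@(suc t′) {{m≢0}} {{n≢0}} {{_}} {{k≢0}} =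
  *ᴿ≃ (regular-word u) (regular-word v)
    (ζ (m + 1) {{positive+1>1 m {{m≢0}}}} (ones (j ∸ 1)))
    (ζ (n + 1) {{positive+1>1 n {{n≢0}}}} (ones (k ∸ 1) ++ (pos s ⊕ 1) ∷ ones (t ∸ 1)))
    (Σ₁ m n j k s t {{m≢0}} +ᴿ Σ₂ m n j k s t {{n≢0}} +ᴿ Σ₃ m n j k s t {{n≢0}} {{k≢0}} +ᴿ Σ₄ m n j k s t {{n≢0}} {{k≢0}})
    (truncated-word u) (truncated-word v)
    -- At `∑`, `_·_` and `ζ` the abstract sums `S₁`, ..., `S₄` are Σ₁, ..., Σ₄ by definition, whence
    -- the four `refl`.
    (seq-rhs m′ n′ j′ k′ s′ t′ {{m≢0}} {{n≢0}} {{k≢0}} (Σ₁ m n j k s t {{m≢0}}) (Σ₂ m n j k s t {{n≢0}})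
      (Σ₃ m n j k s t {{n≢0}} {{k≢0}}) (Σ₄ m n j k s t {{n≢0}} {{k≢0}}) refl refl refl refl)
  where
  u  = is₁ m′ n′ j′ k′ s′ t′
  v  = is₂ m′ n′ j′ k′ s′ t′
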